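{- Let $\mathbb{F}$ be a field of characteristic $p$ (if $p=0$, the constraint on $n$ below is void). Let $C$ be a linear regular line complex in $\mathbb{P}^3$ over $\mathbb{F}$, let $L$ be a set of $n$ lines belonging to $C$ with $n\le p^{4/3}$, and let $Q\subset \mathbb{F}^3$ be a set of $m$ points. Then the number of incidences $|\{(q,l)\in Q\times L:\ q\in l\}|$ is $O\!\left(m^{3/4}n^{1/2}+m+n\right)$, with an absolute implied constant.
   Context: $\mathbb{F}^3$ is identified with the affine chart $x_0=1$ of $\mathbb{P}^3$. A line in $\mathbb{P}^3$ through two distinct points with homogeneous coordinates $(x_0:x_1:x_2:x_3)$ and $(y_0:y_1:y_2:y_3)$ has Plücker coordinates $P_{ij}=x_iy_j-x_jy_i$, collected as $\boldsymbol P=[P_{01}:P_{02}:P_{03}:P_{23}:P_{31}:P_{12}]=[\boldsymbol\omega:\boldsymbol v]\in\mathbb{P}^5$, where $\boldsymbol\omega=(P_{01},P_{02},P_{03})$ and $\boldsymbol v=(P_{23},P_{31},P_{12})$. The images of all lines form the Klein quadric $\mathcal K=\{\boldsymbol\omega\cdot\boldsymbol v=0\}\subset\mathbb{P}^5$ ($\cdot$ the standard dot product). For $\boldsymbol N=[\boldsymbol n:\boldsymbol m]\in\mathbb{P}^5$ let $\mathcal H=\{\boldsymbol P:\ \boldsymbol N\cdot\boldsymbol P=0\}$. If $\boldsymbol N\notin\mathcal K$ (equivalently, $\mathcal H$ is not tangent to $\mathcal K$), the set of lines whose Plücker vectors lie in $\mathcal K\cap\mathcal H$ is called a linear regular line complex.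 The field is throughout assumed to have odd characteristic when $p>0$. -}

module Defs where

open import Level using (Level; _⊔_; suc)
open import Agda.Primitive using (Setω)
open import Algebra.Bundles using (CommutativeRing)
open import Data.Nat as ℕ using (ℕ; zero) renaming (suc to sucℕ)
open import Data.Fin using (Fin)
open import Data.Product using (Σ; ∃; _×_; _,_)
open import Data.Sum using (_⊎_)
open import Relation.Nullary using (¬_)
open import Relation.Binary.PropositionalEquality using (_≡_)

record Field (c ℓ : Level) : Set (suc (c ⊔ ℓ)) where
  field
    commRing : CommutativeRing c ℓ
  open CommutativeRing commRing public
  field
    1≉0     : ¬ (1# ≈ 0#)
    inverse : ∀ x → ¬ (x ≈ 0#) → Σ Carrier (λ y → x * y ≈ 1#)

module _ {c ℓ : Level} (F : Field c ℓ) where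
  open Field F

  ι : ℕ → Carrier
  ι zero     = 0#
  ι (sucℕ k) = 1# + ι k

  HasChar : ℕ → Set ℓ
  HasChar zero     = ∀ k → ¬ (ι (sucℕ k) ≈ 0#)
  HasChar (sucℕ q) = (ι (sucℕ q) ≈ 0#) × (∀ k → k ℕ.< q → ¬ (ι (sucℕ k) ≈ 0#))

  record V3 : Set c where
    constructor v3
    field a1 a2 a3 : Carrier

  record V4 : Set c where
    constructor v4
    field x0 x1 x2 x3 : Carrier

  record V6 : Set c where
    constructor v6
    field p01 p02 p03 p23 p31 p12 : Carrier

  _≈3_ : V3 → V3 → Set ℓ
  v3 a b e ≈3 v3 a' b' e' = (a ≈ a') × (b ≈ b') × (e ≈ e')

  _≈4_ : V4 → V4 → Set ℓ
  v4 a b e f ≈4 v4 a' b' e' f' = (a ≈ a') × (b ≈ b') × (e ≈ e') × (f ≈ f')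

  IsZero4 : V4 → Set ℓ
  IsZero4 x = x ≈4 v4 0# 0# 0# 0#

  _·4_ : Carrier → V4 → V4
  λ' ·4 v4 a b e f = v4 (λ' * a) (λ' * b) (λ' * e) (λ' * f)

  _+4_ : V4 → V4 → V4
  v4 a b e f +4 v4 a' b' e' f' = v4 (a + a') (b + b') (e + e') (f + f')

  DistinctProjPoints : V4 → V4 → Set (c ⊔ ℓ)
  DistinctProjPoints x y =
    ¬ IsZero4 x × ¬ IsZero4 y × ¬ (Σ Carrier λ t → y ≈4 (t ·4 x))

  record Line : Set (c ⊔ ℓ) where
    constructor line
    field
      pt₁ pt₂  : V4
      distinct : DistinctProjPoints pt₁ pt₂

  OnLineH : V4 → Line → Set (c ⊔ ℓ)
  OnLineH z (line x y _) = Σ Carrier λ a → Σ Carrier λ b → z ≈4 ((a ·4 x) +4 (b ·4 y))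

  embed : V3 → V4
  embed (v3 a b e) = v4 1# a b e

  _∈L_ : V3 → Line → Set (c ⊔ ℓ)
  q ∈L l = OnLineH (embed q) l

  SameLine : Line → Line → Set (c ⊔ ℓ)
  SameLine l (line x' y' _) = OnLineH x' l × OnLineH y' l

  plücker : Line → V6
  plücker (line (v4 x0 x1 x2 x3) (v4 y0 y1 y2 y3) _) =
    v6 (x0 * y1 - x1 * y0) (x0 * y2 - x2 * y0) (x0 * y3 - x3 * y0)
       (x2 * y3 - x3 * y2) (x3 * y1 - x1 * y3) (x1 * y2 - x2 * y1)

  dot6 : V6 → V6 → Carrier
  dot6 (v6 a b e f g h) (v6 a' b' e' f' g' h') =
    a * a' + b * b' + e * e' + f * f' + g * g' + h * h'

  -- ω · v for N = [ω : v]
  kleinForm : V6 → Carrier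
  kleinForm (v6 a b e f g h) = a * f + b * g + e * h

  -- N ∉ K (so N ≠ 0 and H is not tangent to K)
  NotOnKlein : V6 → Set ℓ
  NotOnKlein N = ¬ (kleinForm N ≈ 0#)

  InComplex : V6 → Line → Set ℓ
  InComplex N l = dot6 N (plücker l) ≈ 0#

-- existential over ℕ of a Setω-valued predicate (constant independent of
-- universe levels and of the field)
record ∃Const (P : ℕ → Setω) : Setω where
  constructor _,ω_
  field
    const : ℕ
    bound : P const

{-# OPTIONS --safe #-}

-- Choose coordinates in which the complex is P₀₃ = P₁₂. Its lines become points of 𝔽³ and the points of 𝔽³ become
-- null lines, that is, lines in a direction (1, s, s²); no two lines with P₀₁ = 0 meet in a point of Q, so these lines
-- cost at most m incidences. So let there be m null lines and n points; after pruning, every line carries at least k points and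
-- every point lies on at least r lines, where k ~ I/m and r ~ I/n, and one has to bound k³ r by a multiple of n.
--
-- Suppose that k³ r is much larger than n. Counting coefficients, there is a nonzero polynomial f of degree ~ n/k² whose
-- restriction to the light cone of each of the points vanishes there to order ~ n/k³: a jet of order v on the cone has
-- only v² coefficients. Such an f vanishes on all the lines.
--
-- Any f of degree less than p and of order kr that vanishes on all the lines is zero, because its derivatives vanish on
-- all the lines too. Indeed, near one of the points P the function F(t, s) = f(P + t(1, s, s²)) vanishes for r values of s, so its
-- coefficients of tʲ with 2j < r, which have degree at most 2j in s, are zero. Hence ∂F/∂s and ∂²F/∂s² are O(t^(r/2)).
-- Along a line this says that the derivative of f in the direction w = (0, 1, 2s) has a zero of order ~ r/2 at each of
-- the k points, so it is zero; and that λ + (t - tᵢ) κ has such a zero at the i-th point, where κ is the second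
-- derivative along w and λ is the derivative along (0, 0, 2). The Wronskian of λ + tκ and κ then has too many zeros,
-- so the two are proportional, and it follows that both are zero.
--
-- The degree of f is less than p: two points have at most two common neighbours (along null lines) among the
-- neighbours of a third point, and counting as in the Kővári–Sós–Turán theorem for K₃,₃ gives (kr)³ ≲ n²; so
-- n/k² ≲ kr ≲ n^(2/3) ≤ p^(8/9).

module Submission where

-- The lines of a regular complex form a smooth quadric threefold. The chart P₀₁ ≠ 0 maps it to 𝔽³,
-- and two lines meet exactly when y² - xz vanishes on the difference of their images. Hence the
-- null lines, and hence inversion as a tool for counting common neighbours.
--
-- Cones enter because of the count. A zero of order v in all directions of 𝔽³ costs about v³/6
-- conditions; as the degree is about kv, the order v would cancel and k³ would have to exceed a
-- multiple of n. A null line sees only the jet on the cone, so that k³v has to exceed a multiple of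
-- n, and a large v helps. The other half limits v: r slopes control about r/2 powers of t, so v can
-- be about r/4.
--
-- The directions (1, s, s²) and w span only the tangent plane of the cone. The missing direction is
-- reached through its curvature, by a second derivative in s, which brings in κ as well; the
-- Wronskian separates the two.
--
-- The degree has to stay below p for two reasons: a polynomial with vanishing derivatives must be
-- constant, and two polynomials with vanishing Wronskian must be proportional.

open import Defs using (Field)
open import Level using (_⊔_)
open import Algebra.Bundles using (CommutativeRing; RawRing)
open import Data.Empty using (⊥; ⊥-elim)
open import Data.Fin as Fin using (Fin; zero; suc)
import Data.Fin.Properties as Finₚ
open import Data.List using (List; []; _∷_; length; map; allFin; cartesianProduct)
import Data.List.Properties as Listₚ
import Data.List.Membership.DecPropositional as DecMembership
open import Data.List.Membership.Propositional using (_∈_; _∉_)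
import Data.List.Membership.Propositional.Properties as ∈ₚ
open import Data.List.Relation.Unary.All as All using (All; []; _∷_)
import Data.List.Relation.Unary.All.Properties as Allₚ
open import Data.List.Relation.Unary.AllPairs as AllPairs using (AllPairs; []; _∷_)
import Data.List.Relation.Unary.AllPairs.Properties as AllPairsₚ
open import Data.List.Relation.Unary.Any using (here; there)
open import Data.List.Relation.Unary.Unique.Propositional using (Unique)
open import Data.Maybe using (Maybe; just; nothing; maybe)
open import Data.Nat as ℕ using (ℕ; zero; suc; z≤n; s≤s; _≤_; _<_)
open import Data.Nat.Properties as ℕₚ
  using (≤-trans; ≤-reflexive; ≤-refl; <⇒≤; ≤-pred; n≤1+n; m≤m+n; m≤n+m; ≰⇒>; m≤n⇒m≤1+n; <-≤-trans; ≤-<-trans; ≮⇒≥; pred-mono-≤)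
open import Data.Product using (Σ; ∃; _×_; _,_; proj₁; proj₂)
open import Data.Product.Properties using (≡-dec)
open import Data.Sum using (_⊎_; inj₁; inj₂)
open import Data.Unit using (⊤; tt)
open import Function using (_∘_)
open import Relation.Binary using (tri<; tri≈; tri>)
open import Relation.Binary.Definitions using (WeaklyDecidable)
open import Relation.Binary.PropositionalEquality as ≡ using (_≡_; _≢_)
open import Relation.Nullary using (¬_; Dec; yes; no)
open import Relation.Nullary.Decidable using (False; _×-dec_; ¬?; decidable-stable)

-- Polynomial rings

-- The integer a - b is represented by the pair (a , b), reduced so that a or b is 0;
-- the ring solver then cancels numerals without decidable equality in R.
module IntegerSolver {c ℓ} (R : CommutativeRing c ℓ) where
  open CommutativeRing R
  open import Algebra.Properties.Ring ring
  open import Algebra.Properties.AbelianGroup +-abelianGroup using (⁻¹-∙-comm)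
  open import Algebra.Properties.Semiring.Mult semiring using (×-homo-+; ×1-homo-*) renaming (_×_ to _·ₙ_)
  open import Algebra.Properties.CommutativeSemigroup +-commutativeSemigroup using (interchange)
  open import Algebra.Solver.Ring.AlmostCommutativeRing
  open import Relation.Binary.Reasoning.Setoid setoid

  ⟦_⟧ : ℕ × ℕ → Carrier
  ⟦ a , b ⟧ = (a ·ₙ 1#) + - (b ·ₙ 1#)

  -- Agrees with ⟦_⟧ up to ≈; the numerals 0 and 1 must evaluate definitionally to 0# and 1#.
  ⟦_⟧′ : ℕ × ℕ → Carrier
  ⟦ 0 , 0 ⟧′ = 0#
  ⟦ 1 , 0 ⟧′ = 1#
  ⟦ p ⟧′     = ⟦ p ⟧

  reduce : ℕ × ℕ → ℕ × ℕ
  reduce (suc a , suc b) = reduce (a , b)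
  reduce p               = p

  Coeff : RawRing _ _
  Coeff = record
    { Carrier = ℕ × ℕ
    ; _≈_ = _≡_
    ; _+_ = λ { (a , b) (a′ , b′) → reduce (a ℕ.+ a′ , b ℕ.+ b′) }
    ; _*_ = λ { (a , b) (a′ , b′) → reduce (a ℕ.* a′ ℕ.+ b ℕ.* b′ , a ℕ.* b′ ℕ.+ b ℕ.* a′) }
    ; -_ = λ { (a , b) → b , a }
    ; 0# = 0 , 0
    ; 1# = 1 , 0
    }

  private
    diff-+ : ∀ x y u v → (x + u) + - (y + v) ≈ (x + - y) + (u + - v)
    diff-+ x y u v = begin
      (x + u) + - (y + v)     ≈⟨ +-congˡ (⁻¹-∙-comm y v) ⟨
      (x + u) + (- y + - v)   ≈⟨ interchange x u (- y) (- v) ⟩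
      (x + - y) + (u + - v)   ∎

    diff-* : ∀ x y u v → (x * u + y * v) + - (x * v + y * u) ≈ (x + - y) * (u + - v)
    diff-* x y u v = begin
      (x * u + y * v) + - (x * v + y * u)         ≈⟨ diff-+ _ _ _ _ ⟩
      (x * u + - (x * v)) + (y * v + - (y * u))   ≈⟨ +-cong (+-congˡ (-‿distribʳ-* x v)) (+-comm _ _) ⟩
      (x * u + x * - v) + (- (y * u) + y * v)     ≈⟨ +-cong (distribˡ x u (- v)) step ⟨
      x * (u + - v) + - y * (u + - v)             ≈⟨ distribʳ _ _ _ ⟨
      (x + - y) * (u + - v)                       ∎
      where
      step : - y * (u + - v) ≈ - (y * u) + y * v
      step = begin
        - y * (u + - v)         ≈⟨ distribˡ _ _ _ ⟩
        - y * u + - y * - v     ≈⟨ +-cong (sym (-‿distribˡ-* y u)) (sym (-‿distribˡ-* y (- v))) ⟩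
        - (y * u) + - (y * - v) ≈⟨ +-congˡ (-‿cong (sym (-‿distribʳ-* y v))) ⟩
        - (y * u) + - - (y * v) ≈⟨ +-congˡ (-‿involutive _) ⟩
        - (y * u) + y * v       ∎

  private
    ⟦⟧′≈ : ∀ p → ⟦ p ⟧′ ≈ ⟦ p ⟧
    ⟦⟧′≈ (0 , 0)           = sym (-‿inverseʳ 0#)
    ⟦⟧′≈ (1 , 0)           = sym (trans (+-cong (+-identityʳ 1#) -0#≈0#) (+-identityʳ 1#))
    ⟦⟧′≈ (0 , suc _)       = refl
    ⟦⟧′≈ (1 , suc _)       = refl
    ⟦⟧′≈ (suc (suc _) , _) = refl

    module Co = RawRing Coeff

    ⟦⟧-reduce : ∀ p → ⟦ reduce p ⟧ ≈ ⟦ p ⟧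
    ⟦⟧-reduce (suc a , suc b) = trans (⟦⟧-reduce (a , b))
      (sym (trans (diff-+ 1# 1# _ _) (trans (+-congʳ (-‿inverseʳ 1#)) (+-identityˡ _))))
    ⟦⟧-reduce (zero  , b)     = refl
    ⟦⟧-reduce (suc a , zero)  = refl

    ⟦⟧-+ : ∀ p q → ⟦ p Co.+ q ⟧ ≈ ⟦ p ⟧ + ⟦ q ⟧
    ⟦⟧-+ (a , b) (a′ , b′) = trans (⟦⟧-reduce (a ℕ.+ a′ , b ℕ.+ b′))
      (trans (+-cong (×-homo-+ 1# a a′) (-‿cong (×-homo-+ 1# b b′))) (diff-+ _ _ _ _))

    ⟦⟧-* : ∀ p q → ⟦ p Co.* q ⟧ ≈ ⟦ p ⟧ * ⟦ q ⟧
    ⟦⟧-* (a , b) (a′ , b′) = trans (⟦⟧-reduce (a ℕ.* a′ ℕ.+ b ℕ.* b′ , a ℕ.* b′ ℕ.+ b ℕ.* a′))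
      (trans (+-cong (trans (×-homo-+ 1# (a ℕ.* a′) _) (+-cong (×1-homo-* a a′) (×1-homo-* b b′)))
                    (-‿cong (trans (×-homo-+ 1# (a ℕ.* b′) _) (+-cong (×1-homo-* a b′) (×1-homo-* b a′)))))
            (diff-* _ _ _ _))

    ⟦⟧-neg : ∀ p → ⟦ Co.- p ⟧ ≈ - ⟦ p ⟧
    ⟦⟧-neg (a , b) = begin
      (b ·ₙ 1#) + - (a ·ₙ 1#)      ≈⟨ +-comm _ _ ⟩
      - (a ·ₙ 1#) + (b ·ₙ 1#)      ≈⟨ +-congˡ (-‿involutive _) ⟨
      - (a ·ₙ 1#) + - - (b ·ₙ 1#)  ≈⟨ ⁻¹-∙-comm _ _ ⟩
      - ((a ·ₙ 1#) + - (b ·ₙ 1#))  ∎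

  morphism : Coeff -Raw-AlmostCommutative⟶ fromCommutativeRing R
  morphism = record
    { ⟦_⟧ = ⟦_⟧′
    ; +-homo = λ p q → trans (⟦⟧′≈ (p Co.+ q)) (trans (⟦⟧-+ p q) (sym (+-cong (⟦⟧′≈ p) (⟦⟧′≈ q))))
    ; *-homo = λ p q → trans (⟦⟧′≈ (p Co.* q)) (trans (⟦⟧-* p q) (sym (*-cong (⟦⟧′≈ p) (⟦⟧′≈ q))))
    ; -‿homo = λ p → trans (⟦⟧′≈ (Co.- p)) (trans (⟦⟧-neg p) (sym (-‿cong (⟦⟧′≈ p))))
    ; 0-homo = refl
    ; 1-homo = refl
    }

  private
    -- A sound test only: numerals equal as integers have equal images, while numerals that agree
    -- merely because of the characteristic are answered by `nothing`.
    coeff≟ : WeaklyDecidable (Induced-equivalence morphism)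
    coeff≟ (a , b) (a′ , b′) with a ℕ.+ b′ ℕ.≟ a′ ℕ.+ b
    ... | no _  = nothing
    ... | yes e = just (trans (⟦⟧′≈ (a , b)) (trans (begin
      (a ·ₙ 1#) + - (b ·ₙ 1#)
        ≈⟨ +-identityʳ _ ⟨
      ((a ·ₙ 1#) + - (b ·ₙ 1#)) + 0#
        ≈⟨ +-congˡ (-‿inverseʳ _) ⟨
      ((a ·ₙ 1#) + - (b ·ₙ 1#)) + ((b′ ·ₙ 1#) + - (b′ ·ₙ 1#))
        ≈⟨ diff-+ _ _ _ _ ⟨
      ((a ·ₙ 1#) + (b′ ·ₙ 1#)) + - ((b ·ₙ 1#) + (b′ ·ₙ 1#))
        ≈⟨ +-cong (trans (sym (×-homo-+ 1# a b′)) (trans (reflexive (≡.cong (_·ₙ 1#) e)) (×-homo-+ 1# a′ b)))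
                  (-‿cong (+-comm _ _)) ⟩
      ((a′ ·ₙ 1#) + (b ·ₙ 1#)) + - ((b′ ·ₙ 1#) + (b ·ₙ 1#))
        ≈⟨ diff-+ _ _ _ _ ⟩
      ((a′ ·ₙ 1#) + - (b′ ·ₙ 1#)) + ((b ·ₙ 1#) + - (b ·ₙ 1#))
        ≈⟨ +-congˡ (-‿inverseʳ _) ⟩
      ((a′ ·ₙ 1#) + - (b′ ·ₙ 1#)) + 0#
        ≈⟨ +-identityʳ _ ⟩
      (a′ ·ₙ 1#) + - (b′ ·ₙ 1#) ∎) (sym (⟦⟧′≈ (a′ , b′)))))

  open import Algebra.Solver.Ring Coeff (fromCommutativeRing R) morphism coeff≟ public
    using (Polynomial; con; _:+_; _:*_; _:-_; :-_; solve; _:=_)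

  :0 :1 : ∀ {n} → Polynomial n
  :0 = con (0 , 0)
  :1 = con (1 , 0)

record Hom {a ℓ a′ ℓ′} (A : CommutativeRing a ℓ) (B : CommutativeRing a′ ℓ′) : Set (a ⊔ ℓ ⊔ a′ ⊔ ℓ′) where
  private
    module A = CommutativeRing A
    module B = CommutativeRing B
  field
    fn     : A.Carrier → B.Carrier
    cong   : ∀ {x y} → x A.≈ y → fn x B.≈ fn y
    +-homo : ∀ x y → fn (x A.+ y) B.≈ fn x B.+ fn y
    *-homo : ∀ x y → fn (x A.* y) B.≈ fn x B.* fn y
    0-homo : fn A.0# B.≈ B.0#
    1-homo : fn A.1# B.≈ B.1#

record Derivation {a ℓ} (A : CommutativeRing a ℓ) : Set (a ⊔ ℓ) where
  open CommutativeRing A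
  field
    D      : Carrier → Carrier
    D-cong : ∀ {x y} → x ≈ y → D x ≈ D y
    D-+    : ∀ x y → D (x + y) ≈ D x + D y
    D-*    : ∀ x y → D (x * y) ≈ D x * y + x * D y

  open import Algebra.Properties.Group +-group using (identityˡ-unique)
  open import Relation.Binary.Reasoning.Setoid setoid

  D-0 : D 0# ≈ 0#
  D-0 = identityˡ-unique (D 0#) (D 0#) (trans (sym (D-+ 0# 0#)) (D-cong (+-identityʳ 0#)))

  D-1 : D 1# ≈ 0#
  D-1 = identityˡ-unique (D 1#) (D 1#) (begin
    D 1# + D 1#             ≈⟨ +-cong (*-identityʳ _) (*-identityˡ _) ⟨
    D 1# * 1# + 1# * D 1#   ≈⟨ D-* 1# 1# ⟨
    D (1# * 1#)             ≈⟨ D-cong (*-identityʳ 1#) ⟩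
    D 1#                    ∎)

module Sequences {a ℓ} (A : CommutativeRing a ℓ) where
  open CommutativeRing A
  open IntegerSolver A
  open import Algebra.Properties.Semiring.Mult semiring using (×-congʳ; ×-homo-+; ×-comm-*; ×-assoc-*) renaming (_×_ to _·ₙ_) public
  open import Relation.Binary.Reasoning.Setoid setoid

  Seq : Set a
  Seq = ℕ → Carrier

  VanishesFrom : ℕ → Seq → Set ℓ
  VanishesFrom n f = ∀ i → n ≤ i → f i ≈ 0#

  VanishesFrom-mono : ∀ {m n f} → m ≤ n → VanishesFrom m f → VanishesFrom n f
  VanishesFrom-mono m≤n v i n≤i = v i (≤-trans m≤n n≤i)

  tail-vanishes : ∀ {n f} → VanishesFrom (suc n) f → VanishesFrom n (f ∘ suc)
  tail-vanishes v i n≤i = v (suc i) (s≤s n≤i)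

  ·ₙ-zero : ∀ n {x} → x ≈ 0# → n ·ₙ x ≈ 0#
  ·ₙ-zero zero    e = refl
  ·ₙ-zero (suc n) e = trans (+-cong e (·ₙ-zero n e)) (+-identityʳ 0#)

  ·ₙ-+ : ∀ n x y → n ·ₙ (x + y) ≈ n ·ₙ x + n ·ₙ y
  ·ₙ-+ zero    x y = sym (+-identityʳ 0#)
  ·ₙ-+ (suc n) x y = trans (+-congˡ (·ₙ-+ n x y))
    (solve 4 (λ x y u v → (x :+ y) :+ (u :+ v) := (x :+ u) :+ (y :+ v)) refl x y (n ·ₙ x) (n ·ₙ y))

  conv : Seq → Seq → Seq
  conv f g zero    = f 0 * g 0
  conv f g (suc n) = f 0 * g (suc n) + conv (f ∘ suc) g n

  conv-cong : ∀ {f f′ g g′ : Seq} → (∀ i → f i ≈ f′ i) → (∀ i → g i ≈ g′ i) → ∀ n → conv f g n ≈ conv f′ g′ n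
  conv-cong p q zero    = *-cong (p 0) (q 0)
  conv-cong p q (suc n) = +-cong (*-cong (p 0) (q (suc n))) (conv-cong (p ∘ suc) q n)

  conv-+ˡ : ∀ f f′ g n → conv (λ i → f i + f′ i) g n ≈ conv f g n + conv f′ g n
  conv-+ˡ f f′ g zero    = distribʳ _ _ _
  conv-+ˡ f f′ g (suc n) = trans (+-cong (distribʳ _ _ _) (conv-+ˡ (f ∘ suc) (f′ ∘ suc) g n))
    (solve 4 (λ x y u v → (x :+ y) :+ (u :+ v) := (x :+ u) :+ (y :+ v)) refl _ _ _ _)

  conv-scaleˡ : ∀ c f g n → conv (λ i → c * f i) g n ≈ c * conv f g n
  conv-scaleˡ c f g zero    = *-assoc _ _ _
  conv-scaleˡ c f g (suc n) = trans (+-cong (*-assoc _ _ _) (conv-scaleˡ c (f ∘ suc) g n)) (sym (distribˡ _ _ _))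

  conv-zeroˡ : ∀ {f} g → (∀ i → f i ≈ 0#) → ∀ n → conv f g n ≈ 0#
  conv-zeroˡ g z zero    = trans (*-congʳ (z 0)) (zeroˡ _)
  conv-zeroˡ g z (suc n) = trans (+-cong (trans (*-congʳ (z 0)) (zeroˡ _)) (conv-zeroˡ g (z ∘ suc) n))
      (+-identityʳ 0#)

  conv-suc : ∀ f g n → conv f g (suc n) ≈ f (suc n) * g 0 + conv f (g ∘ suc) n
  conv-suc f g zero    = +-comm _ _
  conv-suc f g (suc n) = trans (+-congˡ (conv-suc (f ∘ suc) g n))
    (solve 3 (λ x y z → x :+ (y :+ z) := y :+ (x :+ z)) refl _ _ _)

  conv-comm : ∀ f g n → conv f g n ≈ conv g f n
  conv-comm f g zero    = *-comm _ _
  conv-comm f g (suc n) = trans (+-cong (*-comm _ _) (conv-comm (f ∘ suc) g n)) (sym (conv-suc g f n))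

  conv-assoc : ∀ f g h n → conv (conv f g) h n ≈ conv f (conv g h) n
  conv-assoc f g h zero    = *-assoc _ _ _
  conv-assoc f g h (suc n) = begin
    (f 0 * g 0) * h (suc n) + conv (λ i → f 0 * g (suc i) + conv (f ∘ suc) g i) h n
      ≈⟨ +-cong (*-assoc _ _ _) (conv-+ˡ (λ i → f 0 * g (suc i)) (conv (f ∘ suc) g) h n) ⟩
    f 0 * (g 0 * h (suc n)) + (conv (λ i → f 0 * g (suc i)) h n + conv (conv (f ∘ suc) g) h n)
      ≈⟨ +-congˡ (+-cong (conv-scaleˡ (f 0) (g ∘ suc) h n) (conv-assoc (f ∘ suc) g h n)) ⟩
    f 0 * (g 0 * h (suc n)) + (f 0 * conv (g ∘ suc) h n + conv (f ∘ suc) (conv g h) n)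
      ≈⟨ solve 4 (λ x y z w → x :* y :+ (x :* z :+ w) := x :* (y :+ z) :+ w) refl _ _ _ _ ⟩
    f 0 * (g 0 * h (suc n) + conv (g ∘ suc) h n) + conv (f ∘ suc) (conv g h) n ∎

  -- The bounds count coefficients and so exceed the degrees by one: degree at most m times degree
  -- below n has degree below m + n. The asymmetry keeps the bound sharp and still covers n = 0.
  conv-vanishes : ∀ m n f g → VanishesFrom (suc m) f → VanishesFrom n g → VanishesFrom (m ℕ.+ n) (conv f g)
  conv-vanishes m       n f g vf vg zero    le rewrite ℕₚ.m+n≡0⇒n≡0 m (ℕₚ.n≤0⇒n≡0 le) = trans (*-congˡ
      (vg 0 z≤n)) (zeroʳ _)
  conv-vanishes zero    n f g vf vg (suc i) le =
    trans (+-cong (trans (*-congˡ (vg (suc i) le)) (zeroʳ _)) (conv-zeroˡ g (λ j → vf (suc j) (s≤s z≤n)) i))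
        (+-identityʳ 0#)
  conv-vanishes (suc m) n f g vf vg (suc i) (s≤s le) =
    trans (+-cong (trans (*-congˡ (vg (suc i) (≤-trans (m≤n+m n m) (m≤n⇒m≤1+n le)))) (zeroʳ _))
                  (conv-vanishes m n (f ∘ suc) g (tail-vanishes vf) vg i le))
          (+-identityʳ 0#)

  one : Seq
  one zero    = 1#
  one (suc _) = 0#

  conv-identityˡ : ∀ f n → conv one f n ≈ f n
  conv-identityˡ f zero    = *-identityˡ _
  conv-identityˡ f (suc n) = trans (+-cong (*-identityˡ _) (conv-zeroˡ f (λ _ → refl) n)) (+-identityʳ _)

  deriv : Seq → Seq
  deriv f i = suc i ·ₙ f (suc i)

  deriv-vanishes : ∀ {n f} → VanishesFrom n f → VanishesFrom n (deriv f)
  deriv-vanishes v i n≤i = ·ₙ-zero (suc i) (v (suc i) (m≤n⇒m≤1+n n≤i))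

  conv-·ₙ : ∀ f g n → conv (λ i → i ·ₙ f i) g (suc n) ≈ conv (deriv f) g n
  conv-·ₙ f g n = trans (+-congʳ (zeroˡ _)) (+-identityˡ _)

  -- Leibniz rule, by induction on n through `deriv f = f′ + θ f′`, where θ multiplies the i-th
  -- coefficient by i. The summand f′ accounts for the shift in the recursion of `conv`.
  deriv-conv : ∀ f g n → deriv (conv f g) n ≈ conv (deriv f) g n + conv f (deriv g) n
  deriv-conv f g zero = begin
    (f 0 * g 1 + f 1 * g 0) + 0#
      ≈⟨ solve 4 (λ x y z w → (x :* y :+ z :* w) :+ :0 := (z :+ :0) :* w :+ x :* (y :+ :0)) refl _ _ _ _ ⟩
    (f 1 + 0#) * g 0 + f 0 * (g 1 + 0#) ∎
  deriv-conv f g (suc n) = begin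
    suc (suc n) ·ₙ (f 0 * g (suc (suc n)) + conv f′ g (suc n))
      ≈⟨ ·ₙ-+ (suc (suc n)) _ _ ⟩
    suc (suc n) ·ₙ (f 0 * g (suc (suc n))) + (conv f′ g (suc n) + suc n ·ₙ conv f′ g (suc n))
      ≈⟨ +-cong (×-comm-* (suc (suc n)) _ _) (+-congˡ (sym (deriv-conv f′ g n))) ⟨
    f 0 * (suc (suc n) ·ₙ g (suc (suc n))) + (conv f′ g (suc n) + (conv (deriv f′) g n + conv f′ (deriv g) n))
      ≈⟨ solve 4 (λ x y z w → x :+ (y :+ (z :+ w)) := (y :+ z) :+ (x :+ w)) refl _ _ _ _ ⟩
    (conv f′ g (suc n) + conv (deriv f′) g n) + (f 0 * deriv g (suc n) + conv f′ (deriv g) n)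
      ≈⟨ +-congʳ (+-congˡ (conv-·ₙ f′ g n)) ⟨
    (conv f′ g (suc n) + conv (λ i → i ·ₙ f′ i) g (suc n)) + (f 0 * deriv g (suc n) + conv f′ (deriv g) n)
      ≈⟨ +-congʳ (conv-+ˡ f′ (λ i → i ·ₙ f′ i) g (suc n)) ⟨
    conv (deriv f) g (suc n) + conv f (deriv g) (suc n) ∎
    where
    f′ : Seq
    f′ = f ∘ suc

  horner : ℕ → Carrier → Seq → Carrier
  horner zero    x f = 0#
  horner (suc n) x f = f 0 + x * horner n x (f ∘ suc)

  horner-cong : ∀ n {x y} {f g : Seq} → x ≈ y → (∀ i → f i ≈ g i) → horner n x f ≈ horner n y g
  horner-cong zero    e p = refl
  horner-cong (suc n) e p = +-cong (p 0) (*-cong e (horner-cong n e (p ∘ suc)))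

  horner-congʳ : ∀ n {x} {f g : Seq} → (∀ i → f i ≈ g i) → horner n x f ≈ horner n x g
  horner-congʳ n = horner-cong n refl

  horner-zero : ∀ n x {f} → (∀ i → f i ≈ 0#) → horner n x f ≈ 0#
  horner-zero zero    x z = refl
  horner-zero (suc n) x z = trans (+-cong (z 0) (trans (*-congˡ (horner-zero n x (z ∘ suc))) (zeroʳ x)))
      (+-identityʳ 0#)

  horner-+ : ∀ n x f g → horner n x (λ i → f i + g i) ≈ horner n x f + horner n x g
  horner-+ zero    x f g = sym (+-identityʳ 0#)
  horner-+ (suc n) x f g = trans (+-congˡ (*-congˡ (horner-+ n x (f ∘ suc) (g ∘ suc))))
    (solve 5 (λ a b x u v → (a :+ b) :+ x :* (u :+ v) := (a :+ x :* u) :+ (b :+ x :* v)) refl _ _ _ _ _)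

  horner-*ˡ : ∀ n x c f → horner n x (λ i → c * f i) ≈ c * horner n x f
  horner-*ˡ zero    x c f = sym (zeroʳ c)
  horner-*ˡ (suc n) x c f = trans (+-congˡ (*-congˡ (horner-*ˡ n x c (f ∘ suc))))
    (solve 4 (λ c a x u → c :* a :+ x :* (c :* u) := c :* (a :+ x :* u)) refl _ _ _ _)

  horner-·ₙ : ∀ n x k f → horner n x (λ i → k ·ₙ f i) ≈ k ·ₙ horner n x f
  horner-·ₙ n x zero    f = horner-zero n x (λ _ → refl)
  horner-·ₙ n x (suc k) f = trans (horner-+ n x f (λ i → k ·ₙ f i)) (+-congˡ (horner-·ₙ n x k f))

  horner-extend : ∀ {m n} x f → VanishesFrom m f → m ≤ n → horner n x f ≈ horner m x f
  horner-extend {n = n} x f v z≤n       = horner-zero n x (λ i → v i z≤n)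
  horner-extend         x f v (s≤s m≤n) = +-congˡ (*-congˡ (horner-extend x (f ∘ suc) (tail-vanishes v) m≤n))

  horner-conv : ∀ m n x f g → VanishesFrom m f → VanishesFrom n g →
                horner (m ℕ.+ n) x (conv f g) ≈ horner m x f * horner n x g
  horner-conv zero    n x f g vf vg = trans (horner-zero n x (conv-zeroˡ g (λ i → vf i z≤n))) (sym (zeroˡ _))
  horner-conv (suc m) n x f g vf vg = begin
    f 0 * g 0 + x * horner (m ℕ.+ n) x (λ i → f 0 * g (suc i) + conv (f ∘ suc) g i)
      ≈⟨ +-congˡ (*-congˡ (horner-+ (m ℕ.+ n) x (λ i → f 0 * g (suc i)) (conv (f ∘ suc) g))) ⟩
    f 0 * g 0 + x * (horner (m ℕ.+ n) x (λ i → f 0 * g (suc i)) + horner (m ℕ.+ n) x (conv (f ∘ suc) g))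
      ≈⟨ +-congˡ (*-congˡ (+-cong (horner-*ˡ (m ℕ.+ n) x (f 0) (g ∘ suc)) (horner-conv m n x (f ∘ suc) g
          (tail-vanishes vf) vg))) ⟩
    f 0 * g 0 + x * (f 0 * horner (m ℕ.+ n) x (g ∘ suc) + horner m x (f ∘ suc) * horner n x g)
      ≈⟨ solve 6 (λ a b x u v w → a :* b :+ x :* (a :* u :+ v :* w) := a :*
          (b :+ x :* u) :+ x :* v :* w) refl _ _ _ _ _ _ ⟩
    f 0 * horner (suc (m ℕ.+ n)) x g + x * horner m x (f ∘ suc) * horner n x g
      ≈⟨ +-congʳ (*-congˡ (horner-extend x g vg (m≤n⇒m≤1+n (m≤n+m n m)))) ⟩
    f 0 * horner n x g + x * horner m x (f ∘ suc) * horner n x g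
      ≈⟨ distribʳ _ _ _ ⟨
    (f 0 + x * horner m x (f ∘ suc)) * horner n x g ∎

  module _ (𝒟 : Derivation A) where
    open Derivation 𝒟

    -- The coefficients need not be constants of D, hence the first summand: in a nested evaluation
    -- they are themselves polynomials in the other variables.
    horner-chain : ∀ n x f → VanishesFrom n f → D (horner n x f) ≈ horner n x (D ∘ f) + horner n x (deriv f) * D x
    horner-chain zero    x f v = trans D-0 (solve 1 (λ y → :0 := :0 :+ :0 :* y) refl (D x))
    horner-chain (suc n) x f v = begin
      D (f 0 + x * horner n x f′)
        ≈⟨ trans (D-+ _ _) (+-congˡ (D-* _ _)) ⟩
      D (f 0) + (D x * horner n x f′ + x * D (horner n x f′))
        ≈⟨ +-congˡ (+-cong (*-congˡ (sym shift)) (*-congˡ (horner-chain n x f′ (tail-vanishes v)))) ⟩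
      D (f 0) + (D x * horner (suc n) x f′ + x * (horner n x (D ∘ f′) + horner n x (deriv f′) * D x))
        ≈⟨ solve 6 (λ a d h x u w → a :+ (d :* h :+ x :* (u :+ w :* d)) := (a :+ x :* u) :+ (h :+
            (:0 :+ x :* w)) :* d) refl _ _ _ _ _ _ ⟩
      horner (suc n) x (D ∘ f) + (horner (suc n) x f′ + horner (suc n) x (λ i → i ·ₙ f′ i)) * D x
        ≈⟨ +-congˡ (*-congʳ (horner-+ (suc n) x f′ (λ i → i ·ₙ f′ i))) ⟨
      horner (suc n) x (D ∘ f) + horner (suc n) x (deriv f) * D x ∎
      where
      f′ : Seq
      f′ = f ∘ suc
      shift : horner (suc n) x f′ ≈ horner n x f′
      shift = horner-extend x f′ (tail-vanishes v) (n≤1+n n)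

    D-·ₙ : ∀ n x → D (n ·ₙ x) ≈ n ·ₙ D x
    D-·ₙ zero    x = D-0
    D-·ₙ (suc n) x = trans (D-+ _ _) (+-congˡ (D-·ₙ n x))

    D-conv : ∀ f g n → D (conv f g n) ≈ conv (D ∘ f) g n + conv f (D ∘ g) n
    D-conv f g zero    = D-* _ _
    D-conv f g (suc n) = trans (D-+ _ _) (trans (+-cong (D-* _ _) (D-conv (f ∘ suc) g n))
      (solve 4 (λ x y u v → (x :+ y) :+ (u :+ v) := (x :+ u) :+ (y :+ v)) refl _ _ _ _))

-- A degree cannot be computed without deciding equality, so a polynomial carries some bound `size`
-- on its number of coefficients, and `PolyEq` disregards it.
record Poly {a ℓ} (A : CommutativeRing a ℓ) : Set (a ⊔ ℓ) where
  no-eta-equality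
  constructor poly
  open CommutativeRing A using (Carrier)
  field
    coef   : ℕ → Carrier
    size   : ℕ
    bounded : Sequences.VanishesFrom A size coef

open Poly public

record PolyEq {a ℓ} (A : CommutativeRing a ℓ) (p q : Poly A) : Set ℓ where
  constructor mk≈
  open CommutativeRing A using (_≈_)
  field
    coef≈ : ∀ i → coef p i ≈ coef q i

open PolyEq public

module PolyOperations {a ℓ} (A : CommutativeRing a ℓ) where
  open CommutativeRing A
  open Sequences A
  open import Algebra.Properties.Ring ring using (-0#≈0#)

  opaque
    infixl 6 _+ₚ_
    infixl 7 _*ₚ_

    _+ₚ_ _*ₚ_ : Poly A → Poly A → Poly A
    p +ₚ q = poly (λ i → coef p i + coef q i) (size p ℕ.⊔ size q)
      (λ i le → trans (+-cong (bounded p i (≤-trans (ℕₚ.m≤m⊔n _ _) le)) (bounded q i (≤-trans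
          (ℕₚ.m≤n⊔m _ _) le))) (+-identityʳ 0#))
    p *ₚ q = poly (conv (coef p) (coef q)) (size p ℕ.+ size q)
      (conv-vanishes (size p) (size q) _ _ (VanishesFrom-mono (n≤1+n _) (bounded p)) (bounded q))

    negₚ ∂ₚ : Poly A → Poly A
    negₚ p = poly (λ i → - coef p i) (size p) (λ i le → trans (-‿cong (bounded p i le)) -0#≈0#)
    ∂ₚ p = poly (deriv (coef p)) (size p) (deriv-vanishes (bounded p))

    const : Carrier → Poly A
    const c = poly (λ { zero → c ; (suc _) → 0# }) 1 (λ { (suc i) _ → refl })

    zeroₚ oneₚ X : Poly A
    zeroₚ = poly (λ _ → 0#) 0 (λ _ _ → refl)
    oneₚ = poly one 1 (λ { (suc i) _ → refl })
    X = poly (λ { zero → 0# ; (suc i) → one i }) 2 (λ { (suc (suc i)) _ → refl ; (suc zero) (s≤s ()) })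

    coef-+ : ∀ p q i → coef (p +ₚ q) i ≈ coef p i + coef q i
    coef-+ p q i = refl

    coef-* : ∀ p q i → coef (p *ₚ q) i ≈ conv (coef p) (coef q) i
    coef-* p q i = refl

    coef-neg : ∀ p i → coef (negₚ p) i ≈ - coef p i
    coef-neg p i = refl

    coef-∂ : ∀ p i → coef (∂ₚ p) i ≈ deriv (coef p) i
    coef-∂ p i = refl

    coef-0 : ∀ i → coef zeroₚ i ≈ 0#
    coef-0 i = refl

    coef-1 : ∀ i → coef oneₚ i ≈ one i
    coef-1 i = refl

    const-zero : ∀ c → coef (const c) 0 ≈ c
    const-zero c = refl

    const-suc : ∀ c i → coef (const c) (suc i) ≈ 0#
    const-suc c i = refl

    X-zero : coef X 0 ≈ 0#
    X-zero = refl

    X-suc : ∀ i → coef X (suc i) ≈ one i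
    X-suc i = refl

  private
    poly-ext : ∀ {p q : Poly A} {f g : Seq} → (∀ i → coef p i ≈ f i) → (∀ i → coef q i ≈ g i) →
        (∀ i → f i ≈ g i) → PolyEq A p q
    poly-ext e e′ h = mk≈ λ i → trans (e i) (trans (h i) (sym (e′ i)))

    +-seq : ∀ {p q : Poly A} {f g : Seq} → (∀ i → coef p i ≈ f i) → (∀ i → coef q i ≈ g i) → ∀ i → coef
        (p +ₚ q) i ≈ f i + g i
    +-seq e e′ i = trans (coef-+ _ _ i) (+-cong (e i) (e′ i))

    *-seq : ∀ {p q : Poly A} {f g : Seq} → (∀ i → coef p i ≈ f i) → (∀ i → coef q i ≈ g i) → ∀ i → coef
        (p *ₚ q) i ≈ conv f g i
    *-seq e e′ i = trans (coef-* _ _ i) (conv-cong e e′ i)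

    id-seq : ∀ (p : Poly A) i → coef p i ≈ coef p i
    id-seq p i = refl

    conv-distribˡ : ∀ f g h i → conv f (λ j → g j + h j) i ≈ conv f g i + conv f h i
    conv-distribˡ f g h i = trans (conv-comm f _ i) (trans (conv-+ˡ g h f i) (+-cong (conv-comm g f i)
        (conv-comm h f i)))

  polyRing : CommutativeRing _ ℓ
  polyRing = record
    { Carrier = Poly A
    ; _≈_ = PolyEq A
    ; _+_ = _+ₚ_
    ; _*_ = _*ₚ_
    ; -_ = negₚ
    ; 0# = zeroₚ
    ; 1# = oneₚ
    ; isCommutativeRing = record
      { isRing = record
        { +-isAbelianGroup = record
          { isGroup = record
            { isMonoid = record
              { isSemigroup = record
                { isMagma = record
                  { isEquivalence = record
                    { refl = mk≈ (λ i → refl)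
                    ; sym = λ e → mk≈ (λ i → sym (coef≈ e i))
                    ; trans = λ e e′ → mk≈ (λ i → trans (coef≈ e i) (coef≈ e′ i)) }
                  ; ∙-cong = λ {p} {q} {r} {s} e e′ → poly-ext (coef-+ p r) (coef-+ q s) (λ i → +-cong
                      (coef≈ e i) (coef≈ e′ i)) }
                ; assoc = λ p q r → poly-ext (+-seq (coef-+ p q) (id-seq r)) (+-seq (id-seq p) (coef-+ q r))
                    (λ i → +-assoc _ _ _) }
              ; identity = (λ p → poly-ext (+-seq coef-0 (id-seq p)) (id-seq p) (λ i → +-identityˡ _))
                         , (λ p → poly-ext (+-seq (id-seq p) coef-0) (id-seq p) (λ i → +-identityʳ _)) }
            ; inverse = (λ p → poly-ext (+-seq (coef-neg p) (id-seq p)) coef-0 (λ i → -‿inverseˡ _))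
                      , (λ p → poly-ext (+-seq (id-seq p) (coef-neg p)) coef-0 (λ i → -‿inverseʳ _))
            ; ⁻¹-cong = λ {p} {q} e → poly-ext (coef-neg p) (coef-neg q) (λ i → -‿cong (coef≈ e i)) }
          ; comm = λ p q → poly-ext (coef-+ p q) (coef-+ q p) (λ i → +-comm _ _) }
        ; *-cong = λ {p} {q} {r} {s} e e′ → poly-ext (coef-* p r) (coef-* q s) (conv-cong (coef≈ e) (coef≈ e′))
        ; *-assoc = λ p q r → poly-ext (*-seq (coef-* p q) (id-seq r)) (*-seq (id-seq p) (coef-* q r))
            (conv-assoc (coef p) (coef q) (coef r))
        ; *-identity = (λ p → poly-ext (*-seq coef-1 (id-seq p)) (id-seq p) (conv-identityˡ (coef p)))
                     , (λ p → poly-ext (*-seq (id-seq p) coef-1) (id-seq p) (λ i → trans (conv-comm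
                         (coef p) one i) (conv-identityˡ (coef p) i)))
        ; distrib = (λ p q r → poly-ext (*-seq (id-seq p) (coef-+ q r)) (+-seq (coef-* p q) (coef-* p r))
            (conv-distribˡ (coef p) (coef q) (coef r)))
                  , (λ p q r → poly-ext (*-seq (coef-+ q r) (id-seq p)) (+-seq (coef-* q p) (coef-* r p))
                      (conv-+ˡ (coef q) (coef r) (coef p))) }
      ; *-comm = λ p q → poly-ext (coef-* p q) (coef-* q p) (conv-comm (coef p) (coef q)) } }

open PolyOperations public using (polyRing)

_∘ʰ_ : ∀ {a ℓ a′ ℓ′ a″ ℓ″} {A : CommutativeRing a ℓ} {B : CommutativeRing a′ ℓ′} {C : CommutativeRing a″ ℓ″} →
       Hom B C → Hom A B → Hom A C
_∘ʰ_ {C = C} ψ φ = record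
  { fn = ψ.fn ∘ φ.fn
  ; cong = ψ.cong ∘ φ.cong
  ; +-homo = λ x y → trans (ψ.cong (φ.+-homo x y)) (ψ.+-homo _ _)
  ; *-homo = λ x y → trans (ψ.cong (φ.*-homo x y)) (ψ.*-homo _ _)
  ; 0-homo = trans (ψ.cong φ.0-homo) ψ.0-homo
  ; 1-homo = trans (ψ.cong φ.1-homo) ψ.1-homo }
  where
  open CommutativeRing C
  module φ = Hom φ
  module ψ = Hom ψ

module HomProperties {a ℓ a′ ℓ′} {A : CommutativeRing a ℓ} {B : CommutativeRing a′ ℓ′} (φ : Hom A B) where
  private
    module A = CommutativeRing A
    module SA = Sequences A
    module SB = Sequences B
  open CommutativeRing B
  open Hom φ
  open import Algebra.Properties.Group +-group using (inverseˡ-unique)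

  neg-homo : ∀ x → fn (A.- x) ≈ - fn x
  neg-homo x = inverseˡ-unique _ _ (trans (sym (+-homo _ _)) (trans (cong (A.-‿inverseˡ x)) 0-homo))

  ·ₙ-homo : ∀ n x → fn (n SA.·ₙ x) ≈ n SB.·ₙ fn x
  ·ₙ-homo zero    x = 0-homo
  ·ₙ-homo (suc n) x = trans (+-homo _ _) (+-congˡ (·ₙ-homo n x))

  horner-homo : ∀ n x f → fn (SA.horner n x f) ≈ SB.horner n (fn x) (fn ∘ f)
  horner-homo zero    x f = 0-homo
  horner-homo (suc n) x f = trans (+-homo _ _) (+-congˡ (trans (*-homo _ _) (*-congˡ (horner-homo n x (f ∘ suc)))))

  conv-homo : ∀ f g n → fn (SA.conv f g n) ≈ SB.conv (fn ∘ f) (fn ∘ g) n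
  conv-homo f g zero    = *-homo _ _
  conv-homo f g (suc n) = trans (+-homo _ _) (+-cong (*-homo _ _) (conv-homo (f ∘ suc) g n))

module Polynomials {a ℓ} (A : CommutativeRing a ℓ) where
  open CommutativeRing A
  open Sequences A
  open PolyOperations A public hiding (polyRing)
  module ℙ = CommutativeRing (polyRing A)
  open IntegerSolver A

  const-* : ∀ c p i → coef (const c ℙ.* p) i ≈ c * coef p i
  const-* c p i = trans (coef-* (const c) p i) (go i)
    where
    go : ∀ i → conv (coef (const c)) (coef p) i ≈ c * coef p i
    go zero    = *-congʳ (const-zero c)
    go (suc i) = trans (+-cong (*-congʳ (const-zero c)) (conv-zeroˡ (coef p) (const-suc c) i)) (+-identityʳ _)

  X-*-zero : ∀ p → coef (X ℙ.* p) 0 ≈ 0#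
  X-*-zero p = trans (coef-* X p 0) (trans (*-congʳ X-zero) (zeroˡ _))

  X-*-suc : ∀ p i → coef (X ℙ.* p) (suc i) ≈ coef p i
  X-*-suc p i = trans (coef-* X p (suc i)) (trans (+-cong (trans (*-congʳ X-zero) (zeroˡ _))
    (trans (conv-cong X-suc (λ _ → refl) i) (conv-identityˡ (coef p) i))) (+-identityˡ _))

  constHom : Hom A (polyRing A)
  constHom = record
    { fn = const
    ; cong = λ {x} {y} e → mk≈ λ
        { zero → trans (const-zero x) (trans e (sym (const-zero y)))
        ; (suc i) → trans (const-suc x i) (sym (const-suc y i)) }
    ; +-homo = λ x y → mk≈ λ
        { zero → trans (const-zero _) (sym (trans (coef-+ (const x) (const y) 0) (+-cong (const-zero x)
            (const-zero y))))
        ; (suc i) → trans (const-suc _ i) (sym (trans (coef-+ (const x) (const y) (suc i))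
                      (trans (+-cong (const-suc x i) (const-suc y i)) (+-identityʳ 0#)))) }
    ; *-homo = λ x y → mk≈ λ i → sym (trans (const-* x (const y) i) (lemma x y i))
    ; 0-homo = mk≈ λ { zero → trans (const-zero 0#) (sym (coef-0 0)) ; (suc i) → trans (const-suc 0# i) (sym
        (coef-0 (suc i))) }
    ; 1-homo = mk≈ λ { zero → trans (const-zero 1#) (sym (coef-1 0)) ; (suc i) → trans (const-suc 1# i) (sym
        (coef-1 (suc i))) } }
    where
    lemma : ∀ x y i → x * coef (const y) i ≈ coef (const (x * y)) i
    lemma x y zero    = trans (*-congˡ (const-zero y)) (sym (const-zero (x * y)))
    lemma x y (suc i) = trans (*-congˡ (const-suc y i)) (trans (zeroʳ x) (sym (const-suc (x * y) i)))

  coef₀ : Hom (polyRing A) A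
  coef₀ = record
    { fn = λ p → coef p 0 ; cong = λ e → coef≈ e 0 ; +-homo = λ p q → coef-+ p q 0 ; *-homo = λ p q → coef-* p q 0
    ; 0-homo = coef-0 0 ; 1-homo = coef-1 0 }

  ∂ : Derivation (polyRing A)
  ∂ = record
    { D = ∂ₚ
    ; D-cong = λ {p} {q} e → mk≈ λ i → trans (coef-∂ p i) (trans (×-congʳ (suc i) (coef≈ e (suc i))) (sym
        (coef-∂ q i)))
    ; D-+ = λ p q → mk≈ λ i → trans (coef-∂ (p ℙ.+ q) i) (trans (×-congʳ (suc i) (coef-+ p q (suc i))) (trans
        (·ₙ-+ (suc i) _ _)
        (sym (trans (coef-+ (∂ₚ p) (∂ₚ q) i) (+-cong (coef-∂ p i) (coef-∂ q i))))))
    ; D-* = λ p q → mk≈ λ i → trans (coef-∂ (p ℙ.* q) i) (trans (×-congʳ (suc i) (coef-* p q (suc i))) (trans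
        (deriv-conv (coef p) (coef q) i)
        (sym (trans (coef-+ (∂ₚ p ℙ.* q) (p ℙ.* ∂ₚ q) i)
          (+-cong (trans (coef-* (∂ₚ p) q i) (conv-cong (coef-∂ p) (λ _ → refl) i))
                  (trans (coef-* p (∂ₚ q) i) (conv-cong (λ _ → refl) (coef-∂ q) i))))))) }

  open Derivation ∂ public using () renaming (D-cong to ∂-cong; D-+ to ∂-+; D-* to ∂-*; D-1 to ∂-1; D-0 to ∂-0)

  ∂-const : ∀ c → ∂ₚ (const c) ℙ.≈ ℙ.0#
  ∂-const c = mk≈ λ i → trans (coef-∂ (const c) i) (trans (·ₙ-zero (suc i) (const-suc c i)) (sym (coef-0 i)))

  ∂-X : ∂ₚ X ℙ.≈ ℙ.1#
  ∂-X = mk≈ λ i → trans (coef-∂ X i) (trans (×-congʳ (suc i) (X-suc i)) (trans (go i) (sym (coef-1 i))))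
    where
    go : ∀ i → suc i ·ₙ one i ≈ one i
    go zero    = +-identityʳ 1#
    go (suc i) = ·ₙ-zero (suc (suc i)) refl

  module _ (𝒟 : Derivation A) where
    open Derivation 𝒟

    opaque
      mapD : Poly A → Poly A
      mapD p = poly (D ∘ coef p) (size p) (λ i le → trans (D-cong (bounded p i le)) D-0)

      coef-mapD : ∀ p i → coef (mapD p) i ≈ D (coef p i)
      coef-mapD p i = refl

    -- For coefficients in a polynomial ring and D its derivative, this is the partial derivative
    -- with respect to the inner variable.
    coefwise : Derivation (polyRing A)
    coefwise = record
      { D = mapD
      ; D-cong = λ {p} {q} e → mk≈ λ i → trans (coef-mapD p i) (trans (D-cong (coef≈ e i)) (sym (coef-mapD q i)))
      ; D-+ = λ p q → mk≈ λ i → trans (coef-mapD (p ℙ.+ q) i) (trans (D-cong (coef-+ p q i)) (trans (D-+ _ _)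
          (sym (trans (coef-+ (mapD p) (mapD q) i) (+-cong (coef-mapD p i) (coef-mapD q i))))))
      ; D-* = λ p q → mk≈ λ i → trans (coef-mapD (p ℙ.* q) i) (trans (D-cong (coef-* p q i)) (trans (D-conv 𝒟
          (coef p) (coef q) i)
          (sym (trans (coef-+ (mapD p ℙ.* q) (p ℙ.* mapD q) i)
            (+-cong (trans (coef-* (mapD p) q i) (conv-cong (coef-mapD p) (λ _ → refl) i))
                    (trans (coef-* p (mapD q) i) (conv-cong (λ _ → refl) (coef-mapD q) i))))))) }

  Ord : ℕ → Poly A → Set ℓ
  Ord s p = ∀ i → i < s → coef p i ≈ 0#

  Ord-cong : ∀ {s p q} → p ℙ.≈ q → Ord s p → Ord s q
  Ord-cong e o i i<s = trans (sym (coef≈ e i)) (o i i<s)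

  Ord-+ : ∀ {s p q} → Ord s p → Ord s q → Ord s (p ℙ.+ q)
  Ord-+ {p = p} {q} o o′ i i<s = trans (coef-+ p q i) (trans (+-cong (o i i<s) (o′ i i<s)) (+-identityʳ 0#))

  Ord-*ˡ : ∀ {s} p q → Ord s p → Ord s (p ℙ.* q)
  Ord-*ˡ p q o i i<s = trans (coef-* p q i) (go (coef p) i (λ j j≤i → o j (≤-<-trans j≤i i<s)))
    where
    go : ∀ f i → (∀ j → j ≤ i → f j ≈ 0#) → conv f (coef q) i ≈ 0#
    go f zero    z = trans (*-congʳ (z 0 z≤n)) (zeroˡ _)
    go f (suc i) z = trans (+-cong (trans (*-congʳ (z 0 z≤n)) (zeroˡ _)) (go (f ∘ suc) i (λ j le → z (suc j)
        (s≤s le)))) (+-identityʳ 0#)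

  Ord-neg : ∀ {s p} → Ord s p → Ord s (ℙ.- p)
  Ord-neg {p = p} o i i<s = trans (coef-neg p i) (trans (-‿cong (o i i<s)) (solve 0 (:- :0 := :0) refl))

  Ord-X* : ∀ {s} p → Ord (suc s) (X ℙ.* p) → Ord s p
  Ord-X* p o i i<s = trans (sym (X-*-suc p i)) (o (suc i) (s≤s i<s))

  Ord-∂ : ∀ {s p} → Ord (suc s) p → Ord s (∂ₚ p)
  Ord-∂ {p = p} o i i<s = trans (coef-∂ p i) (·ₙ-zero (suc i) (o (suc i) (s≤s i<s)))

  Ord-mono : ∀ {s t p} → s ≤ t → Ord t p → Ord s p
  Ord-mono s≤t o i i<s = o i (≤-trans i<s s≤t)

  -- Degree less than n rather than at most n, so that `Deg 0` singles out the zero polynomial.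
  Deg : ℕ → Poly A → Set ℓ
  Deg n p = VanishesFrom n (coef p)

  Deg-cong : ∀ {n p q} → p ℙ.≈ q → Deg n p → Deg n q
  Deg-cong e d i le = trans (sym (coef≈ e i)) (d i le)

  Deg-+ : ∀ {n p q} → Deg n p → Deg n q → Deg n (p ℙ.+ q)
  Deg-+ {p = p} {q} d d′ i le = trans (coef-+ p q i) (trans (+-cong (d i le) (d′ i le)) (+-identityʳ 0#))

  Deg-neg : ∀ {n p} → Deg n p → Deg n (ℙ.- p)
  Deg-neg {p = p} d i le = trans (coef-neg p i) (trans (-‿cong (d i le)) (solve 0 (:- :0 := :0) refl))

  Deg-* : ∀ {m n} p q → Deg (suc m) p → Deg n q → Deg (m ℕ.+ n) (p ℙ.* q)
  Deg-* {m} {n} p q dp dq i le = trans (coef-* p q i) (conv-vanishes m n (coef p) (coef q) dp dq i le)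

  Deg-mono : ∀ {m n} {p : Poly A} → m ≤ n → Deg m p → Deg n p
  Deg-mono = VanishesFrom-mono

  Deg-const : ∀ c → Deg 1 (const c)
  Deg-const c (suc i) _ = const-suc c i

  Deg-X : Deg 2 X
  Deg-X (suc zero)    (s≤s ())
  Deg-X (suc (suc i)) _ = X-suc (suc i)

  Deg-∂ : ∀ {n} p → Deg n p → Deg n (∂ₚ p)
  Deg-∂ p d i le = trans (coef-∂ p i) (deriv-vanishes d i le)

module _ {a ℓ a′ ℓ′} {A : CommutativeRing a ℓ} {B : CommutativeRing a′ ℓ′} (φ : Hom A B) where
  open CommutativeRing B
  open Hom φ
  open HomProperties φ
  open Polynomials B
  open Sequences B
  private
    module PA = Polynomials A

  opaque
    mapₚ : Poly A → Poly B
    mapₚ p = poly (fn ∘ coef p) (size p) (λ i le → trans (cong (bounded p i le)) 0-homo)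

    coef-mapₚ : ∀ p i → coef (mapₚ p) i ≈ fn (coef p i)
    coef-mapₚ p i = refl

  mapHom : Hom (polyRing A) (polyRing B)
  mapHom = record
    { fn = mapₚ
    ; cong = λ {p} {q} e → mk≈ λ i → trans (coef-mapₚ p i) (trans (cong (coef≈ e i)) (sym (coef-mapₚ q i)))
    ; +-homo = λ p q → mk≈ λ i → trans (coef-mapₚ (p PA.ℙ.+ q) i) (trans (cong (PA.coef-+ p q i)) (trans (+-homo _ _)
        (sym (trans (coef-+ (mapₚ p) (mapₚ q) i) (+-cong (coef-mapₚ p i) (coef-mapₚ q i))))))
    ; *-homo = λ p q → mk≈ λ i → trans (coef-mapₚ (p PA.ℙ.* q) i) (trans (cong (PA.coef-* p q i)) (trans
        (conv-homo (coef p) (coef q) i)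
        (sym (trans (coef-* (mapₚ p) (mapₚ q) i) (conv-cong (coef-mapₚ p) (coef-mapₚ q) i)))))
    ; 0-homo = mk≈ λ i → trans (coef-mapₚ PA.ℙ.0# i) (trans (cong (PA.coef-0 i)) (trans 0-homo (sym (coef-0 i))))
    ; 1-homo = mk≈ λ i → trans (coef-mapₚ PA.ℙ.1# i) (trans (cong (PA.coef-1 i)) (trans (one-homo i) (sym
        (coef-1 i)))) }
    where
    one-homo : ∀ i → fn (Sequences.one A i) ≈ one i
    one-homo zero    = 1-homo
    one-homo (suc i) = 0-homo

  mapₚ-const : ∀ c → mapₚ (PA.const c) ℙ.≈ const (fn c)
  mapₚ-const c = mk≈ λ
    { zero → trans (coef-mapₚ _ 0) (trans (cong (PA.const-zero c)) (sym (const-zero (fn c))))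
    ; (suc i) → trans (coef-mapₚ _ (suc i)) (trans (cong (PA.const-suc c i)) (trans 0-homo (sym (const-suc
        (fn c) i)))) }

  mapₚ-X : mapₚ PA.X ℙ.≈ X
  mapₚ-X = mk≈ λ
    { zero → trans (coef-mapₚ _ 0) (trans (cong PA.X-zero) (trans 0-homo (sym X-zero)))
    ; (suc zero) → trans (coef-mapₚ _ 1) (trans (cong (PA.X-suc 0)) (trans 1-homo (sym (X-suc 0))))
    ; (suc (suc i)) → trans (coef-mapₚ _ (suc (suc i))) (trans (cong (PA.X-suc (suc i))) (trans 0-homo (sym
        (X-suc (suc i))))) }

module _ {a ℓ a′ ℓ′} {A : CommutativeRing a ℓ} {B : CommutativeRing a′ ℓ′} (φ : Hom A B) (β : CommutativeRing.Carrier B) where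
  open CommutativeRing B
  open Hom φ
  open Sequences B
  private
    module SA = Sequences A
    module PA = Polynomials A
    module φ = HomProperties φ

  vanishes-homo : ∀ {n f} → SA.VanishesFrom n f → VanishesFrom n (fn ∘ f)
  vanishes-homo v i le = trans (cong (v i le)) 0-homo

  opaque
    evalₚ : Poly A → Carrier
    evalₚ p = horner (size p) β (fn ∘ coef p)

    -- Equal polynomials may carry different sizes, so their values are compared at a common number
    -- of terms.
    evalₚ-size : ∀ n p → PA.Deg n p → evalₚ p ≈ horner n β (fn ∘ coef p)
    evalₚ-size n p v = trans (sym (horner-extend β _ (vanishes-homo (bounded p)) (ℕₚ.m≤m⊔n (size p) n)))
                             (horner-extend β _ (vanishes-homo v) (ℕₚ.m≤n⊔m (size p) n))

  private
    ev-cong : ∀ {p q} → PolyEq A p q → evalₚ p ≈ evalₚ q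
    ev-cong {p} {q} e = trans (evalₚ-size (size q) p (PA.Deg-cong (PA.ℙ.sym e) (bounded q)))
      (trans (horner-congʳ (size q) (λ i → cong (coef≈ e i))) (sym (evalₚ-size (size q) q (bounded q))))

    ev-+ : ∀ p q → evalₚ (p PA.ℙ.+ q) ≈ evalₚ p + evalₚ q
    ev-+ p q = trans (evalₚ-size n (p PA.ℙ.+ q) (PA.Deg-+ {p = p} {q} dp dq))
      (trans (horner-congʳ n (λ i → trans (cong (PA.coef-+ p q i)) (+-homo (coef p i) (coef q i))))
      (trans (horner-+ n β _ _) (sym (+-cong (evalₚ-size n p dp) (evalₚ-size n q dq)))))
      where
      n : ℕ
      n = size p ℕ.⊔ size q
      dp : PA.Deg n p
      dp = PA.Deg-mono {p = p} (ℕₚ.m≤m⊔n _ _) (bounded p)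
      dq : PA.Deg n q
      dq = PA.Deg-mono {p = q} (ℕₚ.m≤n⊔m (size p) _) (bounded q)

    ev-* : ∀ p q → evalₚ (p PA.ℙ.* q) ≈ evalₚ p * evalₚ q
    ev-* p q = trans (evalₚ-size n (p PA.ℙ.* q) (PA.Deg-* p q (PA.Deg-mono {p = p} (n≤1+n _) (bounded p))
        (bounded q)))
      (trans (horner-congʳ n (λ i → trans (cong (PA.coef-* p q i)) (φ.conv-homo (coef p) (coef q) i)))
      (trans (horner-conv (size p) (size q) β _ _ (vanishes-homo (bounded p)) (vanishes-homo (bounded q)))
             (sym (*-cong (evalₚ-size _ p (bounded p)) (evalₚ-size _ q (bounded q))))))
      where
      n : ℕ
      n = size p ℕ.+ size q

  evalₚ-const : ∀ c → evalₚ (PA.const c) ≈ fn c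
  evalₚ-const c = trans (evalₚ-size 1 (PA.const c) (PA.Deg-const c))
    (trans (+-cong (cong (PA.const-zero c)) (zeroʳ β)) (+-identityʳ _))

  evalₚ-X : evalₚ PA.X ≈ β
  evalₚ-X = trans (evalₚ-size 2 PA.X PA.Deg-X)
    (trans (+-cong (trans (cong PA.X-zero) 0-homo) (*-congˡ (trans (+-cong (trans (cong (PA.X-suc 0)) 1-homo)
        (zeroʳ β)) (+-identityʳ _))))
           (trans (+-identityˡ _) (*-identityʳ β)))

  aeval : Hom (polyRing A) B
  aeval = record
    { fn = evalₚ
    ; cong = ev-cong
    ; +-homo = ev-+
    ; *-homo = ev-*
    ; 0-homo = evalₚ-size 0 PA.ℙ.0# (λ i _ → PA.coef-0 i)
    ; 1-homo = trans (ev-cong (PA.ℙ.sym (Hom.1-homo PA.constHom))) (trans (evalₚ-const _) 1-homo) }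

  evalₚ-chain : (𝒟 : Derivation B) → (∀ c → Derivation.D 𝒟 (fn c) ≈ 0#) → ∀ p →
                Derivation.D 𝒟 (evalₚ p) ≈ evalₚ (PA.∂ₚ p) * Derivation.D 𝒟 β
  evalₚ-chain 𝒟 kills p = trans (D-cong (evalₚ-size (size p) p (bounded p)))
    (trans (horner-chain 𝒟 (size p) β _ (vanishes-homo (bounded p)))
    (trans (+-cong (horner-zero (size p) β (λ i → kills (coef p i)))
                   (*-congʳ (trans (horner-congʳ (size p) (λ i → trans (sym (φ.·ₙ-homo (suc i) (coef p
                       (suc i)))) (cong (CommutativeRing.sym A (PA.coef-∂ p i)))))
                                   (sym (evalₚ-size (size p) (PA.∂ₚ p) (PA.Deg-∂ p (bounded p)))))))
           (+-identityˡ _)))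
    where open Derivation 𝒟

-- Polynomials in three variables, as arrays of coefficients.
module Arrays {a ℓ} (K : CommutativeRing a ℓ) where
  open CommutativeRing K
  open Sequences K

  Array : Set a
  Array = ℕ → ℕ → ℕ → Carrier

  -- Total degree, not the degree in each variable: it drops under each of the three partial
  -- derivatives, which is what the induction in `vanishing` descends on.
  Supported : ℕ → Array → Set ℓ
  Supported w f = ∀ i j l → w ≤ i ℕ.+ j ℕ.+ l → f i j l ≈ 0#

  Supported-mono : ∀ {v w} f → v ≤ w → Supported v f → Supported w f
  Supported-mono f v≤w s i j l le = s i j l (≤-trans v≤w le)

  ∂₁ ∂₂ ∂₃ : Array → Array
  ∂₁ f i j l = suc i ·ₙ f (suc i) j l
  ∂₂ f i j l = suc j ·ₙ f i (suc j) l
  ∂₃ f i j l = suc l ·ₙ f i j (suc l)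

  ∂₁-supported : ∀ {w} f → Supported (suc w) f → Supported w (∂₁ f)
  ∂₁-supported f s i j l le = ·ₙ-zero (suc i) (s (suc i) j l (s≤s le))

  ∂₂-supported : ∀ {w} f → Supported (suc w) f → Supported w (∂₂ f)
  ∂₂-supported f s i j l le = ·ₙ-zero (suc j) (s i (suc j) l
    (≤-trans (s≤s le) (≤-reflexive (≡.cong (ℕ._+ l) (≡.sym (ℕₚ.+-suc i j))))))

  ∂₃-supported : ∀ {w} f → Supported (suc w) f → Supported w (∂₃ f)
  ∂₃-supported f s i j l le = ·ₙ-zero (suc l) (s i j (suc l)
    (≤-trans (s≤s le) (≤-reflexive (≡.sym (ℕₚ.+-suc (i ℕ.+ j) l)))))

module Evaluation {a ℓ a′ ℓ′} {K : CommutativeRing a ℓ} {B : CommutativeRing a′ ℓ′} (ι : Hom K B) (N : ℕ) where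
  private
    module K = CommutativeRing K
    module ι where
      open Hom ι public
      open HomProperties ι public
  open Arrays K
  open CommutativeRing B
  open Sequences B
  open IntegerSolver B
  open import Relation.Binary.Reasoning.Setoid setoid

  -- A truncation to exponents below N in each variable. It is additive on all arrays, and it is the
  -- true value on arrays of total degree below N.
  ev : Array → Carrier → Carrier → Carrier → Carrier
  ev f α β γ = horner N α (λ i → horner N β (λ j → horner N γ (λ l → ι.fn (f i j l))))

  ev-congᵃ : ∀ {f g} α β γ → (∀ i j l → f i j l K.≈ g i j l) → ev f α β γ ≈ ev g α β γ
  ev-congᵃ α β γ e = horner-congʳ N (λ i → horner-congʳ N (λ j → horner-congʳ N (λ l → ι.cong (e i j l))))

  ev-cong : ∀ f {α α′ β β′ γ γ′} → α ≈ α′ → β ≈ β′ → γ ≈ γ′ → ev f α β γ ≈ ev f α′ β′ γ′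
  ev-cong f p q r = horner-cong N p (λ i → horner-cong N q (λ j → horner-cong N r (λ l → refl)))

  ev-+ : ∀ f g α β γ → ev (λ i j l → f i j l K.+ g i j l) α β γ ≈ ev f α β γ + ev g α β γ
  ev-+ f g α β γ = begin
    ev (λ i j l → f i j l K.+ g i j l) α β γ
      ≈⟨ horner-congʳ N (λ i → horner-congʳ N (λ j → trans (horner-congʳ N (λ l → ι.+-homo (f i j l) (g i j l)))
          (horner-+ N γ _ _))) ⟩
    horner N α (λ i → horner N β (λ j → horner N γ (λ l → ι.fn (f i j l)) + horner N γ (λ l → ι.fn (g i j l))))
      ≈⟨ horner-congʳ N (λ i → horner-+ N β _ _) ⟩
    horner N α (λ i → horner N β (λ j → horner N γ (λ l → ι.fn (f i j l))) + horner N β (λ j → horner N γ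
        (λ l → ι.fn (g i j l))))
      ≈⟨ horner-+ N α _ _ ⟩
    ev f α β γ + ev g α β γ ∎

  ev-* : ∀ c f α β γ → ev (λ i j l → c K.* f i j l) α β γ ≈ ι.fn c * ev f α β γ
  ev-* c f α β γ = begin
    ev (λ i j l → c K.* f i j l) α β γ
      ≈⟨ horner-congʳ N (λ i → horner-congʳ N (λ j → trans (horner-congʳ N (λ l → ι.*-homo c (f i j l)))
          (horner-*ˡ N γ _ _))) ⟩
    horner N α (λ i → horner N β (λ j → ι.fn c * horner N γ (λ l → ι.fn (f i j l))))
      ≈⟨ horner-congʳ N (λ i → horner-*ˡ N β _ _) ⟩
    horner N α (λ i → ι.fn c * horner N β (λ j → horner N γ (λ l → ι.fn (f i j l))))
      ≈⟨ horner-*ˡ N α _ _ ⟩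
    ι.fn c * ev f α β γ ∎

  private
    horner-*ʳ : ∀ n x f c → horner n x (λ i → f i * c) ≈ horner n x f * c
    horner-*ʳ n x f c = trans (horner-congʳ n (λ i → *-comm (f i) c)) (trans (horner-*ˡ n x c f) (*-comm c _))

  module _ (𝒟 : Derivation B) (kills : ∀ c → Derivation.D 𝒟 (ι.fn c) ≈ 0#) where
    open Derivation 𝒟

    ev-chain : ∀ f α β γ → Supported N f →
               D (ev f α β γ) ≈ ev (∂₁ f) α β γ * D α + ev (∂₂ f) α β γ * D β + ev (∂₃ f) α β γ * D γ
    ev-chain f α β γ s = begin
      D (horner N α G)
        ≈⟨ horner-chain 𝒟 N α G G-vanishes ⟩
      horner N α (D ∘ G) + horner N α (deriv G) * D α
        ≈⟨ +-cong inner (*-congʳ (horner-congʳ N outer)) ⟩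
      (ev (∂₂ f) α β γ * D β + ev (∂₃ f) α β γ * D γ) + ev (∂₁ f) α β γ * D α
        ≈⟨ solve 3 (λ x y z → (x :+ y) :+ z := z :+ x :+ y) refl _ _ _ ⟩
      ev (∂₁ f) α β γ * D α + ev (∂₂ f) α β γ * D β + ev (∂₃ f) α β γ * D γ ∎
      where
      H : ℕ → ℕ → Carrier
      H i j = horner N γ (λ l → ι.fn (f i j l))
      G : ℕ → Carrier
      G i = horner N β (H i)
      H-vanishes : ∀ i → VanishesFrom N (H i)
      H-vanishes i j le = horner-zero N γ (λ l → trans (ι.cong (s i j l (≤-trans le (≤-trans (m≤n+m j i) (m≤m+n
          (i ℕ.+ j) l))))) ι.0-homo)
      G-vanishes : VanishesFrom N G
      G-vanishes i le = horner-zero N β (λ j → horner-zero N γ (λ l →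
        trans (ι.cong (s i j l (≤-trans le (≤-trans (m≤m+n i j) (m≤m+n (i ℕ.+ j) l))))) ι.0-homo))
      outer : ∀ i → deriv G i ≈ horner N β (λ j → horner N γ (λ l → ι.fn (∂₁ f i j l)))
      outer i = begin
        suc i ·ₙ horner N β (H (suc i))            ≈⟨ horner-·ₙ N β (suc i) (H (suc i)) ⟨
        horner N β (λ j → suc i ·ₙ H (suc i) j)    ≈⟨ horner-congʳ N (λ j → horner-·ₙ N γ (suc i) _) ⟨
        horner N β (λ j → horner N γ (λ l → suc i ·ₙ ι.fn (f (suc i) j l)))
          ≈⟨ horner-congʳ N (λ j → horner-congʳ N (λ l → ι.·ₙ-homo (suc i) (f (suc i) j l))) ⟨
        horner N β (λ j → horner N γ (λ l → ι.fn (∂₁ f i j l))) ∎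
      D-H : ∀ i j → D (H i j) ≈ horner N γ (λ l → ι.fn (∂₃ f i j l)) * D γ
      D-H i j = begin
        D (H i j)
          ≈⟨ horner-chain 𝒟 N γ _ (λ l le → trans (ι.cong (s i j l (≤-trans le (m≤n+m l (i ℕ.+ j))))) ι.0-homo) ⟩
        horner N γ (λ l → D (ι.fn (f i j l))) + horner N γ (deriv (λ l → ι.fn (f i j l))) * D γ
          ≈⟨ +-cong (horner-zero N γ (λ l → kills (f i j l)))
                    (*-congʳ (horner-congʳ N (λ l → sym (ι.·ₙ-homo (suc l) (f i j (suc l)))))) ⟩
        0# + horner N γ (λ l → ι.fn (∂₃ f i j l)) * D γ
          ≈⟨ +-identityˡ _ ⟩
        horner N γ (λ l → ι.fn (∂₃ f i j l)) * D γ ∎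
      D-G : ∀ i → D (G i) ≈ horner N β (λ j → horner N γ (λ l → ι.fn (∂₂ f i j l))) * D β
                          + horner N β (λ j → horner N γ (λ l → ι.fn (∂₃ f i j l))) * D γ
      D-G i = begin
        D (G i)
          ≈⟨ horner-chain 𝒟 N β (H i) (H-vanishes i) ⟩
        horner N β (D ∘ H i) + horner N β (deriv (H i)) * D β
          ≈⟨ +-comm _ _ ⟩
        horner N β (deriv (H i)) * D β + horner N β (D ∘ H i)
          ≈⟨ +-cong (*-congʳ (horner-congʳ N step)) (trans (horner-congʳ N (D-H i)) (horner-*ʳ N β _ (D γ))) ⟩
        horner N β (λ j → horner N γ (λ l → ι.fn (∂₂ f i j l))) * D β
          + horner N β (λ j → horner N γ (λ l → ι.fn (∂₃ f i j l))) * D γ ∎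
        where
        step : ∀ j → deriv (H i) j ≈ horner N γ (λ l → ι.fn (∂₂ f i j l))
        step j = trans (sym (horner-·ₙ N γ (suc j) _)) (horner-congʳ N (λ l → sym (ι.·ₙ-homo (suc j) (f i
            (suc j) l))))
      inner : horner N α (D ∘ G) ≈ ev (∂₂ f) α β γ * D β + ev (∂₃ f) α β γ * D γ
      inner = trans (horner-congʳ N D-G) (trans (horner-+ N α _ _) (+-cong (horner-*ʳ N α _ (D β))
          (horner-*ʳ N α _ (D γ))))

module _ {a ℓ a′ ℓ′ a″ ℓ″} {K : CommutativeRing a ℓ} {B : CommutativeRing a′ ℓ′} {C : CommutativeRing a″ ℓ″}
         (ι : Hom K B) (ψ : Hom B C) (κ : Hom K C) (N : ℕ) where
  private
    module ψ where
      open Hom ψ public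
      open HomProperties ψ public
  open CommutativeRing C
  open Sequences C

  -- The restrictions to a line, to a line seen from one of its points and to a cone are all values
  -- of `ev`. This lemma is how one passes between them by substitution.
  ev-natural : (∀ c → ψ.fn (Hom.fn ι c) ≈ Hom.fn κ c) → ∀ f {α β γ α′ β′ γ′} →
               ψ.fn α ≈ α′ → ψ.fn β ≈ β′ → ψ.fn γ ≈ γ′ →
               ψ.fn (Evaluation.ev ι N f α β γ) ≈ Evaluation.ev κ N f α′ β′ γ′
  ev-natural e f p q r =
    trans (ψ.horner-homo N _ _) (horner-cong N p λ i →
    trans (ψ.horner-homo N _ _) (horner-cong N q λ j →
    trans (ψ.horner-homo N _ _) (horner-cong N r λ l → e (f i j l))))

-- Zeros and Wronskians of polynomials over a field

¬¬-dec : ∀ {p} {P : Set p} → ¬ ¬ Dec P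
¬¬-dec k = k (no (λ p → k (yes p)))

-- Equality in F need not be decidable; if it is stable, equations may be proved by case distinction on equality.
Stable : ∀ {c ℓ} → Field c ℓ → Set (c ⊔ ℓ)
Stable F = ∀ {x y} → ¬ ¬ x ≈ y → x ≈ y
  where open Field F

Char2 : ∀ {c ℓ} → Field c ℓ → Set ℓ
Char2 F = 1# + 1# ≈ 0#
  where open Field F

module FieldPolynomials {c ℓ} (F : Field c ℓ) where
  open Field F
  open Sequences commRing
  open Polynomials commRing
  open IntegerSolver commRing
  private
    module ℙS = IntegerSolver (polyRing commRing)
    module C = Hom constHom
    module Cₚ = HomProperties constHom
  open import Relation.Binary.Reasoning.Setoid setoid

  cancelˡ : ∀ {x y} → ¬ x ≈ 0# → x * y ≈ 0# → y ≈ 0#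
  cancelˡ {x} {y} x≉0 xy≈0 with inverse x x≉0
  ... | z , xz≈1 = begin
    y              ≈⟨ *-identityˡ y ⟨
    1# * y         ≈⟨ *-congʳ xz≈1 ⟨
    x * z * y      ≈⟨ solve 3 (λ x z y → x :* z :* y := z :* (x :* y)) refl x z y ⟩
    z * (x * y)    ≈⟨ *-congˡ xy≈0 ⟩
    z * 0#         ≈⟨ zeroʳ z ⟩
    0#             ∎

  -‿≉0 : ∀ {x y} → ¬ x ≈ y → ¬ x - y ≈ 0#
  -‿≉0 {x} {y} x≉y e = x≉y (begin
    x            ≈⟨ solve 2 (λ x y → x := (x :- y) :+ y) refl x y ⟩
    (x - y) + y  ≈⟨ +-congʳ e ⟩
    0# + y       ≈⟨ +-identityˡ y ⟩
    y            ∎)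

  translate : Carrier → Hom (polyRing commRing) (polyRing commRing)
  translate t = aeval constHom (X ℙ.+ const t)

  T : Carrier → Poly commRing → Poly commRing
  T t = Hom.fn (translate t)

  -- Defined by the shift X ↦ X + t and not by iterated derivatives, so that multiplicities are
  -- right in every characteristic.
  OrdAt : Carrier → ℕ → Poly commRing → Set ℓ
  OrdAt t s p = Ord s (T t p)

  OrdAt-cong : ∀ {t s p q} → p ℙ.≈ q → OrdAt t s p → OrdAt t s q
  OrdAt-cong {t} e = Ord-cong (Hom.cong (translate t) e)

  T-linear : ∀ t u → T t (X ℙ.- const u) ℙ.≈ X ℙ.+ const (t - u)
  T-linear t u = ℙ.trans (Hom.+-homo (translate t) X (ℙ.- const u)) (ℙ.trans
    (ℙ.+-cong (evalₚ-X constHom (X ℙ.+ const t))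
              (ℙ.trans (HomProperties.neg-homo (translate t) (const u)) (ℙ.-‿cong (evalₚ-const constHom
                  (X ℙ.+ const t) u))))
    (ℙ.trans (ℙ.+-assoc X (const t) (ℙ.- const u)) (ℙ.+-congˡ {X}
      (ℙ.trans (ℙ.+-congˡ {const t} (ℙ.sym (Cₚ.neg-homo u))) (ℙ.sym (C.+-homo t (- u)))))))

  T-∂ : ∀ t p → T t (∂ₚ p) ℙ.≈ ∂ₚ (T t p)
  T-∂ t p = ℙ.sym (ℙ.trans (evalₚ-chain constHom (X ℙ.+ const t) ∂ ∂-const p) (ℙ.trans
    (ℙ.*-congˡ {T t (∂ₚ p)} (ℙ.trans (∂-+ X (const t)) (ℙ.trans (ℙ.+-cong ∂-X (∂-const t)) (ℙ.+-identityʳ ℙ.1#))))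
    (ℙ.*-identityʳ _)))

  T-const : ∀ t x → T t (const x) ℙ.≈ const x
  T-const t x = evalₚ-const constHom (X ℙ.+ const t) x

  -- X + e with e ≠ 0 is a unit among power series; the coefficients of p are solved for from the
  -- lowest one upwards.
  Ord-unit : ∀ {e s} p → ¬ e ≈ 0# → Ord s ((X ℙ.+ const e) ℙ.* p) → Ord s p
  Ord-unit {e} {s} p e≉0 o = go
    where
    expand : ∀ i → coef ((X ℙ.+ const e) ℙ.* p) i ≈ coef (X ℙ.* p) i + e * coef p i
    expand i = trans (coef≈ (ℙ.distribʳ p X (const e)) i) (trans (coef-+ (X ℙ.* p) (const e ℙ.* p) i) (+-congˡ
        (const-* e p i)))
    go : Ord s p
    go zero    i<s = cancelˡ e≉0 (trans (sym (trans (expand 0) (trans (+-congʳ (X-*-zero p)) (+-identityˡ _))))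
        (o 0 i<s))
    go (suc i) i<s = cancelˡ e≉0 (begin
      e * coef p (suc i)
        ≈⟨ +-identityˡ _ ⟨
      0# + e * coef p (suc i)
        ≈⟨ +-congʳ (trans (X-*-suc p i) (go i (ℕₚ.<-trans (ℕₚ.n<1+n i) i<s))) ⟨
      coef (X ℙ.* p) (suc i) + e * coef p (suc i)
        ≈⟨ expand (suc i) ⟨
      coef ((X ℙ.+ const e) ℙ.* p) (suc i)
        ≈⟨ o (suc i) i<s ⟩
      0# ∎)

  coef-sub : ∀ p q i → coef (p ℙ.- q) i ≈ coef p i - coef q i
  coef-sub p q i = trans (coef-+ p (ℙ.- q) i) (+-congˡ (coef-neg q i))

  module _ (t : Carrier) (n : ℕ) (p : Poly commRing) (deg : Deg (suc n) p) where
    -- Synthetic division: these are the coefficients of (p(X) - p(t)) / (X - t).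
    quotient : Poly commRing
    quotient = poly (λ i → horner n t (λ j → coef p (j ℕ.+ suc i))) n
      (λ i n≤i → horner-zero n t (λ j → deg (j ℕ.+ suc i) (≤-trans (s≤s n≤i) (m≤n+m (suc i) j))))

    quotient-* : OrdAt t 1 p → p ℙ.≈ (X ℙ.- const t) ℙ.* quotient
    quotient-* o = mk≈ λ i → sym (trans (coef≈ (expand quotient) i) (trans (coef-sub (X ℙ.* quotient) (const t ℙ.* quotient) i)
        (trans (+-congˡ (-‿cong (const-* t quotient i))) (go i))))
      where
      h : ℕ → Carrier
      h = coef quotient
      expand : ∀ q → (X ℙ.- const t) ℙ.* q ℙ.≈ X ℙ.* q ℙ.- const t ℙ.* q
      expand q = ℙS.solve 3 (λ x c q → (x ℙS.:- c) ℙS.:* q ℙS.:= x ℙS.:* q ℙS.:- c ℙS.:* q) ℙ.refl X (const t) q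
      value≈0 : horner (suc n) t (coef p) ≈ 0#
      value≈0 = trans (sym at-zero) (o 0 (s≤s z≤n))
        where
        X+t : coef (X ℙ.+ const t) 0 ≈ t
        X+t = trans (coef-+ X (const t) 0) (trans (+-cong X-zero (const-zero t)) (+-identityˡ t))
        at-zero : coef (T t p) 0 ≈ horner (suc n) t (coef p)
        at-zero = trans (coef≈ (evalₚ-size constHom (X ℙ.+ const t) (suc n) p deg) 0)
          (trans (HomProperties.horner-homo coef₀ (suc n) (X ℙ.+ const t) (const ∘ coef p))
                 (horner-cong (suc n) {f = λ i → coef (const (coef p i)) 0} {g = coef p} X+t (λ i → const-zero
                     (coef p i))))
      go : ∀ i → coef (X ℙ.* quotient) i - t * h i ≈ coef p i
      go zero = begin
        coef (X ℙ.* quotient) 0 - t * h 0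
          ≈⟨ +-cong (X-*-zero quotient) (-‿cong (*-congˡ (horner-congʳ n (λ j → reflexive (≡.cong (coef p)
              (≡.trans (ℕₚ.+-suc j 0) (≡.cong suc (ℕₚ.+-identityʳ j)))))))) ⟩
        0# - t * horner n t (coef p ∘ suc)
          ≈⟨ +-congʳ value≈0 ⟨
        (coef p 0 + t * horner n t (coef p ∘ suc)) - t * horner n t (coef p ∘ suc)
          ≈⟨ solve 2 (λ a b → (a :+ b) :- b := a) refl _ _ ⟩
        coef p 0 ∎
      go (suc i) = begin
        coef (X ℙ.* quotient) (suc i) - t * h (suc i)
          ≈⟨ +-cong (trans (X-*-suc quotient i) (sym longer)) (-‿cong (*-congˡ (horner-congʳ n (λ j → reflexive
              (≡.cong (coef p) (ℕₚ.+-suc j (suc i))))))) ⟩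
        (coef p (suc i) + t * horner n t (λ j → coef p (suc j ℕ.+ suc i))) - t * horner n t (λ j → coef p (suc
            (j ℕ.+ suc i)))
          ≈⟨ solve 2 (λ a b → (a :+ b) :- b := a) refl _ _ ⟩
        coef p (suc i) ∎
        where
        longer : horner (suc n) t (λ j → coef p (j ℕ.+ suc i)) ≈ h i
        longer = horner-extend t _ (λ j n≤j → deg (j ℕ.+ suc i) (≤-trans (s≤s n≤j) (ℕₚ.m<m+n j (s≤s z≤n)))) (n≤1+n n)

  -- Divides by (X - t)ˢ. The zeros at the other points survive because X - t is a unit there. The
  -- factorisation itself is remembered only through its consequence that h = 0 forces p = 0.
  extract : ∀ {t s′ us} s n p → OrdAt t s p → Deg (s ℕ.+ n) p → All (λ u → ¬ t ≈ u) us → All (λ u → OrdAt u s′ p) us →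
            Σ (Poly commRing) λ h → (h ℙ.≈ ℙ.0# → p ℙ.≈ ℙ.0#) × Deg n h × All (λ u → OrdAt u s′ h) us
  extract {t} {s′} {us} zero    n p o d ne os = p , (λ e → e) , d , os
  extract {t} {s′} {us} (suc s) n p o d ne os =
    let h , h≈0→ , dh , osh = extract s n q o′ (bounded q) ne (All.zipWith (λ { (t≉u , ou) → other t≉u ou }) (ne , os))
    in h , (λ e → ℙ.trans p≈ (ℙ.trans (ℙ.*-congˡ {X ℙ.- const t} (h≈0→ e)) (ℙ.zeroʳ (X ℙ.- const t)))) , dh , osh
    where
    q : Poly commRing
    q = quotient t (s ℕ.+ n) p d
    p≈ : p ℙ.≈ (X ℙ.- const t) ℙ.* q
    p≈ = quotient-* t (s ℕ.+ n) p d (Ord-mono {1} {suc s} {T t p} (s≤s z≤n) o)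
    T-p : ∀ u → T u p ℙ.≈ (X ℙ.+ const (u - t)) ℙ.* T u q
    T-p u = ℙ.trans (Hom.cong (translate u) p≈) (ℙ.trans (Hom.*-homo (translate u) (X ℙ.- const t) q) (ℙ.*-congʳ
        {T u q} (T-linear u t)))
    o′ : OrdAt t s q
    o′ = Ord-X* (T t q) (Ord-cong (ℙ.trans (T-p t) (ℙ.*-congʳ {T t q} (ℙ.trans (ℙ.+-congˡ {X} (ℙ.trans (C.cong
        (-‿inverseʳ t)) C.0-homo)) (ℙ.+-identityʳ X)))) o)
    other : ∀ {u} → ¬ t ≈ u → OrdAt u s′ p → OrdAt u s′ q
    other {u} t≉u ou = Ord-unit (T u q) (-‿≉0 (λ e → t≉u (sym e))) (Ord-cong (T-p u) ou)

  many-zeros : ∀ {s} us p → AllPairs (λ t u → ¬ t ≈ u) us → All (λ u → OrdAt u s p) us → Deg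
      (length us ℕ.* s) p → p ℙ.≈ ℙ.0#
  many-zeros         []       p _          _        d = mk≈ (λ i → trans (d i z≤n) (sym (coef-0 i)))
  many-zeros {s} (t ∷ us) p (ne ∷ nes) (o ∷ os) d =
    let h , h≈0→ , dh , osh = extract s (length us ℕ.* s) p o d ne os
    in h≈0→ (many-zeros us h nes osh dh)

  conv-zeros : ∀ f g n → (∀ i → i ≤ n → g i ≈ 0#) → conv f g n ≈ 0#
  conv-zeros f g zero    z = trans (*-congˡ (z 0 z≤n)) (zeroʳ _)
  conv-zeros f g (suc n) z = trans (+-cong (trans (*-congˡ (z (suc n) ≤-refl)) (zeroʳ _))
    (conv-zeros (f ∘ suc) g n (λ i le → z i (m≤n⇒m≤1+n le)))) (+-identityʳ 0#)

  conv-lowest : ∀ a b f g → (∀ i → i < a → f i ≈ 0#) → (∀ i → i < b → g i ≈ 0#) → conv f g (a ℕ.+ b) ≈ f a * g b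
  conv-lowest zero    zero    f g zf zg = refl
  conv-lowest zero    (suc b) f g zf zg = trans (+-congˡ (conv-zeros (f ∘ suc) g b (λ i le → zg i (s≤s le))))
      (+-identityʳ _)
  conv-lowest (suc a) b       f g zf zg = trans (+-cong (trans (*-congʳ (zf 0 (s≤s z≤n))) (zeroˡ _))
    (conv-lowest a b (f ∘ suc) g (λ i lt → zf (suc i) (s≤s lt)) zg)) (+-identityˡ _)

  *-lowest : ∀ a b p q → Ord a p → Ord b q → coef (p ℙ.* q) (a ℕ.+ b) ≈ coef p a * coef q b
  *-lowest a b p q op oq = trans (coef-* p q (a ℕ.+ b)) (conv-lowest a b (coef p) (coef q) op oq)

  -- The numbers 1, ..., n are nonzero in F; this treats characteristic zero and p > n alike.
  CharExceeds : ℕ → Set ℓ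
  CharExceeds n = ∀ i → i < n → ¬ suc i ·ₙ 1# ≈ 0#

  ·ₙ-cancel : ∀ {n} i {x} → CharExceeds n → i < n → suc i ·ₙ x ≈ 0# → x ≈ 0#
  ·ₙ-cancel i {x} char i<n e = cancelˡ (char i i<n)
    (trans (×-assoc-* (suc i) 1# x) (trans (×-congʳ (suc i) (*-identityˡ x)) e))

  ·ₙ-ordered : ∀ {n i j x} → CharExceeds n → j ≤ n → i < j → i ·ₙ x ≈ j ·ₙ x → x ≈ 0#
  ·ₙ-ordered {n} {i} {j} {x} char j≤n i<j e with ℕₚ.m≤n⇒∃[o]m+o≡n i<j
  ... | d , ≡.refl = ·ₙ-cancel d char (≤-trans (s≤s (m≤n+m d i)) j≤n) (begin
    suc d ·ₙ x                        ≈⟨ solve 2 (λ a b → b := (a :+ b) :- a) refl (i ·ₙ x) (suc d ·ₙ x) ⟩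
    (i ·ₙ x + suc d ·ₙ x) - i ·ₙ x    ≈⟨ +-congʳ (×-homo-+ x i (suc d)) ⟨
    (i ℕ.+ suc d) ·ₙ x - i ·ₙ x       ≈⟨ +-congʳ (reflexive (≡.cong (_·ₙ x) (ℕₚ.+-suc i d))) ⟩
    suc (i ℕ.+ d) ·ₙ x - i ·ₙ x       ≈⟨ +-congʳ e ⟨
    i ·ₙ x - i ·ₙ x                   ≈⟨ -‿inverseʳ _ ⟩
    0#                                ∎)

  ·ₙ-distinct : ∀ {n} i j {x} → CharExceeds n → i ≤ n → j ≤ n → i ≢ j → i ·ₙ x ≈ j ·ₙ x → x ≈ 0#
  ·ₙ-distinct i j char i≤n j≤n i≢j e with ℕₚ.<-cmp i j
  ... | tri< i<j _ _ = ·ₙ-ordered char j≤n i<j e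
  ... | tri≈ _ i≡j _ = ⊥-elim (i≢j i≡j)
  ... | tri> _ _ j<i = ·ₙ-ordered char i≤n j<i (sym e)

  ∂-neg : ∀ p → ∂ₚ (ℙ.- p) ℙ.≈ ℙ.- ∂ₚ p
  ∂-neg p = inverseˡ-unique _ _ (ℙ.trans (ℙ.sym (∂-+ (ℙ.- p) p)) (ℙ.trans (∂-cong (ℙ.-‿inverseˡ p)) ∂-0))
    where open import Algebra.Properties.Group ℙ.+-group using (inverseˡ-unique)

  ∂-scale : ∀ t q → ∂ₚ (const t ℙ.* q) ℙ.≈ const t ℙ.* ∂ₚ q
  ∂-scale t q = ℙ.trans (∂-* (const t) q) (ℙ.trans (ℙ.+-congʳ (ℙ.trans (ℙ.*-congʳ (∂-const t)) (ℙ.zeroˡ q)))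
      (ℙ.+-identityˡ _))

  ∂-pencil : ∀ p t q → ∂ₚ (p ℙ.- const t ℙ.* q) ℙ.≈ ∂ₚ p ℙ.- const t ℙ.* ∂ₚ q
  ∂-pencil p t q = ℙ.trans (∂-+ p (ℙ.- (const t ℙ.* q))) (ℙ.+-congˡ (ℙ.trans (∂-neg _) (ℙ.-‿cong (∂-scale t q))))

  X-∂ : ∀ p i → coef (X ℙ.* ∂ₚ p) i ≈ i ·ₙ coef p i
  X-∂ p zero    = X-*-zero (∂ₚ p)
  X-∂ p (suc i) = trans (X-*-suc (∂ₚ p) i) (coef-∂ p i)

  first-nonzero : ∀ n (f : ℕ → Carrier) →
    ¬ ¬ ((∀ i → i < n → f i ≈ 0#) ⊎ Σ ℕ λ e → e < n × ¬ f e ≈ 0# × (∀ i → i < e → f i ≈ 0#))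
  first-nonzero zero    f k = k (inj₁ λ i ())
  first-nonzero (suc n) f k = first-nonzero n f step
    where
    below : (∀ i → i < n → f i ≈ 0#) → f n ≈ 0# → ∀ i → i ≤ n → f i ≈ 0#
    below z e i i≤n with ℕₚ.m≤n⇒m<n∨m≡n i≤n
    ... | inj₁ i<n    = z i i<n
    ... | inj₂ ≡.refl = e
    step : ¬ ((∀ i → i < n → f i ≈ 0#) ⊎ Σ ℕ λ e → e < n × ¬ f e ≈ 0# × (∀ i → i < e → f i ≈ 0#))
    step (inj₂ (e , e<n , nz , z)) = k (inj₂ (e , m≤n⇒m≤1+n e<n , nz , z))
    step (inj₁ z) = ¬¬-dec λ { (no nz) → k (inj₂ (n , ≤-refl , nz , z))
                             ; (yes e) → k (inj₁ λ i i<1+n → below z e i (≤-pred i<1+n)) }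

  module _ {n} (char : CharExceeds n) (p q : Poly commRing) (dp : Deg n p) (dq : Deg n q)
           (wronskian : p ℙ.* ∂ₚ q ℙ.≈ ∂ₚ p ℙ.* q) where

    private
      module _ (e : ℕ) (e<n : e < n) (q-e≉0 : ¬ coef q e ≈ 0#) (low : ∀ i → i < e → coef q i ≈ 0#) where
        t : Carrier
        t = coef p e * proj₁ (inverse (coef q e) q-e≉0)

        r : Poly commRing
        r = p ℙ.- const t ℙ.* q

        -- Subtracting a multiple of q from p does not change their Wronskian. The factor X turns ∂
        -- into the Euler operator, which multiplies the i-th coefficient by i and lowers no order.
        wronskian-r : r ℙ.* (X ℙ.* ∂ₚ q) ℙ.≈ (X ℙ.* ∂ₚ r) ℙ.* q
        wronskian-r = ℙ.trans (split p (const t) q X (∂ₚ q)) (ℙ.trans (ℙ.+-congʳ {ℙ.- (const t ℙ.* q ℙ.*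
            (X ℙ.* ∂ₚ q))} (ℙ.*-congˡ {X} wronskian))
          (ℙ.trans (join (∂ₚ p) (const t) q X (∂ₚ q)) (ℙ.*-congʳ {q} (ℙ.*-congˡ {X} (ℙ.sym (∂-pencil p t q))))))
          where
          split : ∀ p t q x q′ → (p ℙ.- t ℙ.* q) ℙ.* (x ℙ.* q′) ℙ.≈ x ℙ.* (p ℙ.* q′) ℙ.- t ℙ.* q ℙ.* (x ℙ.* q′)
          split = ℙS.solve 5 (λ p t q x q′ → (p ℙS.:- t ℙS.:* q) ℙS.:* (x ℙS.:* q′) ℙS.:= x ℙS.:*
              (p ℙS.:* q′) ℙS.:- t ℙS.:* q ℙS.:* (x ℙS.:* q′)) ℙ.refl
          join : ∀ p′ t q x q′ → x ℙ.* (p′ ℙ.* q) ℙ.- t ℙ.* q ℙ.* (x ℙ.* q′) ℙ.≈ (x ℙ.* (p′ ℙ.- t ℙ.* q′)) ℙ.* q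
          join = ℙS.solve 5 (λ p′ t q x q′ → x ℙS.:* (p′ ℙS.:* q) ℙS.:- t ℙS.:* q ℙS.:* (x ℙS.:* q′) ℙS.:=
              (x ℙS.:* (p′ ℙS.:- t ℙS.:* q′)) ℙS.:* q) ℙ.refl

        coef-r : ∀ i → coef r i ≈ coef p i - t * coef q i
        coef-r i = trans (coef-sub p (const t ℙ.* q) i) (+-congˡ (-‿cong (const-* t q i)))

        r-e≈0 : coef r e ≈ 0#
        r-e≈0 = trans (coef-r e) (begin
          coef p e - coef p e * proj₁ inv * coef q e
            ≈⟨ solve 3 (λ a b c → a :- a :* b :* c := a :* (:1 :- c :* b)) refl (coef p e) (proj₁ inv) (coef q e) ⟩
          coef p e * (1# - coef q e * proj₁ inv)
            ≈⟨ *-congˡ (trans (+-congˡ (-‿cong (proj₂ inv))) (-‿inverseʳ 1#)) ⟩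
          coef p e * 0#
            ≈⟨ zeroʳ _ ⟩
          0# ∎)
          where
          inv : Σ Carrier λ y → coef q e * y ≈ 1#
          inv = inverse (coef q e) q-e≉0

        -- Let q start at index e; t is chosen so that r has no coefficient there. If the
        -- coefficients of r below j vanish, then at index j + e the identity `wronskian-r` reads e
        -- rⱼ qₑ = j rⱼ qₑ. For j ≠ e, both at most n, this forces rⱼ = 0.
        r-zeros : ∀ j i → i < j → coef r i ≈ 0#
        r-zero : ∀ j → coef r j ≈ 0#
        r-zeros (suc j) i i<1+j with ℕₚ.m≤n⇒m<n∨m≡n (≤-pred i<1+j)
        ... | inj₁ i<j    = r-zeros j i i<j
        ... | inj₂ ≡.refl = r-zero j
        r-zero j with n ℕ.≤? j
        ... | yes n≤j = trans (coef-r j) (trans (+-cong (dp j n≤j) (-‿cong (trans (*-congˡ (dq j n≤j))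
            (zeroʳ t)))) (-‿inverseʳ 0#))
        ... | no  n≰j with e ℕ.≟ j
        ...   | yes ≡.refl = r-e≈0
        ...   | no  e≢j = ·ₙ-distinct e j char (<⇒≤ e<n) (<⇒≤ (≰⇒> n≰j)) e≢j (cancel-q (begin
          coef q e * (e ·ₙ coef r j)
            ≈⟨ solve 2 (λ x y → x :* y := y :* x) refl _ _ ⟩
          e ·ₙ coef r j * coef q e
            ≈⟨ ×-assoc-* e (coef r j) (coef q e) ⟩
          e ·ₙ (coef r j * coef q e)
            ≈⟨ ×-comm-* e (coef r j) (coef q e) ⟨
          coef r j * (e ·ₙ coef q e)
            ≈⟨ *-congˡ (X-∂ q e) ⟨
          coef r j * coef (X ℙ.* ∂ₚ q) e
            ≈⟨ *-lowest j e r (X ℙ.* ∂ₚ q) (r-zeros j) (λ i lt → trans (X-∂ q i) (·ₙ-zero i (low i lt))) ⟨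
          coef (r ℙ.* (X ℙ.* ∂ₚ q)) (j ℕ.+ e)
            ≈⟨ coef≈ wronskian-r (j ℕ.+ e) ⟩
          coef ((X ℙ.* ∂ₚ r) ℙ.* q) (j ℕ.+ e)
            ≈⟨ *-lowest j e (X ℙ.* ∂ₚ r) q (λ i lt → trans (X-∂ r i) (·ₙ-zero i (r-zeros j i lt))) low ⟩
          coef (X ℙ.* ∂ₚ r) j * coef q e
            ≈⟨ *-congʳ (X-∂ r j) ⟩
          j ·ₙ coef r j * coef q e
            ≈⟨ *-comm _ _ ⟩
          coef q e * (j ·ₙ coef r j) ∎))
          where
          cancel-q : ∀ {x y} → coef q e * x ≈ coef q e * y → x ≈ y
          cancel-q {x} {y} e′ = begin
            x            ≈⟨ solve 2 (λ x y → x := (x :- y) :+ y) refl x y ⟩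
            (x - y) + y  ≈⟨ +-congʳ (cancelˡ q-e≉0 (trans (solve 3 (λ c x y → c :*
                (x :- y) := c :* x :- c :* y) refl (coef q e) x y)
                                    (trans (+-congʳ e′) (-‿inverseʳ _)))) ⟩
            0# + y       ≈⟨ +-identityˡ y ⟩
            y            ∎

        p≈tq : p ℙ.≈ const t ℙ.* q
        p≈tq = ℙ.trans (ℙS.solve 2 (λ p u → p ℙS.:= (p ℙS.:- u) ℙS.:+ u) ℙ.refl p (const t ℙ.* q))
          (ℙ.trans (ℙ.+-congʳ {const t ℙ.* q} (mk≈ {p = r} {q = ℙ.0#} (λ i → trans (r-zero i) (sym
              (coef-0 i))))) (ℙ.+-identityˡ _))

    proportional : ¬ ¬ (q ℙ.≈ ℙ.0# ⊎ Σ Carrier λ t → p ℙ.≈ const t ℙ.* q)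
    proportional k = first-nonzero n (coef q) λ
      { (inj₁ z) → k (inj₁ (mk≈ (all z)))
      ; (inj₂ (e , e<n , nz , low)) → k (inj₂ (t e e<n nz low , p≈tq e e<n nz low)) }
      where
      all : (∀ i → i < n → coef q i ≈ 0#) → ∀ i → coef q i ≈ coef ℙ.0# i
      all z i with n ℕ.≤? i
      ... | yes n≤i = trans (dq i n≤i) (sym (coef-0 i))
      ... | no  n≰i = trans (z i (≰⇒> n≰i)) (sym (coef-0 i))

module Pencils {c ℓ} (F : Field c ℓ) (stable : Stable F) where
  open Field F
  open Sequences commRing
  open Polynomials commRing
  open FieldPolynomials F
  open IntegerSolver (polyRing commRing)
  private
    module C = Hom constHom

  ℙ-stable : ∀ {p q} → ¬ ¬ p ℙ.≈ q → p ℙ.≈ q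
  ℙ-stable h = mk≈ λ i → stable λ ne → h λ e → ne (coef≈ e i)

  -- The members of `ts` are pairwise distinct, so at most one of them equals t₀, and dropping it
  -- costs one.
  avoid : ∀ {a} {P : Carrier → Set a} t₀ ts → AllPairs (λ t u → ¬ t ≈ u) ts → All P ts →
          ¬ ¬ Σ (List Carrier) λ us → AllPairs (λ t u → ¬ t ≈ u) us × All P us × All
              (λ u → ¬ t₀ ≈ u) us × length ts ≤ suc (length us)
  avoid t₀ []       ds         ps       k = k ([] , [] , [] , [] , z≤n)
  avoid {P = P} t₀ (t ∷ ts) (d ∷ ds) (p ∷ ps) k = ¬¬-dec λ
    { (yes t₀≈t) → k (ts , ds , ps , All.map (λ t≉u t₀≈u → t≉u (trans (sym t₀≈t) t₀≈u)) d , ≤-refl)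
    ; (no t₀≉t) → avoid {P = λ u → P u × ¬ t ≈ u} t₀ ts ds (All.zip (ps , d)) λ
        { (us , ds′ , ps′ , ne , le) →
          k (t ∷ us , All.map proj₂ ps′ ∷ ds′ , p ∷ All.map proj₁ ps′ , t₀≉t ∷ ne , s≤s le) } }

  T-pencil : ∀ t p u q → T t (p ℙ.- const u ℙ.* q) ℙ.≈ T t p ℙ.- const u ℙ.* T t q
  T-pencil t p u q = ℙ.trans (+-homo p (ℙ.- (const u ℙ.* q))) (ℙ.+-congˡ (ℙ.trans (neg-homo _) (ℙ.-‿cong
    (ℙ.trans (*-homo (const u) q) (ℙ.*-congʳ (T-const t u))))))
    where
    open Hom (translate t)
    open HomProperties (translate t)

  -- The Wronskian of p and q is also that of p - t q and q, so it vanishes to order s at every t in ts; there are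
  -- too many of them, hence p = t₀ q. Then (t₀ - t) q vanishes to order s + 1 at every t.
  pencil-vanishes : ∀ {n s} → CharExceeds n → ∀ p q ts → Deg n p → Deg n q →
    AllPairs (λ t u → ¬ t ≈ u) ts → All (λ t → OrdAt t (suc s) (p ℙ.- const t ℙ.* q)) ts →
    n ℕ.+ n ≤ length ts ℕ.* s → n ≤ ℕ.pred (length ts) ℕ.* suc s → p ℙ.≈ ℙ.0# × q ℙ.≈ ℙ.0#
  pencil-vanishes {n} {s} char p q ts dp dq distinct ord big₁ big₂ = p≈0 , q≈0
    where
    W : Poly commRing
    W = p ℙ.* ∂ₚ q ℙ.- ∂ₚ p ℙ.* q

    ord-W : ∀ {t} → OrdAt t (suc s) (p ℙ.- const t ℙ.* q) → OrdAt t s W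
    ord-W {t} o = Ord-cong (ℙ.sym T-W)
      (Ord-+ {p = M ℙ.* ∂ₚ q′} {ℙ.- (∂ₚ M ℙ.* q′)} (Ord-*ˡ M (∂ₚ q′) (Ord-mono {t = suc s} {M} (n≤1+n s) o))
             (Ord-neg {p = ∂ₚ M ℙ.* q′} (Ord-*ˡ (∂ₚ M) q′ (Ord-∂ {p = M} o))))
      where
      open Hom (translate t)
      p′ q′ M : Poly commRing
      p′ = T t p
      q′ = T t q
      M = T t (p ℙ.- const t ℙ.* q)
      T-W : T t W ℙ.≈ M ℙ.* ∂ₚ q′ ℙ.- ∂ₚ M ℙ.* q′
      T-W = ℙ.trans (+-homo (p ℙ.* ∂ₚ q) (ℙ.- (∂ₚ p ℙ.* q))) (ℙ.trans
        (ℙ.+-cong (ℙ.trans (*-homo p (∂ₚ q)) (ℙ.*-congˡ (T-∂ t q)))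
                  (ℙ.trans (HomProperties.neg-homo (translate t) (∂ₚ p ℙ.* q)) (ℙ.-‿cong (ℙ.trans (*-homo
                      (∂ₚ p) q) (ℙ.*-congʳ (T-∂ t p))))))
        (ℙ.trans (solve 5 (λ p q p₁ q₁ c → p :* q₁ :- p₁ :* q :=
                      (p :- c :* q) :* q₁ :- (p₁ :- c :* q₁) :* q) ℙ.refl p′ q′ (∂ₚ p′) (∂ₚ q′) (const t))
          (ℙ.sym (ℙ.+-cong (ℙ.*-congʳ M≈) (ℙ.-‿cong (ℙ.*-congʳ (ℙ.trans (∂-cong M≈) (∂-pencil p′ t q′))))))))
        where
        M≈ : M ℙ.≈ p′ ℙ.- const t ℙ.* q′
        M≈ = T-pencil t p t q

    W≈0 : W ℙ.≈ ℙ.0#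
    W≈0 = many-zeros ts W distinct (All.map ord-W ord) (Deg-mono {p = W} big₁
      (Deg-+ {p = p ℙ.* ∂ₚ q} {ℙ.- (∂ₚ p ℙ.* q)} (Deg-* p (∂ₚ q) (Deg-mono {p = p} (n≤1+n n) dp) (Deg-∂ q dq))
        (Deg-neg {p = ∂ₚ p ℙ.* q} (Deg-* (∂ₚ p) q (Deg-mono {p = ∂ₚ p} (n≤1+n n) (Deg-∂ p dp)) dq))))

    wronskian : p ℙ.* ∂ₚ q ℙ.≈ ∂ₚ p ℙ.* q
    wronskian = ℙ.trans (solve 2 (λ x y → x := (x :- y) :+ y) ℙ.refl (p ℙ.* ∂ₚ q) (∂ₚ p ℙ.* q))
      (ℙ.trans (ℙ.+-congʳ W≈0) (ℙ.+-identityˡ _))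

    q≈0 : q ℙ.≈ ℙ.0#
    q≈0 = ℙ-stable λ q≉0 → proportional char p q dp dq wronskian λ
      { (inj₁ e) → q≉0 e
      -- t₀ may itself belong to `ts`, and there the factor t₀ - t gives nothing; hence
      -- `pred (length ts)` in the second numerical hypothesis.
      ; (inj₂ (t₀ , p≈t₀q)) → avoid t₀ ts distinct ord λ
          { (us , ds , os , ne , le) → q≉0 (many-zeros us q ds (All.zipWith (λ {
              (o , t₀≉u) → ord-q p≈t₀q o t₀≉u }) (os , ne))
              (Deg-mono {p = q} (≤-trans big₂ (ℕₚ.*-monoˡ-≤ (suc s) (≤-pred (pred-mono le)))) dq)) } }
      where
      pred-mono : ∀ {a b} → a ≤ suc b → suc (ℕ.pred a) ≤ suc b
      pred-mono z≤n     = s≤s z≤n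
      pred-mono (s≤s h) = s≤s h
      ord-q : ∀ {t₀ u} → p ℙ.≈ const t₀ ℙ.* q → OrdAt u (suc s) (p ℙ.- const u ℙ.* q) → ¬ t₀ ≈ u → OrdAt u (suc s) q
      ord-q {t₀} {u} e o t₀≉u i lt = cancelˡ (-‿≉0 t₀≉u) (trans (sym (const-* (t₀ - u) (T u q) i)) (trans (sym
          (coef≈ rewritten i)) (o i lt)))
        where
        rewritten : T u (p ℙ.- const u ℙ.* q) ℙ.≈ const (t₀ - u) ℙ.* T u q
        rewritten = ℙ.trans (T-pencil u p u q) (ℙ.trans (ℙ.+-congʳ (ℙ.trans (Hom.cong (translate u) e)
          (ℙ.trans (Hom.*-homo (translate u) (const t₀) q) (ℙ.*-congʳ (T-const u t₀)))))
          (ℙ.trans (solve 3 (λ a b q → a :* q :- b :* q := (a :- b) :* q) ℙ.refl (const t₀) (const u) (T u q))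
            (ℙ.*-congʳ (ℙ.sym (ℙ.trans (C.+-homo t₀ (- u)) (ℙ.+-congˡ (HomProperties.neg-homo constHom u)))))))

    p≈0 : p ℙ.≈ ℙ.0#
    p≈0 = many-zeros ts p distinct (All.map (λ {t} → ord-p {t}) ord)
      (Deg-mono {p = p} (≤-trans (≤-trans (m≤m+n n n) big₁) (ℕₚ.*-monoʳ-≤ (length ts) (n≤1+n s))) dp)
      where
      ord-p : ∀ {t} → OrdAt t (suc s) (p ℙ.- const t ℙ.* q) → OrdAt t (suc s) p
      ord-p {t} = OrdAt-cong {t} (ℙ.trans (ℙ.+-congˡ (ℙ.-‿cong (ℙ.trans (ℙ.*-congˡ q≈0) (ℙ.zeroʳ (const t)))))
        (solve 1 (λ p → p :- :0 := p) ℙ.refl p))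

-- Homogeneous linear systems with more unknowns than equations

module LinearSystems {c ℓ} (F : Field c ℓ) where
  open Field F hiding (zero)
  open IntegerSolver commRing
  open import Relation.Binary.Reasoning.Setoid setoid

  -- Linear forms are given as functions and not by matrix rows: the forms in question are
  -- coefficients of `onCone`, whose linearity is easy to see and whose entries are unwieldy.
  record Functional (n : ℕ) : Set (c ⊔ ℓ) where
    field
      fn     : (Fin n → Carrier) → Carrier
      cong   : ∀ {x y} → (∀ i → x i ≈ y i) → fn x ≈ fn y
      +-homo : ∀ x y → fn (λ i → x i + y i) ≈ fn x + fn y
      *-homo : ∀ a x → fn (λ i → a * x i) ≈ a * fn x

  open Functional

  private
    variable
      n : ℕ

    _∷ᵛ_ : Carrier → (Fin n → Carrier) → Fin (suc n) → Carrier
    (a ∷ᵛ x) zero    = a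
    (a ∷ᵛ x) (suc i) = x i

    basis : Fin (suc n) → Carrier
    basis = 1# ∷ᵛ (λ _ → 0#)

    -- The last component stands in for the statement that `φs` is a permutation of `π ∷ ψs`.
    Pivot : List (Functional (suc n)) → Set _
    Pivot φs = Σ (Functional _) λ π → ¬ fn π basis ≈ 0# × Σ (List (Functional _)) λ ψs →
      length φs ≡ suc (length ψs) × (∀ {P : Functional _ → Set ℓ} → P π → All P ψs → All P φs)

    find-pivot : (φs : List (Functional (suc n))) → ¬ ¬ (All (λ φ → fn φ basis ≈ 0#) φs ⊎ Pivot φs)
    find-pivot []       k = k (inj₁ [])
    find-pivot (φ ∷ φs) k = ¬¬-dec λ
      { (no φ≉0) → k (inj₂ (φ , φ≉0 , φs , ≡.refl , _∷_))
      ; (yes e) → find-pivot φs λ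
          { (inj₁ es) → k (inj₁ (e ∷ es))
          ; (inj₂ (π , π≉0 , ψs , len , put)) →
              k (inj₂ (π , π≉0 , φ ∷ ψs , ≡.cong suc len , λ { pπ (pφ ∷ ps) → pφ ∷ put pπ ps })) } }

    module Eliminate (π : Functional (suc n)) (π≉0 : ¬ fn π basis ≈ 0#) where
      ρ : Carrier
      ρ = proj₁ (inverse _ π≉0)

      lift : (Fin n → Carrier) → Fin (suc n) → Carrier
      lift x = (- (ρ * fn π (0# ∷ᵛ x))) ∷ᵛ x

      restrict : Functional (suc n) → Functional n
      restrict φ = record
        { fn = fn φ ∘ lift
        ; cong = λ {x} {y} e → cong φ λ
            { zero → -‿cong (*-congˡ (cong π λ { zero → refl ; (suc i) → e i })) ; (suc i) → e i }
        ; +-homo = λ x y → trans (cong φ λ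
            { zero → trans (-‿cong (*-congˡ (trans (cong π λ { zero → sym (+-identityʳ 0#) ; (suc i) → refl })
                (+-homo π (0# ∷ᵛ x) (0# ∷ᵛ y)))))
                           (solve 3 (λ r u v → :- (r :* (u :+ v)) := :- (r :* u) :+ :- (r :* v)) refl _ _ _)
            ; (suc i) → refl }) (+-homo φ (lift x) (lift y))
        ; *-homo = λ a x → trans (cong φ λ
            { zero → trans (-‿cong (*-congˡ (trans (cong π λ { zero → sym (zeroʳ a) ; (suc i) → refl })
                (*-homo π a (0# ∷ᵛ x)))))
                           (solve 3 (λ r a u → :- (r :* (a :* u)) := a :* :- (r :* u)) refl _ _ _)
            ; (suc i) → refl }) (*-homo φ a (lift x)) }

      π-lift : ∀ x → fn π (lift x) ≈ 0#
      π-lift x = begin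
        fn π (lift x)
          ≈⟨ cong π (λ { zero → sym (trans (+-identityʳ _) (*-identityʳ _))
                       ; (suc i) → sym (trans (+-congʳ (zeroʳ _)) (+-identityˡ _)) }) ⟩
        fn π (λ i → - (ρ * p) * basis i + (0# ∷ᵛ x) i)
          ≈⟨ +-homo π _ _ ⟩
        fn π (λ i → - (ρ * p) * basis i) + p
          ≈⟨ +-congʳ (*-homo π _ basis) ⟩
        - (ρ * p) * fn π basis + p
          ≈⟨ solve 3 (λ r p b → :- (r :* p) :* b :+ p := p :* (:1 :- b :* r)) refl ρ p (fn π basis) ⟩
        p * (1# - fn π basis * ρ)
          ≈⟨ *-congˡ (trans (+-congˡ (-‿cong (proj₂ (inverse _ π≉0)))) (-‿inverseʳ 1#)) ⟩
        p * 0#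
          ≈⟨ zeroʳ p ⟩
        0# ∎
        where
        p : Carrier
        p = fn π (0# ∷ᵛ x)

  -- Elimination of the first unknown: if no form involves it, the first basis vector is a solution;
  -- otherwise a pivot removes one unknown together with one form. Finding a pivot decides equations
  -- in F, hence the double negation.
  nontrivial-solution : ∀ n (φs : List (Functional n)) → length φs < n →
    ¬ ¬ Σ (Fin n → Carrier) λ x → ¬ (∀ i → x i ≈ 0#) × All (λ φ → fn φ x ≈ 0#) φs
  nontrivial-solution (suc n) φs lt k = find-pivot φs λ
    { (inj₁ es) → k (basis , (λ z → 1≉0 (z zero)) , es)
    ; (inj₂ (π , π≉0 , ψs , len , put)) → let open Eliminate π π≉0 in
        nontrivial-solution n (map restrict ψs)
          (≡.subst (ℕ._< n) (≡.sym (Listₚ.length-map restrict ψs)) (≤-pred (≡.subst (ℕ._< suc n) len lt))) λ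
          { (x , x≉0 , es) → k (lift x , (λ z → x≉0 (z ∘ suc)) , put {λ φ → fn φ (lift x) ≈ 0#} (π-lift x)
              (Allₚ.map⁻ es)) } }

-- Null lines and the light cone of a point

module NullGeometry {c ℓ} (F : Field c ℓ) where
  open Field F

  -- Lines in direction (1 , s , s²).
  record NullLine : Set c where
    constructor nullLine
    field
      slope y₀ z₀ : Carrier

  record Point : Set c where
    constructor point
    field
      px py pz : Carrier

  open NullLine public
  open Point public

  On : Point → NullLine → Set ℓ
  On p l = py p ≈ y₀ l + slope l * px p × pz p ≈ z₀ l + slope l * slope l * px p

module NullLines {c ℓ} (F : Field c ℓ) (N : ℕ) where
  open Field F
  open Sequences commRing
  open Polynomials commRing
  open FieldPolynomials F
  open IntegerSolver (polyRing commRing)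
  open Arrays commRing
  open NullGeometry F
  private
    R₁ : CommutativeRing _ _
    R₁ = polyRing commRing
    module P₂ = Polynomials R₁
    module ℙ₂ = CommutativeRing (polyRing R₁)
    module C = Hom constHom
    module S₁ = Sequences R₁
    module S₂ = Sequences (polyRing R₁)

  constHom₂ : Hom commRing (polyRing R₁)
  constHom₂ = P₂.constHom ∘ʰ constHom

  module E₁ = Evaluation {K = commRing} {B = R₁} constHom N
  module E₂ = Evaluation {K = commRing} {B = polyRing R₁} constHom₂ N

  onLine : Array → NullLine → Poly commRing
  onLine f l = E₁.ev f X (const (y₀ l) ℙ.+ const (slope l) ℙ.* X) (const (z₀ l) ℙ.+ const (slope l * slope l) ℙ.* X)

  fromPoint : Array → Point → Carrier → Poly commRing
  fromPoint f p s = E₁.ev f (const (px p) ℙ.+ X) (const (py p) ℙ.+ const s ℙ.* X) (const (pz p) ℙ.+ const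
      (s * s) ℙ.* X)

  τ : Poly R₁
  τ = P₂.X

  coneY coneZ : Poly R₁
  coneY = τ ℙ₂.* P₂.const X
  coneZ = τ ℙ₂.* P₂.const (X ℙ.* X)

  -- f (p + τ (1 , X , X²)), where the outer variable is τ
  onCone : Array → Point → Poly R₁
  onCone f p = E₂.ev f (P₂.const (const (px p)) ℙ₂.+ τ) (P₂.const (const (py p)) ℙ₂.+ coneY) (P₂.const (const
      (pz p)) ℙ₂.+ coneZ)

  -- A null line is parametrised by its first coordinate, so the shift by `px p` moves the origin of
  -- the parameter to p.
  translate-onLine : ∀ f {p l} → On p l → T (px p) (onLine f l) ℙ.≈ fromPoint f p (slope l)
  translate-onLine f {p} {l} (ey , ez) = ev-natural constHom (translate (px p)) constHom N (T-const (px p)) f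
    (ℙ.trans T-X (ℙ.+-comm X (const (px p)))) (affine ey) (affine ez)
    where
    open Hom (translate (px p))
    T-X : T (px p) X ℙ.≈ X ℙ.+ const (px p)
    T-X = evalₚ-X constHom (X ℙ.+ const (px p))
    affine : ∀ {v u w} → v ≈ u + w * px p → T (px p) (const u ℙ.+ const w ℙ.* X) ℙ.≈ const v ℙ.+ const w ℙ.* X
    affine {v} {u} {w} e = ℙ.trans (+-homo _ _) (ℙ.trans (ℙ.+-cong (T-const _ u) (ℙ.trans (*-homo _ _) (ℙ.*-cong
        (T-const _ w) T-X)))
      (ℙ.trans (solve 4 (λ u w x a → u :+ w :* (x :+ a) := (u :+ w :* a) :+ w :* x) ℙ.refl (const u) (const w) X
          (const (px p)))
        (ℙ.+-congʳ (ℙ.trans (ℙ.+-congˡ (ℙ.sym (C.*-homo w (px p)))) (ℙ.trans (ℙ.sym (C.+-homo u _)) (C.cong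
            (sym e)))))))

  valueAt : Carrier → Hom R₁ commRing
  valueAt s = coef₀ ∘ʰ translate s

  valueAt-const : ∀ s x → Hom.fn (valueAt s) (const x) ≈ x
  valueAt-const s x = trans (coef≈ (T-const s x) 0) (const-zero x)

  valueAt-X : ∀ s → Hom.fn (valueAt s) X ≈ s
  valueAt-X s = trans (coef≈ (evalₚ-X constHom (X ℙ.+ const s)) 0) (trans (coef-+ X (const s) 0)
    (trans (+-cong X-zero (const-zero s)) (+-identityˡ s)))

  specialize : Carrier → Hom (polyRing R₁) R₁
  specialize s = mapHom (valueAt s)

  private
    spec : Carrier → Poly R₁ → Poly commRing
    spec s = Hom.fn (specialize s)

    spec-const : ∀ s q → spec s (P₂.const q) ℙ.≈ const (Hom.fn (valueAt s) q)
    spec-const s q = mapₚ-const (valueAt s) q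

    spec-const₂ : ∀ s x → spec s (P₂.const (const x)) ℙ.≈ const x
    spec-const₂ s x = ℙ.trans (spec-const s (const x)) (C.cong (valueAt-const s x))

    spec-τ : ∀ s → spec s τ ℙ.≈ X
    spec-τ s = mapₚ-X (valueAt s)

    spec-coneY : ∀ s → spec s coneY ℙ.≈ const s ℙ.* X
    spec-coneY s = ℙ.trans (Hom.*-homo (specialize s) _ _)
      (ℙ.trans (ℙ.*-cong (spec-τ s) (ℙ.trans (spec-const s X) (C.cong (valueAt-X s)))) (ℙ.*-comm _ _))

    spec-coneZ : ∀ s → spec s coneZ ℙ.≈ const (s * s) ℙ.* X
    spec-coneZ s = ℙ.trans (Hom.*-homo (specialize s) _ _)
      (ℙ.trans (ℙ.*-cong (spec-τ s) (ℙ.trans (spec-const s (X ℙ.* X))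
        (C.cong (trans (Hom.*-homo (valueAt s) X X) (*-cong (valueAt-X s) (valueAt-X s)))))) (ℙ.*-comm _ _))

  specialize-onCone : ∀ f p s → spec s (onCone f p) ℙ.≈ fromPoint f p s
  specialize-onCone f p s = ev-natural constHom₂ (specialize s) constHom N (spec-const₂ s) f
    (ℙ.trans (+-homo _ _) (ℙ.+-cong (spec-const₂ s (px p)) (spec-τ s)))
    (ℙ.trans (+-homo _ _) (ℙ.+-cong (spec-const₂ s (py p)) (spec-coneY s)))
    (ℙ.trans (+-homo _ _) (ℙ.+-cong (spec-const₂ s (pz p)) (spec-coneZ s)))
    where open Hom (specialize s)

  specialize-coef : ∀ s Ψ j → coef (spec s Ψ) j ≈ Hom.fn (valueAt s) (coef Ψ j)
  specialize-coef s Ψ j = coef-mapₚ (valueAt s) Ψ j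

  specialize-Ord : ∀ {m} s Ψ → P₂.Ord m Ψ → Ord m (spec s Ψ)
  specialize-Ord s Ψ o j lt = trans (specialize-coef s Ψ j) (trans (Hom.cong (valueAt s) (o j lt)) (Hom.0-homo
      (valueAt s)))

  horner-Deg : ∀ {m} n α h → Deg 2 α → (∀ i → Deg m (h i)) → Deg (n ℕ.+ m) (S₁.horner n α h)
  horner-Deg zero    α h dα dh i _ = coef-0 i
  horner-Deg {m} (suc n) α h dα dh = Deg-+ {p = h 0} {α ℙ.* S₁.horner n α (h ∘ suc)} (Deg-mono {p = h 0}
      (m≤n+m m (suc n)) (dh 0))
    (Deg-* α (S₁.horner n α (h ∘ suc)) dα (horner-Deg n α (h ∘ suc) dα (dh ∘ suc)))

  -- A crude 3N + 1: each of the three nested Horner sums is charged N. The lost factor is absorbed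
  -- by the constant 10 in the choice of k.
  degree : ℕ
  degree = N ℕ.+ (N ℕ.+ (N ℕ.+ 1))

  affine-Deg : ∀ u w → Deg 2 (const u ℙ.+ const w ℙ.* X)
  affine-Deg u w = Deg-+ {p = const u} {const w ℙ.* X} (Deg-mono {p = const u} (s≤s z≤n) (Deg-const u)) (Deg-*
      (const w) X (Deg-const w) Deg-X)

  onLine-Deg : ∀ f l → Deg degree (onLine f l)
  onLine-Deg f l = horner-Deg N _ _ Deg-X λ i → horner-Deg N _ _ (affine-Deg _ _) λ j → horner-Deg N _ _
      (affine-Deg _ _) λ k → Deg-const _

  private
    -- The direction (1, s, s²) is quadratic in s, so τʲ comes with degree at most 2j in s. The
    -- offset e is for the induction: `conv` shifts its first factor, which raises the offset by
    -- two.
    Graded : ℕ → (ℕ → Poly commRing) → Set ℓ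
    Graded e f = ∀ j → Deg (suc (e ℕ.+ (j ℕ.+ j))) (f j)

    double-suc : ∀ e j → e ℕ.+ (suc j ℕ.+ suc j) ≡ suc (suc e) ℕ.+ (j ℕ.+ j)
    double-suc e j = ≡.trans (≡.cong (e ℕ.+_) (≡.cong suc (ℕₚ.+-suc j j))) (≡.trans (ℕₚ.+-suc e _) (≡.cong suc
        (ℕₚ.+-suc e _)))

    Graded-tail : ∀ {e f} → Graded e f → Graded (suc (suc e)) (f ∘ suc)
    Graded-tail {e} {f} g j = ≡.subst (λ d → Deg (suc d) (f (suc j))) (double-suc e j) (g (suc j))

    Graded-conv : ∀ d e f g → Graded d f → Graded e g → Graded (d ℕ.+ e) (S₁.conv f g)
    Graded-conv d e f g gf gg zero = ≡.subst (λ x → Deg (suc x) (f 0 ℙ.* g 0)) eq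
      (≡.subst (λ x → Deg x (f 0 ℙ.* g 0)) (ℕₚ.+-suc _ _) (Deg-* (f 0) (g 0) (gf 0) (gg 0)))
      where
      eq : (d ℕ.+ 0) ℕ.+ (e ℕ.+ 0) ≡ (d ℕ.+ e) ℕ.+ 0
      eq = ≡.trans (≡.cong₂ ℕ._+_ (ℕₚ.+-identityʳ d) (ℕₚ.+-identityʳ e)) (≡.sym (ℕₚ.+-identityʳ _))
    Graded-conv d e f g gf gg (suc n) = Deg-+ {p = f 0 ℙ.* g (suc n)} {S₁.conv (f ∘ suc) g n}
      (≡.subst (λ x → Deg x (f 0 ℙ.* g (suc n))) eq₁ (Deg-* (f 0) (g (suc n)) (gf 0) (gg (suc n))))
      (≡.subst (λ x → Deg (suc x) (S₁.conv (f ∘ suc) g n)) eq₂ (Graded-conv (suc (suc d)) e (f ∘ suc) g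
          (Graded-tail {d} {f} gf) gg n))
      where
      eq₁ : (d ℕ.+ 0) ℕ.+ suc (e ℕ.+ (suc n ℕ.+ suc n)) ≡ suc ((d ℕ.+ e) ℕ.+ (suc n ℕ.+ suc n))
      eq₁ = ≡.trans (≡.cong (ℕ._+ _) (ℕₚ.+-identityʳ d)) (≡.trans (ℕₚ.+-suc d _) (≡.cong suc (≡.sym
          (ℕₚ.+-assoc d e _))))
      eq₂ : suc (suc d) ℕ.+ e ℕ.+ (n ℕ.+ n) ≡ d ℕ.+ e ℕ.+ (suc n ℕ.+ suc n)
      eq₂ = ≡.sym (double-suc (d ℕ.+ e) n)

    GradedPoly : Poly R₁ → Set ℓ
    GradedPoly Ψ = Graded 0 (coef Ψ)

    Graded-cong : ∀ {f g : ℕ → Poly commRing} → (∀ j → f j ℙ.≈ g j) → Graded 0 g → Graded 0 f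
    Graded-cong e gg j = Deg-cong (ℙ.sym (e j)) (gg j)

    Graded-+ : ∀ Ψ Ψ′ → GradedPoly Ψ → GradedPoly Ψ′ → GradedPoly (Ψ ℙ₂.+ Ψ′)
    Graded-+ Ψ Ψ′ g g′ = Graded-cong (P₂.coef-+ Ψ Ψ′) λ j → Deg-+ {p = coef Ψ j} {coef Ψ′ j} (g j) (g′ j)

    Graded-* : ∀ Ψ Ψ′ → GradedPoly Ψ → GradedPoly Ψ′ → GradedPoly (Ψ ℙ₂.* Ψ′)
    Graded-* Ψ Ψ′ g g′ = Graded-cong (P₂.coef-* Ψ Ψ′) (Graded-conv 0 0 (coef Ψ) (coef Ψ′) g g′)

    Deg-0 : ∀ {n} → Deg n ℙ.0#
    Deg-0 i _ = coef-0 i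

    Graded-0 : GradedPoly ℙ₂.0#
    Graded-0 = Graded-cong P₂.coef-0 λ j → Deg-0

    Graded-const : ∀ x → GradedPoly (P₂.const (const x))
    Graded-const x zero    = Deg-cong (ℙ.sym (P₂.const-zero (const x))) (Deg-const x)
    Graded-const x (suc j) = Deg-cong (ℙ.sym (P₂.const-suc (const x) j)) Deg-0

    Graded-τ* : ∀ q → Deg 3 q → GradedPoly (τ ℙ₂.* P₂.const q)
    Graded-τ* q d zero          = Deg-cong (ℙ.sym (P₂.X-*-zero (P₂.const q))) Deg-0
    Graded-τ* q d (suc zero)    = Deg-cong (ℙ.sym (ℙ.trans (P₂.X-*-suc (P₂.const q) 0) (P₂.const-zero q))) d
    Graded-τ* q d (suc (suc j)) = Deg-cong (ℙ.sym (ℙ.trans (P₂.X-*-suc (P₂.const q) (suc j))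
        (P₂.const-suc q j))) Deg-0

    Graded-horner : ∀ n α (h : ℕ → Poly R₁) → GradedPoly α → (∀ i → GradedPoly (h i)) → GradedPoly (S₂.horner n α h)
    Graded-horner zero    α h gα gh = Graded-0
    Graded-horner (suc n) α h gα gh = Graded-+ (h 0) (α ℙ₂.* S₂.horner n α (h ∘ suc)) (gh 0)
      (Graded-* α (S₂.horner n α (h ∘ suc)) gα (Graded-horner n α (h ∘ suc) gα (gh ∘ suc)))

    Graded-τ : GradedPoly τ
    Graded-τ zero          = Deg-cong (ℙ.sym P₂.X-zero) Deg-0
    Graded-τ (suc zero)    = Deg-cong (ℙ.sym (P₂.X-suc 0)) (Deg-mono {n = 3} {p = ℙ.1#} (s≤s z≤n) (Deg-cong
        (C.1-homo) (Deg-const 1#)))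
    Graded-τ (suc (suc j)) = Deg-cong (ℙ.sym (P₂.X-suc (suc j))) Deg-0

  onCone-Deg : ∀ f p j → Deg (suc (j ℕ.+ j)) (coef (onCone f p) j)
  onCone-Deg f p = Graded-horner N _ _ (Graded-+ (P₂.const (const (px p))) τ (Graded-const _) Graded-τ)
    λ i → Graded-horner N _ _ (Graded-+ (P₂.const (const (py p))) coneY (Graded-const _) (Graded-τ* X (Deg-mono
        {p = X} (s≤s (s≤s z≤n)) Deg-X)))
    λ j → Graded-horner N _ _ (Graded-+ (P₂.const (const (pz p))) coneZ (Graded-const _) (Graded-τ* (X ℙ.* X)
        (Deg-* X X Deg-X Deg-X)))
    λ k → Graded-const _

module ConeDerivatives {c ℓ} (F : Field c ℓ) (stable : Stable F) (N : ℕ) where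
  open Field F
  open Polynomials commRing
  open FieldPolynomials F
  open Pencils F stable
  open IntegerSolver (polyRing commRing)
  open Arrays commRing
  open NullGeometry F
  open NullLines F N
  private
    R₁ : CommutativeRing _ _
    R₁ = polyRing commRing
    module P₂ = Polynomials R₁
    module ℙ₂ = CommutativeRing (polyRing R₁)
    module C = Hom constHom
    module C₂ = Hom P₂.constHom

  -- The coefficient of τʲ is a polynomial of degree at most 2j in X with length ss roots.
  onCone-Ord : ∀ {m} f p ss → AllPairs (λ s t → ¬ s ≈ t) ss → All (λ s → fromPoint f p s ℙ.≈ ℙ.0#) ss →
               (∀ j → j < m → suc (j ℕ.+ j) ≤ length ss) → P₂.Ord m (onCone f p)
  onCone-Ord f p ss distinct zeros enough j j<m = many-zeros {s = 1} ss (coef (onCone f p) j) distinct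
    (All.map (λ {s} e → λ { zero _ → trans (sym (specialize-coef s (onCone f p) j))
                              (trans (coef≈ (ℙ.trans (specialize-onCone f p s) e) j) (coef-0 j))
                          ; (suc _) (s≤s ()) }) zeros)
    (Deg-mono {p = coef (onCone f p) j} (≤-trans (enough j j<m) (≤-reflexive (≡.sym (ℕₚ.*-identityʳ _))))
        (onCone-Deg f p j))

  ∂ₛ : Derivation (polyRing R₁)
  ∂ₛ = P₂.coefwise ∂

  open Derivation ∂ₛ

  D-const : ∀ q → D (P₂.const q) ℙ₂.≈ P₂.const (∂ₚ q)
  D-const q = mk≈ λ
    { zero → ℙ.trans (P₂.coef-mapD ∂ (P₂.const q) 0) (ℙ.trans (∂-cong (P₂.const-zero q)) (ℙ.sym (P₂.const-zero
        (∂ₚ q))))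
    ; (suc i) → ℙ.trans (P₂.coef-mapD ∂ (P₂.const q) (suc i)) (ℙ.trans (∂-cong (P₂.const-suc q i)) (ℙ.trans ∂-0
        (ℙ.sym (P₂.const-suc (∂ₚ q) i)))) }

  D-const₂ : ∀ x → D (P₂.const (const x)) ℙ₂.≈ ℙ₂.0#
  D-const₂ x = ℙ₂.trans (D-const (const x)) (ℙ₂.trans (C₂.cong (∂-const x)) C₂.0-homo)

  D-τ : D τ ℙ₂.≈ ℙ₂.0#
  D-τ = mk≈ λ i → ℙ.trans (P₂.coef-mapD ∂ τ i) (ℙ.trans (go i) (ℙ.sym (P₂.coef-0 i)))
    where
    go : ∀ i → ∂ₚ (coef τ i) ℙ.≈ ℙ.0#
    go zero          = ℙ.trans (∂-cong P₂.X-zero) ∂-0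
    go (suc zero)    = ℙ.trans (∂-cong (P₂.X-suc 0)) ∂-1
    go (suc (suc i)) = ℙ.trans (∂-cong (P₂.X-suc (suc i))) ∂-0

  D-τ* : ∀ q → D (τ ℙ₂.* P₂.const q) ℙ₂.≈ τ ℙ₂.* P₂.const (∂ₚ q)
  D-τ* q = ℙ₂.trans (D-* τ (P₂.const q)) (ℙ₂.trans (ℙ₂.+-cong (ℙ₂.trans (ℙ₂.*-congʳ D-τ) (ℙ₂.zeroˡ _))
      (ℙ₂.*-congˡ (D-const q))) (ℙ₂.+-identityˡ _))

  private
    2X : Poly commRing
    2X = X ℙ.+ X

    ω : Poly R₁
    ω = τ ℙ₂.* P₂.const 2X

    D-coneY : D coneY ℙ₂.≈ τ
    D-coneY = ℙ₂.trans (D-τ* X) (ℙ₂.trans (ℙ₂.*-congˡ (ℙ₂.trans (C₂.cong ∂-X) C₂.1-homo)) (ℙ₂.*-identityʳ τ))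

    D-coneZ : D coneZ ℙ₂.≈ ω
    D-coneZ = ℙ₂.trans (D-τ* (X ℙ.* X)) (ℙ₂.*-congˡ (C₂.cong (ℙ.trans (∂-* X X)
      (ℙ.+-cong (ℙ.trans (ℙ.*-congʳ ∂-X) (ℙ.*-identityˡ X)) (ℙ.trans (ℙ.*-congˡ ∂-X) (ℙ.*-identityʳ X))))))

    D-ω : D ω ℙ₂.≈ τ ℙ₂.* P₂.const (const (1# + 1#))
    D-ω = ℙ₂.trans (D-τ* 2X) (ℙ₂.*-congˡ (C₂.cong (ℙ.trans (∂-+ X X) (ℙ.trans (ℙ.+-cong ∂-X ∂-X)
      (ℙ.sym (ℙ.trans (C.+-homo 1# 1#) (ℙ.+-cong C.1-homo C.1-homo)))))))

    D-shift : ∀ {x Ψ Ψ′} → D Ψ ℙ₂.≈ Ψ′ → D (P₂.const (const x) ℙ₂.+ Ψ) ℙ₂.≈ Ψ′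
    D-shift {x} {Ψ} e = ℙ₂.trans (D-+ (P₂.const (const x)) Ψ) (ℙ₂.trans (ℙ₂.+-cong (D-const₂ x) e) (ℙ₂.+-identityˡ _))

  D-onCone : ∀ f p → Supported N f → D (onCone f p) ℙ₂.≈ onCone (∂₂ f) p ℙ₂.* τ ℙ₂.+ onCone (∂₃ f) p ℙ₂.* ω
  D-onCone f p s = ℙ₂.trans (E₂.ev-chain ∂ₛ D-const₂ f _ _ _ s)
    (ℙ₂.+-cong (ℙ₂.trans (ℙ₂.+-cong (ℙ₂.trans (ℙ₂.*-congˡ (D-shift D-τ)) (ℙ₂.zeroʳ _)) (ℙ₂.*-congˡ
        (D-shift D-coneY))) (ℙ₂.+-identityˡ _))
               (ℙ₂.*-congˡ (D-shift D-coneZ)))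

  private
    weaken : ∀ {f} → Supported N f → Supported (suc N) f
    weaken {f} = Supported-mono f (n≤1+n N)

  -- The term from D ω carries a single factor τ, while the second derivatives of f carry τ²: after
  -- division by τ they appear as λ + tκ. Mixed partial derivatives are kept in both orders.
  D²-onCone : ∀ f p → Supported N f → D (D (onCone f p)) ℙ₂.≈
    (onCone (∂₂ (∂₂ f)) p ℙ₂.* τ ℙ₂.+ onCone (∂₃ (∂₂ f)) p ℙ₂.* ω) ℙ₂.* τ ℙ₂.+
    ((onCone (∂₂ (∂₃ f)) p ℙ₂.* τ ℙ₂.+ onCone (∂₃ (∂₃ f)) p ℙ₂.* ω) ℙ₂.* ω ℙ₂.+ onCone (∂₃ f) p ℙ₂.*
        (τ ℙ₂.* P₂.const (const (1# + 1#))))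
  D²-onCone f p s = ℙ₂.trans (D-cong (D-onCone f p s)) (ℙ₂.trans (D-+ _ _) (ℙ₂.+-cong
    (ℙ₂.trans (D-* _ τ) (ℙ₂.trans (ℙ₂.+-cong (ℙ₂.*-congʳ (D-onCone (∂₂ f) p (∂₂-supported f (weaken s))))
        (ℙ₂.trans (ℙ₂.*-congˡ D-τ) (ℙ₂.zeroʳ _))) (ℙ₂.+-identityʳ _)))
    (ℙ₂.trans (D-* _ ω) (ℙ₂.+-cong (ℙ₂.*-congʳ (D-onCone (∂₃ f) p (∂₃-supported f (weaken s)))) (ℙ₂.*-congˡ D-ω)))))

  D-Ord : ∀ {m} Ψ → P₂.Ord m Ψ → P₂.Ord m (D Ψ)
  D-Ord Ψ o i lt = ℙ.trans (P₂.coef-mapD ∂ Ψ i) (ℙ.trans (∂-cong (o i lt)) ∂-0)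

  -- With u = (1 , s , s²), w = ∂u/∂s and n = ∂w/∂s, these are the derivative of f along w,
  -- the second derivative along w, and the derivative along n.
  module Along (R : Array → Poly commRing) (s : Carrier) where
    S : Poly commRing
    S = const (s + s)

    ∂w ∂w² ∂n : Array → Poly commRing
    ∂w f = R (∂₂ f) ℙ.+ S ℙ.* R (∂₃ f)
    ∂w² f = R (∂₂ (∂₂ f)) ℙ.+ S ℙ.* (R (∂₃ (∂₂ f)) ℙ.+ R (∂₂ (∂₃ f))) ℙ.+ S ℙ.* S ℙ.* R (∂₃ (∂₃ f))
    ∂n f = const (1# + 1#) ℙ.* R (∂₃ f)

  private
    spec : Carrier → Poly R₁ → Poly commRing
    spec s = Hom.fn (specialize s)

    spec-ω : ∀ s → spec s ω ℙ.≈ X ℙ.* const (s + s)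
    spec-ω s = ℙ.trans (*-homo τ _) (ℙ.*-cong (mapₚ-X (valueAt s)) (ℙ.trans (mapₚ-const (valueAt s) 2X)
      (C.cong (trans (Hom.+-homo (valueAt s) X X) (+-cong (valueAt-X s) (valueAt-X s))))))
      where open Hom (specialize s)

  module _ (f : Array) (supported : Supported N f) (p : Point) (s : Carrier) {m : ℕ} (ord : P₂.Ord (suc m) (onCone f p)) where
    open Hom (specialize s)
    open Along (λ g → fromPoint g p s) s

    -- Differentiating in s costs no order in τ; the only loss is the factor τ common to both terms
    -- of ∂F/∂s.
    ∂w-Ord : Ord m (∂w f)
    ∂w-Ord = Ord-X* (∂w f) (Ord-cong eq (specialize-Ord s (D (onCone f p)) (D-Ord (onCone f p) ord)))
      where
      eq : spec s (D (onCone f p)) ℙ.≈ X ℙ.* ∂w f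
      eq = ℙ.trans (cong (D-onCone f p supported)) (ℙ.trans (+-homo _ _) (ℙ.trans
        (ℙ.+-cong (ℙ.trans (*-homo _ _) (ℙ.*-cong (specialize-onCone (∂₂ f) p s) (mapₚ-X (valueAt s))))
                  (ℙ.trans (*-homo _ _) (ℙ.*-cong (specialize-onCone (∂₃ f) p s) (spec-ω s))))
        (solve 4 (λ a b x t → a :* x :+ b :* (x :* t) := x :* (a :+ t :* b)) ℙ.refl _ _ X S)))

    ∂w²-Ord : Ord m (X ℙ.* ∂w² f ℙ.+ ∂n f)
    ∂w²-Ord = Ord-X* (X ℙ.* ∂w² f ℙ.+ ∂n f) (Ord-cong eq (specialize-Ord s (D (D (onCone f p))) (D-Ord (D
        (onCone f p)) (D-Ord (onCone f p) ord))))
      where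
      first : ∀ g h → spec s (onCone g p ℙ₂.* τ ℙ₂.+ onCone h p ℙ₂.* ω) ℙ.≈ fromPoint g p s ℙ.* X ℙ.+ fromPoint h p s ℙ.* (X ℙ.* S)
      first g h = ℙ.trans (+-homo _ _) (ℙ.+-cong (ℙ.trans (*-homo _ _) (ℙ.*-cong (specialize-onCone g p s)
          (mapₚ-X (valueAt s))))
        (ℙ.trans (*-homo _ _) (ℙ.*-cong (specialize-onCone h p s) (spec-ω s))))
      eq : spec s (D (D (onCone f p))) ℙ.≈ X ℙ.* (X ℙ.* ∂w² f ℙ.+ ∂n f)
      eq = ℙ.trans (cong (D²-onCone f p supported)) (ℙ.trans (+-homo _ _) (ℙ.trans (ℙ.+-cong
          (ℙ.trans (*-homo _ _) (ℙ.*-cong (first (∂₂ (∂₂ f)) (∂₃ (∂₂ f))) (mapₚ-X (valueAt s))))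
          (ℙ.trans (+-homo _ _) (ℙ.+-cong (ℙ.trans (*-homo _ _) (ℙ.*-cong (first (∂₂ (∂₃ f)) (∂₃ (∂₃ f))) (spec-ω s)))
            (ℙ.trans (*-homo _ _) (ℙ.*-cong (specialize-onCone (∂₃ f) p s) (ℙ.trans (*-homo _ _)
              (ℙ.*-cong (mapₚ-X (valueAt s)) (ℙ.trans (mapₚ-const (valueAt s) _) (C.cong (valueAt-const s
                  (1# + 1#)))))))))))
        (solve 8 (λ a b b′ d e x t u →
            (a :* x :+ b :* (x :* t)) :* x :+ ((b′ :* x :+ d :* (x :* t)) :* (x :* t) :+ e :* (x :* u))
            := x :* (x :* (a :+ t :* (b :+ b′) :+ t :* t :* d) :+ u :* e)) ℙ.refl _ _ _ _ _ X S (const (1# + 1#)))))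

  module _ (two≉0 : ¬ 1# + 1# ≈ 0#) (char : CharExceeds (suc degree)) (f : Array) (supported : Supported N f)
           (l : NullLine) {s : ℕ} (ps : List Point) (on : All (λ p → On p l) ps)
           (distinct : AllPairs (λ p q → ¬ px p ≈ px q) ps)
           (ord : All (λ p → P₂.Ord (suc (suc s)) (onCone f p)) ps)
           (big₁ : suc degree ℕ.+ suc degree ≤ length ps ℕ.* s) (big₂ : suc degree ≤ ℕ.pred (length ps) ℕ.* suc s)
           (f≈0 : onLine f l ℙ.≈ ℙ.0#) where
    private
      open Along (λ g → onLine g l) (slope l)

      -- At the point with first coordinate tᵢ the combination of high order is λ′ + (X - tᵢ) κ. In
      -- terms of ν it is ν - tᵢ κ, a member of a pencil with constant coefficients, as
      -- `pencil-vanishes` requires.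
      κ λ′ ν : Poly commRing
      κ = ∂w² f
      λ′ = ∂n f
      ν = X ℙ.* κ ℙ.+ λ′

      ts : List Carrier
      ts = map px ps

      ts-length : length ts ≡ length ps
      ts-length = Listₚ.length-map px ps

      ts-distinct : AllPairs (λ t u → ¬ t ≈ u) ts
      ts-distinct = AllPairsₚ.map⁺ distinct

      scale-Deg : ∀ {n} x q → Deg n q → Deg n (const x ℙ.* q)
      scale-Deg x q d = Deg-* (const x) q (Deg-const x) d

      κ-Deg : Deg degree κ
      κ-Deg = Deg-+ {p = _} {S ℙ.* S ℙ.* onLine (∂₃ (∂₃ f)) l}
        (Deg-+ {p = onLine (∂₂ (∂₂ f)) l} {S ℙ.* (onLine (∂₃ (∂₂ f)) l ℙ.+ onLine (∂₂ (∂₃ f)) l)} (onLine-Deg _ l)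
          (scale-Deg _ _ (Deg-+ {p = onLine (∂₃ (∂₂ f)) l} {onLine (∂₂ (∂₃ f)) l} (onLine-Deg _ l) (onLine-Deg _ l))))
        (Deg-* (S ℙ.* S) _ (Deg-* S S (Deg-const _) (Deg-const _)) (onLine-Deg _ l))

      ν-Deg : Deg (suc degree) ν
      ν-Deg = Deg-+ {p = X ℙ.* κ} {λ′} (Deg-* X κ Deg-X κ-Deg) (Deg-mono {p = λ′} (n≤1+n degree) (scale-Deg _ _
          (onLine-Deg _ l)))

      module _ {p : Point} (on : On p l) where
        open Hom (translate (px p))
        module L = Along (λ g → fromPoint g p (slope l)) (slope l)

        tr : ∀ g → T (px p) (onLine g l) ℙ.≈ fromPoint g p (slope l)
        tr g = translate-onLine g on

        T-∂w : T (px p) (∂w f) ℙ.≈ L.∂w f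
        T-∂w = ℙ.trans (+-homo _ _) (ℙ.+-cong (tr _) (ℙ.trans (*-homo _ _) (ℙ.*-cong (T-const _ _) (tr _))))

        T-∂w² : T (px p) κ ℙ.≈ L.∂w² f
        T-∂w² = ℙ.trans (+-homo _ _) (ℙ.+-cong
          (ℙ.trans (+-homo _ _) (ℙ.+-cong (tr _) (ℙ.trans (*-homo _ _) (ℙ.*-cong (T-const _ _) (ℙ.trans
              (+-homo _ _) (ℙ.+-cong (tr _) (tr _)))))))
          (ℙ.trans (*-homo _ _) (ℙ.*-cong (ℙ.trans (*-homo _ _) (ℙ.*-cong (T-const _ _) (T-const _ _))) (tr _))))

        T-∂n : T (px p) λ′ ℙ.≈ L.∂n f
        T-∂n = ℙ.trans (*-homo _ _) (ℙ.*-cong (T-const _ _) (tr _))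

        T-ν : T (px p) (ν ℙ.- const (px p) ℙ.* κ) ℙ.≈ X ℙ.* L.∂w² f ℙ.+ L.∂n f
        T-ν = ℙ.trans (T-pencil (px p) ν (px p) κ) (ℙ.trans (ℙ.+-congʳ (ℙ.trans (+-homo _ _) (ℙ.+-congʳ (ℙ.trans
            (*-homo _ _)
            (ℙ.*-congʳ (evalₚ-X constHom (X ℙ.+ const (px p))))))))
          (ℙ.trans (solve 4 (λ x a k n → (x :+ a) :* k :+ n :- a :* k := x :* k :+ n) ℙ.refl X (const (px p)) _ _)
            (ℙ.+-cong (ℙ.*-congˡ T-∂w²) T-∂n)))

      both : ν ℙ.≈ ℙ.0# × κ ℙ.≈ ℙ.0#
      both = pencil-vanishes {suc degree} {s} char ν κ ts ν-Deg (Deg-mono {p = κ} (n≤1+n degree) κ-Deg) ts-distinct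
        (Allₚ.map⁺ (All.zipWith (λ { {p} (o , d) → Ord-cong (ℙ.sym (T-ν o)) (∂w²-Ord f supported p
            (slope l) d) }) (on , ord)))
        (≡.subst (λ n → _ ≤ n ℕ.* s) (≡.sym ts-length) big₁) (≡.subst (λ n → _ ≤ ℕ.pred n ℕ.* suc s)
            (≡.sym ts-length) big₂)

      ∂w≈0 : ∂w f ℙ.≈ ℙ.0#
      ∂w≈0 = many-zeros {suc s} ts (∂w f) ts-distinct
        (Allₚ.map⁺ (All.zipWith (λ { {p} (o , d) → Ord-cong (ℙ.sym (T-∂w o)) (∂w-Ord f supported p
            (slope l) d) }) (on , ord)))
        (Deg-mono {p = ∂w f} (≤-trans (≤-trans (n≤1+n degree) (m≤m+n _ _)) (≤-trans
            (≡.subst (λ n → _ ≤ n ℕ.* s) (≡.sym ts-length) big₁) (ℕₚ.*-monoʳ-≤ (length ts) (n≤1+n s))))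
          (Deg-+ {p = onLine (∂₂ f) l} {S ℙ.* onLine (∂₃ f) l} (onLine-Deg _ l) (scale-Deg _ _ (onLine-Deg _ l))))

    ∂₃-vanishes : onLine (∂₃ f) l ℙ.≈ ℙ.0#
    ∂₃-vanishes = mk≈ λ i → trans (cancelˡ two≉0 (trans (sym (const-* (1# + 1#) (onLine (∂₃ f) l) i)) (trans
        (coef≈ λ′≈0 i) (coef-0 i)))) (sym (coef-0 i))
      where
      λ′≈0 : λ′ ℙ.≈ ℙ.0#
      λ′≈0 = ℙ.trans (solve 3 (λ x k n → n := (x :* k :+ n) :- x :* k) ℙ.refl X κ λ′)
        (ℙ.trans (ℙ.+-cong (proj₁ both) (ℙ.-‿cong (ℙ.trans (ℙ.*-congˡ (proj₂ both)) (ℙ.zeroʳ X))))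
            (ℙ.-‿inverseʳ ℙ.0#))

    ∂₂-vanishes : onLine (∂₂ f) l ℙ.≈ ℙ.0#
    ∂₂-vanishes = ℙ.trans (solve 3 (λ a t b → a := (a :+ t :* b) :- t :* b) ℙ.refl (onLine (∂₂ f) l) S (onLine
        (∂₃ f) l))
      (ℙ.trans (ℙ.+-cong ∂w≈0 (ℙ.-‿cong (ℙ.trans (ℙ.*-congˡ ∂₃-vanishes) (ℙ.zeroʳ S)))) (ℙ.-‿inverseʳ ℙ.0#))

    -- The derivative along l is zero since f vanishes on l. It is a combination of the three
    -- partial derivatives in which the first has coefficient one.
    ∂₁-vanishes : onLine (∂₁ f) l ℙ.≈ ℙ.0#
    ∂₁-vanishes = ℙ.trans (ℙ.sym (ℙ.*-identityʳ _)) (ℙ.trans (ℙ.*-congˡ (ℙ.sym ∂-X)) (ℙ.trans (ℙ.sym last-two)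
        (ℙ.trans (ℙ.sym chain) (ℙ.trans (∂-cong f≈0) ∂-0))))
      where
      dy dz : Poly commRing
      dy = ∂ₚ (const (y₀ l) ℙ.+ const (slope l) ℙ.* X)
      dz = ∂ₚ (const (z₀ l) ℙ.+ const (slope l * slope l) ℙ.* X)
      chain : ∂ₚ (onLine f l) ℙ.≈ onLine (∂₁ f) l ℙ.* ∂ₚ X ℙ.+ onLine (∂₂ f) l ℙ.* dy ℙ.+ onLine (∂₃ f) l ℙ.* dz
      chain = E₁.ev-chain ∂ ∂-const f _ _ _ supported
      last-two : onLine (∂₁ f) l ℙ.* ∂ₚ X ℙ.+ onLine (∂₂ f) l ℙ.* dy ℙ.+ onLine (∂₃ f) l ℙ.* dz ℙ.≈ onLine
          (∂₁ f) l ℙ.* ∂ₚ X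
      last-two = ℙ.trans (ℙ.+-cong (ℙ.+-congˡ (ℙ.trans (ℙ.*-congʳ ∂₂-vanishes) (ℙ.zeroˡ dy))) (ℙ.trans
          (ℙ.*-congʳ ∂₃-vanishes) (ℙ.zeroˡ dz)))
        (ℙ.trans (ℙ.+-identityʳ _) (ℙ.+-identityʳ _))

-- The auxiliary polynomial and its vanishing

length-cartesianProduct : ∀ {a b} {A : Set a} {B : Set b} (xs : List A) (ys : List B) →
                          length (cartesianProduct xs ys) ≡ length xs ℕ.* length ys
length-cartesianProduct []       ys = ≡.refl
length-cartesianProduct (x ∷ xs) ys = ≡.trans (Listₚ.length-++ (map (x ,_) ys))
  (≡.cong₂ ℕ._+_ (Listₚ.length-map (x ,_) ys) (length-cartesianProduct xs ys))

module Boxes {c ℓ} (F : Field c ℓ) (M : ℕ) where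
  open Field F hiding (zero)
  open Arrays commRing

  -- The unknowns are the coefficients with all three exponents below M. This box lies in the
  -- simplex of total degree below 3M and has a dimension that is immediate to count; only a
  -- constant factor is lost.
  dimension : ℕ
  dimension = M ℕ.* (M ℕ.* M)

  index : ℕ → ℕ → ℕ → Maybe (Fin dimension)
  index i j l with i ℕ.<? M | j ℕ.<? M | l ℕ.<? M
  ... | yes p | yes q | yes r = just (Fin.combine (Fin.fromℕ< p) (Fin.combine (Fin.fromℕ< q) (Fin.fromℕ< r)))
  ... | _     | _     | _     = nothing

  index-toℕ : ∀ i j l → index (Fin.toℕ i) (Fin.toℕ j) (Fin.toℕ l) ≡ just (Fin.combine i (Fin.combine j l))
  index-toℕ i j l with Fin.toℕ i ℕ.<? M | Fin.toℕ j ℕ.<? M | Fin.toℕ l ℕ.<? M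
  ... | yes p | yes q | yes r = ≡.cong just (≡.cong₂ Fin.combine (Finₚ.fromℕ<-toℕ i p)
                                  (≡.cong₂ Fin.combine (Finₚ.fromℕ<-toℕ j q) (Finₚ.fromℕ<-toℕ l r)))
  ... | no ¬p | _     | _     = ⊥-elim (¬p (Finₚ.toℕ<n i))
  ... | yes _ | no ¬q | _     = ⊥-elim (¬q (Finₚ.toℕ<n j))
  ... | yes _ | yes _ | no ¬r = ⊥-elim (¬r (Finₚ.toℕ<n l))

  index-outside : ∀ i j l → M ℕ.+ M ℕ.+ M ≤ i ℕ.+ j ℕ.+ l → index i j l ≡ nothing
  index-outside i j l le with i ℕ.<? M | j ℕ.<? M | l ℕ.<? M
  ... | yes p | yes q | yes r = ⊥-elim (ℕₚ.<⇒≱ (ℕₚ.+-mono-< (ℕₚ.+-mono-< p q) r) le)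
  ... | no _  | _     | _     = ≡.refl
  ... | yes _ | no _  | _     = ≡.refl
  ... | yes _ | yes _ | no _  = ≡.refl

  array : (Fin dimension → Carrier) → Array
  array x i j l = maybe x 0# (index i j l)

  array-supported : ∀ x → Supported (M ℕ.+ M ℕ.+ M) (array x)
  array-supported x i j l le rewrite index-outside i j l le = refl

  array-injective : ∀ x → (∀ i j l → array x i j l ≈ 0#) → ∀ u → x u ≈ 0#
  array-injective x z u with Fin.remQuot {M} (M ℕ.* M) u in eq₁
  ... | i , v with Fin.remQuot {M} M v in eq₂
  ... | j , l = trans (reflexive (≡.cong (maybe x 0#) (≡.sym (≡.trans (index-toℕ i j l) (≡.cong just
      (≡.sym u≡)))))) (z (Fin.toℕ i) (Fin.toℕ j) (Fin.toℕ l))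
    where
    u≡ : u ≡ Fin.combine i (Fin.combine j l)
    u≡ = ≡.trans (≡.sym (Finₚ.combine-remQuot {M} (M ℕ.* M) u)) (≡.trans (≡.cong (λ {
        (a , b) → Fin.combine a b }) eq₁)
           (≡.cong (Fin.combine i) (≡.trans (≡.sym (Finₚ.combine-remQuot {M} M v)) (≡.cong (λ {
               (a , b) → Fin.combine a b }) eq₂))))

  array-cong : ∀ {x y} → (∀ u → x u ≈ y u) → ∀ i j l → array x i j l ≈ array y i j l
  array-cong e i j l with index i j l
  ... | just u  = e u
  ... | nothing = refl

  array-+ : ∀ x y i j l → array (λ u → x u + y u) i j l ≈ array x i j l + array y i j l
  array-+ x y i j l with index i j l
  ... | just u  = refl
  ... | nothing = sym (+-identityʳ 0#)

  array-* : ∀ a x i j l → array (λ u → a * x u) i j l ≈ a * array x i j l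
  array-* a x i j l with index i j l
  ... | just u  = refl
  ... | nothing = sym (zeroʳ a)

module Configurations {c ℓ} (F : Field c ℓ) (stable : Stable F)
  {rˡ rᶜ} {Row : Set rˡ} {Col : Set rᶜ} (line : Row → NullGeometry.NullLine F) (pt : Col → NullGeometry.Point F)
  (cols : Row → List Col) (rows : Col → List Row) (k r : ℕ)
  (k≤cols : ∀ a → k ≤ length (cols a)) (r≤rows : ∀ b → r ≤ length (rows b))
  (on-cols : ∀ a → All (λ b → NullGeometry.On F (pt b) (line a)) (cols a))
  (on-rows : ∀ b → All (λ a → NullGeometry.On F (pt b) (line a)) (rows b))
  (cols-distinct : ∀ a → AllPairs (λ b b′ → ¬ Field._≈_ F (NullGeometry.px (pt b)) (NullGeometry.px (pt b′)))
      (cols a))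
  (rows-distinct : ∀ b → AllPairs (λ a a′ → ¬ Field._≈_ F (NullGeometry.slope (line a)) (NullGeometry.slope
      (line a′))) (rows b))
  (row₀ : Row)
  where
  open Field F hiding (zero)
  open Sequences commRing
  open Polynomials commRing
  open FieldPolynomials F
  open Arrays commRing
  open NullGeometry F

  module _ (N : ℕ) where
    open NullLines F N
    open ConeDerivatives F stable N
    private
      module P₂ = Polynomials (polyRing commRing)
      module ℙ₂ = CommutativeRing (polyRing (polyRing commRing))
      module S₁ = Sequences (polyRing commRing)

    horner-first : ∀ n x (h : ℕ → Poly commRing) → (∀ i → h (suc i) ℙ.≈ ℙ.0#) → S₁.horner (suc n) x h ℙ.≈ h 0
    horner-first n x h z = ℙ.trans (ℙ.+-congˡ (ℙ.trans (ℙ.*-congˡ (S₁.horner-zero n x z)) (ℙ.zeroʳ x)))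
        (ℙ.+-identityʳ _)

    fromPoint-vanishes : ∀ f {b a} → On (pt b) (line a) → onLine f (line a) ℙ.≈ ℙ.0# → fromPoint f (pt b) (slope
        (line a)) ℙ.≈ ℙ.0#
    fromPoint-vanishes f {b} on e = ℙ.trans (ℙ.sym (translate-onLine f on)) (ℙ.trans (Hom.cong (translate (px
        (pt b))) e) (Hom.0-homo (translate (px (pt b)))))

    module _ (two≉0 : ¬ 1# + 1# ≈ 0#) (char : CharExceeds (suc degree)) (s : ℕ)
             (big₁ : suc degree ℕ.+ suc degree ≤ k ℕ.* s) (big₂ : suc degree ≤ ℕ.pred k ℕ.* suc s)
             (rich : ∀ j → j < suc (suc s) → suc (j ℕ.+ j) ≤ r) where

      -- Induction on the total degree. The partial derivatives vanish on all lines too, so they are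
      -- zero, and division by the exponents leaves only the constant term, which is the value of f
      -- on `row₀`. N stays fixed while w falls, so the numerical hypotheses are the same at each
      -- stage.
      vanishing : ∀ w f → w ≤ N → Supported w f → (∀ a → onLine f (line a) ℙ.≈ ℙ.0#) → ∀ i j l → f i j l ≈ 0#
      vanishing zero    f w≤N supp zeros i j l = supp i j l z≤n
      vanishing (suc w) f w<N supp zeros = coefficient
        where
        ord : ∀ b → P₂.Ord (suc (suc s)) (onCone f (pt b))
        ord b = onCone-Ord f (pt b) (map (slope ∘ line) (rows b)) (AllPairsₚ.map⁺ (rows-distinct b))
          (Allₚ.map⁺ (All.map (λ {a} on → fromPoint-vanishes f on (zeros a)) (on-rows b)))
          (λ j lt → ≤-trans (rich j lt) (≤-trans (r≤rows b) (≤-reflexive (≡.sym (Listₚ.length-map _ (rows b))))))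
        suppN : Supported N f
        suppN = Supported-mono f w<N supp
        module _ (a : Row) where
          ps : List Point
          ps = map pt (cols a)
          k≤ps : k ≤ length ps
          k≤ps = ≤-trans (k≤cols a) (≤-reflexive (≡.sym (Listₚ.length-map pt (cols a))))
          on-ps : All (λ p → On p (line a)) ps
          on-ps = Allₚ.map⁺ (on-cols a)
          ps-distinct : AllPairs (λ p q → ¬ px p ≈ px q) ps
          ps-distinct = AllPairsₚ.map⁺ (cols-distinct a)
          ords : All (λ p → P₂.Ord (suc (suc s)) (onCone f p)) ps
          ords = Allₚ.map⁺ (All.universal ord (cols a))
          large₁ : suc degree ℕ.+ suc degree ≤ length ps ℕ.* s
          large₁ = ≤-trans big₁ (ℕₚ.*-monoˡ-≤ s k≤ps)
          large₂ : suc degree ≤ ℕ.pred (length ps) ℕ.* suc s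
          large₂ = ≤-trans big₂ (ℕₚ.*-monoˡ-≤ (suc s) (pred-mono-≤ k≤ps))
          z₁ : onLine (∂₁ f) (line a) ℙ.≈ ℙ.0#
          z₁ = ∂₁-vanishes two≉0 char f suppN (line a) ps on-ps ps-distinct ords large₁ large₂ (zeros a)
          z₂ : onLine (∂₂ f) (line a) ℙ.≈ ℙ.0#
          z₂ = ∂₂-vanishes two≉0 char f suppN (line a) ps on-ps ps-distinct ords large₁ large₂ (zeros a)
          z₃ : onLine (∂₃ f) (line a) ℙ.≈ ℙ.0#
          z₃ = ∂₃-vanishes two≉0 char f suppN (line a) ps on-ps ps-distinct ords large₁ large₂ (zeros a)
        w≤N : w ≤ N
        w≤N = <⇒≤ w<N
        divide : ∀ i {x} → i < suc w → suc i ·ₙ x ≈ 0# → x ≈ 0#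
        divide i lt = ·ₙ-cancel i char (≤-trans lt (≤-trans w<N (≤-trans (m≤m+n N _) (n≤1+n degree))))
        coefficient₁ : ∀ i j l → f (suc i) j l ≈ 0#
        coefficient₁ i j l with suc w ℕ.≤? i
        ... | yes le = supp (suc i) j l (≤-trans le (m≤n⇒m≤1+n (≤-trans (m≤m+n i j) (m≤m+n _ l))))
        ... | no ¬le = divide i (≰⇒> ¬le) (vanishing w (∂₁ f) w≤N (∂₁-supported f supp) z₁ i j l)
        coefficient₂ : ∀ i j l → f i (suc j) l ≈ 0#
        coefficient₂ i j l with suc w ℕ.≤? j
        ... | yes le = supp i (suc j) l (≤-trans le (≤-trans (n≤1+n j) (≤-trans (m≤n+m (suc j) i) (m≤m+n _ l))))
        ... | no ¬le = divide j (≰⇒> ¬le) (vanishing w (∂₂ f) w≤N (∂₂-supported f supp) z₂ i j l)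
        coefficient₃ : ∀ i j l → f i j (suc l) ≈ 0#
        coefficient₃ i j l with suc w ℕ.≤? l
        ... | yes le = supp i j (suc l) (≤-trans le (≤-trans (n≤1+n l) (m≤n+m (suc l) (i ℕ.+ j))))
        ... | no ¬le = divide l (≰⇒> ¬le) (vanishing w (∂₃ f) w≤N (∂₃-supported f supp) z₃ i j l)
        -- Stated for a variable n equal to N, so that `horner` unfolds once; N is positive because
        -- w < N.
        constant : ∀ n → n ≡ N → ∀ α β γ → Evaluation.ev {K = commRing}
            {B = polyRing commRing} constHom n f α β γ ℙ.≈ ℙ.0# → f 0 0 0 ≈ 0#
        constant zero    n≡N α β γ e = ⊥-elim (ℕₚ.<⇒≢ (≤-trans (s≤s z≤n) w<N) n≡N)
        constant (suc n) n≡N α β γ e = trans (sym (const-zero (f 0 0 0))) (trans (coef≈ (ℙ.trans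
            (ℙ.sym collapse) e) 0) (coef-0 0))
          where
          null : ∀ {x} → x ≈ 0# → const x ℙ.≈ ℙ.0#
          null e = ℙ.trans (Hom.cong constHom e) (Hom.0-homo constHom)
          collapse : Evaluation.ev {K = commRing} {B = polyRing commRing} constHom (suc n) f α β γ ℙ.≈ const (f 0 0 0)
          collapse = ℙ.trans (horner-first n α (λ i → S₁.horner (suc n) β (λ j → inner i j))
              (λ i → S₁.horner-zero (suc n) β λ j → S₁.horner-zero (suc n) γ λ l → null (coefficient₁ i j l)))
            (ℙ.trans (horner-first n β (inner 0) (λ j → S₁.horner-zero (suc n) γ λ l → null (coefficient₂ 0 j l)))
                     (horner-first n γ (λ l → const (f 0 0 l)) (λ l → null (coefficient₃ 0 0 l))))
            where
            inner : ℕ → ℕ → Poly commRing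
            inner i j = S₁.horner (suc n) γ (λ l → const (f i j l))
        coefficient : ∀ i j l → f i j l ≈ 0#
        coefficient (suc i) j       l       = coefficient₁ i j l
        coefficient zero    (suc j) l       = coefficient₂ zero j l
        coefficient zero    zero    (suc l) = coefficient₃ zero zero l
        coefficient zero    zero    zero    = constant N ≡.refl _ _ _ (zeros row₀)

    vanishes-on-lines : ∀ v f → degree ≤ k ℕ.* v →
      (∀ b j i → j < v → i < v ℕ.+ v → coef (coef (onCone f (pt b)) j) i ≈ 0#) → ∀ a → onLine f (line a) ℙ.≈ ℙ.0#
    vanishes-on-lines v f big conds a = many-zeros {v} (map (px ∘ pt) (cols a)) (onLine f (line a))
        (AllPairsₚ.map⁺ (cols-distinct a))
      (Allₚ.map⁺ (All.map (λ {b} on → Ord-cong (ℙ.sym (ℙ.trans (translate-onLine f on) (ℙ.sym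
          (specialize-onCone f (pt b) (slope (line a))))))
          (specialize-Ord (slope (line a)) (onCone f (pt b)) (cone-Ord b))) (on-cols a)))
      (Deg-mono {p = onLine f (line a)} (≤-trans big (ℕₚ.*-monoˡ-≤ v (≤-trans (k≤cols a) (≤-reflexive (≡.sym
          (Listₚ.length-map _ (cols a)))))))
        (onLine-Deg f (line a)))
      where
      cone-Ord : ∀ b → P₂.Ord v (onCone f (pt b))
      cone-Ord b j j<v = mk≈ go
        where
        go : ∀ i → coef (coef (onCone f (pt b)) j) i ≈ coef ℙ.0# i
        go i with i ℕ.<? v ℕ.+ v
        ... | yes lt = trans (conds b j i j<v lt) (sym (coef-0 i))
        ... | no ¬lt = trans (onCone-Deg f (pt b) j i (≤-trans (ℕₚ.+-mono-≤-< (<⇒≤ j<v) j<v) (≮⇒≥ ¬lt))) (sym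
            (coef-0 i))

  module _ {n : ℕ} (P : Fin n → Point) (idx : Col → Fin n) (pt≡ : ∀ b → pt b ≡ P (idx b)) (M v s : ℕ) where
    N : ℕ
    N = M ℕ.+ M ℕ.+ M
    open NullLines F N
    open LinearSystems F
    open Boxes F M
    private
      module P₂ = Polynomials (polyRing commRing)
      module ℙ₂ = CommutativeRing (polyRing (polyRing commRing))

      -- For j < v the coefficient of τʲ has degree at most 2j < 2v in s, so 2v² conditions describe
      -- a jet of order v on a cone. They are imposed at all n given points, including those removed
      -- by the pruning, so their number is known.
      condition : Fin n × (Fin v × Fin (v ℕ.+ v)) → Functional dimension
      condition (b , j , i) = record
        { fn = λ x → coef (coef (onCone (array x) (P b)) (Fin.toℕ j)) (Fin.toℕ i)
        ; cong = λ e → coef≈ (coef≈ (E₂.ev-congᵃ _ _ _ (array-cong e)) (Fin.toℕ j)) (Fin.toℕ i)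
        ; +-homo = λ x y → trans (coef≈ (coef≈ (ℙ₂.trans (E₂.ev-congᵃ _ _ _ (array-+ x y)) (E₂.ev-+ (array x)
            (array y) _ _ _)) (Fin.toℕ j)) (Fin.toℕ i))
            (trans (coef≈ (P₂.coef-+ _ _ (Fin.toℕ j)) (Fin.toℕ i)) (coef-+ _ _ (Fin.toℕ i)))
        ; *-homo = λ a x → trans (coef≈ (coef≈ (ℙ₂.trans (E₂.ev-congᵃ _ _ _ (array-* a x)) (E₂.ev-* a
            (array x) _ _ _)) (Fin.toℕ j)) (Fin.toℕ i))
            (trans (coef≈ (P₂.const-* (const a) _ (Fin.toℕ j)) (Fin.toℕ i)) (const-* a _ (Fin.toℕ i))) }

      indices : List (Fin n × (Fin v × Fin (v ℕ.+ v)))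
      indices = cartesianProduct (allFin n) (cartesianProduct (allFin v) (allFin (v ℕ.+ v)))

      length-allFin : ∀ m → length (allFin m) ≡ m
      length-allFin m = Listₚ.length-tabulate (λ i → i)

      indices-length : length indices ≡ n ℕ.* (v ℕ.* (v ℕ.+ v))
      indices-length = ≡.trans (length-cartesianProduct (allFin n) _) (≡.cong₂ ℕ._*_ (length-allFin n)
        (≡.trans (length-cartesianProduct (allFin v) _) (≡.cong₂ ℕ._*_ (length-allFin v) (length-allFin (v ℕ.+ v)))))

    -- There are more coefficients than conditions, so a nonzero f vanishes to order v on the cone of every point,
    -- hence on every line; but then all its derivatives do.
    contradiction : ¬ 1# + 1# ≈ 0# → CharExceeds (suc degree) →
      suc degree ℕ.+ suc degree ≤ k ℕ.* s → suc degree ≤ ℕ.pred k ℕ.* suc s → (∀ j → j < suc (suc s) → suc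
          (j ℕ.+ j) ≤ r) →
      degree ≤ k ℕ.* v → n ℕ.* (v ℕ.* (v ℕ.+ v)) < dimension → ⊥
    contradiction two≉0 char big₁ big₂ rich big few =
      nontrivial-solution dimension (map condition indices)
        (≡.subst (ℕ._< dimension) (≡.sym (≡.trans (Listₚ.length-map condition indices) indices-length)) few) λ
        { (x , x≉0 , conds) → x≉0 (array-injective x
            (vanishing N two≉0 char s big₁ big₂ rich N (array x) ≤-refl (array-supported x)
              (vanishes-on-lines N v (array x) big λ b j i j<v i<2v →
                ≡.subst (λ p → coef (coef (onCone (array x) p) j) i ≈ 0#) (≡.sym (pt≡ b))
                (≡.subst₂ (λ j i → coef (coef (onCone (array x) (P (idx b))) j) i ≈ 0#) (Finₚ.toℕ-fromℕ< j<v)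
                    (Finₚ.toℕ-fromℕ< i<2v)
                  (All.lookup (Allₚ.map⁻ conds) (∈ₚ.∈-cartesianProduct⁺ (∈ₚ.∈-allFin (idx b))
                    (∈ₚ.∈-cartesianProduct⁺ (∈ₚ.∈-allFin (Fin.fromℕ< j<v)) (∈ₚ.∈-allFin (Fin.fromℕ< i<2v))))))))) }

-- Counting incidences

module Counting where
  open import Algebra.Properties.CommutativeMonoid.Sum ℕₚ.+-0-commutativeMonoid public
    using (sum; sum-cong-≗; ∑-comm; ∑-distrib-+)
  open import Algebra.Properties.Semiring.Sum ℕₚ.+-*-semiring public using (*-distribˡ-sum; *-distribʳ-sum)
  open ℕₚ.≤-Reasoning

  private
    variable
      m n : ℕ

  ind : ∀ {p} {P : Set p} → Dec P → ℕ
  ind (yes _) = 1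
  ind (no _)  = 0

  ind-mono : ∀ {p q} {P : Set p} {Q : Set q} (P? : Dec P) (Q? : Dec Q) → (P → Q) → ind P? ≤ ind Q?
  ind-mono (yes p) (yes q) f = ≤-refl
  ind-mono (yes p) (no ¬q) f = ⊥-elim (¬q (f p))
  ind-mono (no _)  Q?      f = z≤n

  ind-true : ∀ {p} {P : Set p} (P? : Dec P) → P → ind P? ≡ 1
  ind-true (yes _) p = ≡.refl
  ind-true (no ¬p) p = ⊥-elim (¬p p)

  ind-× : ∀ {p q} {P : Set p} {Q : Set q} (P? : Dec P) (Q? : Dec Q) → ind (P? ×-dec Q?) ≡ ind P? ℕ.* ind Q?
  ind-× (yes _) (yes _) = ≡.refl
  ind-× (yes _) (no _)  = ≡.refl
  ind-× (no _)  _       = ≡.refl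

  ind-disjoint : ∀ {p q r} {P : Set p} {Q : Set q} {R : Set r} (P? : Dec P) (Q? : Dec Q) (R? : Dec R) →
                 (P → ¬ Q) → (P → R) → (Q → R) → ind P? ℕ.+ ind Q? ≤ ind R?
  ind-disjoint (yes p) (yes q) R? ¬pq f g = ⊥-elim (¬pq p q)
  ind-disjoint (yes p) (no _)  R? ¬pq f g = ≤-reflexive (≡.sym (ind-true R? (f p)))
  ind-disjoint (no _)  (yes q) R? ¬pq f g = ≤-reflexive (≡.sym (ind-true R? (g q)))
  ind-disjoint (no _)  (no _)  R? ¬pq f g = z≤n

  count : ∀ {p} {P : Fin n → Set p} → (∀ i → Dec (P i)) → ℕ
  count P? = sum (λ i → ind (P? i))

  sum-mono : (f g : Fin n → ℕ) → (∀ i → f i ≤ g i) → sum f ≤ sum g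
  sum-mono {zero}  f g le = z≤n
  sum-mono {suc n} f g le = ℕₚ.+-mono-≤ (le zero) (sum-mono (f ∘ suc) (g ∘ suc) (le ∘ suc))

  sum-const : ∀ n c → sum {n} (λ _ → c) ≡ n ℕ.* c
  sum-const zero    c = ≡.refl
  sum-const (suc n) c = ≡.cong (c ℕ.+_) (sum-const n c)

  count-mono : ∀ {p q} {P : Fin n → Set p} {Q : Fin n → Set q} (P? : ∀ i → Dec (P i)) (Q? : ∀ i → Dec (Q i)) →
               (∀ i → P i → Q i) → count P? ≤ count Q?
  count-mono P? Q? f = sum-mono (λ i → ind (P? i)) (λ i → ind (Q? i)) (λ i → ind-mono (P? i) (Q? i) (f i))

  count-⊎ : ∀ {p q r} {P : Fin n → Set p} {Q : Fin n → Set q} {R : Fin n → Set r}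
            (P? : ∀ i → Dec (P i)) (Q? : ∀ i → Dec (Q i)) (R? : ∀ i → Dec (R i)) →
            (∀ i → P i → Q i ⊎ R i) → count P? ≤ count Q? ℕ.+ count R?
  count-⊎ P? Q? R? f = ≤-trans (sum-mono _ (λ i → ind (Q? i) ℕ.+ ind (R? i)) go) (≤-reflexive (∑-distrib-+
      (λ i → ind (Q? i)) (λ i → ind (R? i))))
    where
    go : ∀ i → ind (P? i) ≤ ind (Q? i) ℕ.+ ind (R? i)
    go i with P? i
    ... | no _ = z≤n
    ... | yes p with f i p
    ...   | inj₁ q = ≤-trans (≤-reflexive (≡.sym (ind-true (Q? i) q))) (m≤m+n _ _)
    ...   | inj₂ r = ≤-trans (≤-reflexive (≡.sym (ind-true (R? i) r))) (m≤n+m _ _)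

  elements : ∀ {p} {P : Fin n → Set p} (P? : ∀ i → Dec (P i)) →
             Σ (List (Σ (Fin n) P)) λ xs → AllPairs (λ x y → proj₁ x ≢ proj₁ y) xs × length xs ≡ count P?
  elements {zero}  P? = [] , [] , ≡.refl
  elements {suc n} {P = P} P? with P? zero | elements (P? ∘ suc)
  ... | yes p | xs , distinct , len = (zero , p) ∷ map shift xs
              , Allₚ.map⁺ (All.universal (λ _ ()) xs) ∷ AllPairsₚ.map⁺ (AllPairs.map (λ ne eq → ne
                  (Finₚ.suc-injective eq)) distinct)
              , ≡.cong suc (≡.trans (Listₚ.length-map shift xs) len)
    where
    shift : Σ (Fin n) (P ∘ suc) → Σ (Fin (suc n)) P
    shift (i , p) = suc i , p
  ... | no _ | xs , distinct , len = map shift xs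
              , AllPairsₚ.map⁺ (AllPairs.map (λ ne eq → ne (Finₚ.suc-injective eq)) distinct)
              , ≡.trans (Listₚ.length-map shift xs) len
    where
    shift : Σ (Fin n) (P ∘ suc) → Σ (Fin (suc n)) P
    shift (i , p) = suc i , p

  count-≤1 : ∀ {p} {P : Fin n → Set p} (P? : ∀ i → Dec (P i)) → (∀ i j → P i → P j → i ≡ j) → count P? ≤ 1
  count-≤1 P? unique with elements P?
  ... | []                         , _               , len = ≤-trans (≤-reflexive (≡.sym len)) z≤n
  ... | _ ∷ []                     , _               , len = ≤-reflexive (≡.sym len)
  ... | (i , pi) ∷ (j , pj) ∷ _    , (i≢j ∷ _) ∷ _   , _   = ⊥-elim (i≢j (unique i j pi pj))

  count-≤2 : ∀ {p} {P : Fin n → Set p} (P? : ∀ i → Dec (P i)) →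
             (∀ i j k → P i → P j → P k → i ≢ j → i ≢ k → j ≢ k → ⊥) → count P? ≤ 2
  count-≤2 P? no-three with elements P?
  ... | []                                , _ , len = ≤-trans (≤-reflexive (≡.sym len)) z≤n
  ... | _ ∷ []                            , _ , len = ≤-trans (≤-reflexive (≡.sym len)) (s≤s z≤n)
  ... | _ ∷ _ ∷ []                        , _ , len = ≤-reflexive (≡.sym len)
  ... | (i , pi) ∷ (j , pj) ∷ (k , pk) ∷ _ , (i≢j ∷ i≢k ∷ _) ∷ (j≢k ∷ _) ∷ _ , _ = ⊥-elim
      (no-three i j k pi pj pk i≢j i≢k j≢k)

  count-∃ : ∀ {p} {P : Fin n → Set p} (P? : ∀ i → Dec (P i)) → 0 < count P? → ∃ P
  count-∃ P? pos with elements P?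
  ... | []    , _ , len = ⊥-elim (ℕₚ.<⇒≢ pos len)
  ... | x ∷ _ , _       = x

  sum-pos : (f : Fin n → ℕ) → 0 < sum f → ∃ λ i → 0 < f i
  sum-pos {suc n} f pos with f zero in eq
  ... | suc _ = zero , ≡.subst (0 ℕ.<_) (≡.sym eq) (s≤s z≤n)
  ... | zero with sum-pos (f ∘ suc) pos
  ...   | i , p = suc i , p

  count-drop : ∀ {p} {P : Fin n → Set p} (P? : ∀ i → Dec (P i)) j →
               count P? ≤ suc (count (λ i → P? i ×-dec ¬? (i Fin.≟ j)))
  count-drop P? j = ≤-trans (count-⊎ P? (λ i → i Fin.≟ j) (λ i → P? i ×-dec ¬? (i Fin.≟ j)) split)
    (ℕₚ.+-monoˡ-≤ _ (count-≤1 (λ i → i Fin.≟ j) (λ i i′ e e′ → ≡.trans e (≡.sym e′))))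
    where
    split : ∀ i → _ → i ≡ j ⊎ (_ × i ≢ j)
    split i p with i Fin.≟ j
    ... | yes e = inj₁ e
    ... | no ne = inj₂ (p , ne)

  count-remove : ∀ {p} {P : Fin n → Set p} (P? : ∀ i → Dec (P i)) j → P j →
                 suc (count (λ i → P? i ×-dec ¬? (i Fin.≟ j))) ≡ count P?
  count-remove {suc n} P? zero p = ≡.cong₂ ℕ._+_ (≡.trans (≡.cong suc zero-gone) (≡.sym (ind-true (P? zero) p)))
    (sum-cong-≗ (λ i → rest (P? (suc i)) (suc i Fin.≟ zero) (λ ())))
    where
    zero-gone : ind (P? zero ×-dec ¬? (zero {n} Fin.≟ zero)) ≡ 0
    zero-gone with P? zero
    ... | yes _ = ≡.refl
    ... | no _  = ≡.refl
    rest : ∀ {a b} {A : Set a} {B : Set b} (A? : Dec A) (B? : Dec B) → ¬ B → ind (A? ×-dec ¬? B?) ≡ ind A?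
    rest (yes _) (yes b) ¬b = ⊥-elim (¬b b)
    rest (yes _) (no _)  ¬b = ≡.refl
    rest (no _)  _       ¬b = ≡.refl
  count-remove {suc n} {P = P} P? (suc j) p = ≡.trans (≡.sym (ℕₚ.+-suc _ _)) (≡.cong₂ ℕ._+_ head (≡.trans
      (≡.cong suc (sum-cong-≗ same)) (count-remove (P? ∘ suc) j p)))
    where
    head : ind (P? zero ×-dec ¬? (zero Fin.≟ suc j)) ≡ ind (P? zero)
    head with P? zero
    ... | yes _ = ≡.refl
    ... | no _  = ≡.refl
    same : ∀ i → ind (P? (suc i) ×-dec ¬? (suc i Fin.≟ suc j)) ≡ ind (P? (suc i) ×-dec ¬? (i Fin.≟ j))
    same i = ℕₚ.≤-antisym (ind-mono (P? (suc i) ×-dec ¬? (suc i Fin.≟ suc j)) (P? (suc i) ×-dec ¬? (i Fin.≟ j))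
        (λ { (x , ne) → x , λ e → ne (≡.cong suc e) }))
                          (ind-mono (P? (suc i) ×-dec ¬? (i Fin.≟ j)) (P? (suc i) ×-dec ¬? (suc i Fin.≟ suc j))
                              (λ { (x , ne) → x , λ e → ne (Finₚ.suc-injective e) }))

-- Passing to a subgraph of large minimum degrees

module Pruning where
  open Counting
  open ℕₚ.≤-Reasoning

  edges : ∀ {m n} {A : Fin m → Set} {B : Fin n → Set} {G : Fin m → Fin n → Set}
          (A? : ∀ a → Dec (A a)) (B? : ∀ b → Dec (B b)) (G? : ∀ a b → Dec (G a b)) → ℕ
  edges A? B? G? = sum λ a → ind (A? a) ℕ.* count (λ b → B? b ×-dec G? a b)

  module _ {m n : ℕ} {A : Fin m → Set} {B : Fin n → Set} {G : Fin m → Fin n → Set}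
           (A? : ∀ a → Dec (A a)) (B? : ∀ b → Dec (B b)) (G? : ∀ a b → Dec (G a b)) where

    edges-swap : edges A? B? G? ≡ edges B? A? (λ b a → G? a b)
    edges-swap = ≡.trans (sum-cong-≗ row) (≡.trans (∑-comm term) (sum-cong-≗ col))
      where
      term : Fin m → Fin n → ℕ
      term a b = ind (A? a) ℕ.* (ind (B? b) ℕ.* ind (G? a b))
      row : ∀ a → ind (A? a) ℕ.* count (λ b → B? b ×-dec G? a b) ≡ sum (term a)
      row a = ≡.trans (*-distribˡ-sum (ind (A? a)) (λ b → ind (B? b ×-dec G? a b))) (sum-cong-≗ λ b → ≡.cong
          (ind (A? a) ℕ.*_) (ind-× (B? b) (G? a b)))
      col : ∀ b → sum (λ a → term a b) ≡ ind (B? b) ℕ.* count (λ a → A? a ×-dec G? a b)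
      col b = ≡.sym (≡.trans (*-distribˡ-sum (ind (B? b)) (λ a → ind (A? a ×-dec G? a b)))
          (sum-cong-≗ λ a → ≡.trans (≡.cong (ind (B? b) ℕ.*_) (ind-× (A? a) (G? a b))) (shuffle (ind (B? b))
          (ind (A? a)) (ind (G? a b)))))
        where
        shuffle : ∀ x y z → x ℕ.* (y ℕ.* z) ≡ y ℕ.* (x ℕ.* z)
        shuffle x y z = ≡.trans (≡.sym (ℕₚ.*-assoc x y z)) (≡.trans (≡.cong (ℕ._* z) (ℕₚ.*-comm x y))
            (ℕₚ.*-assoc y x z))

    edges-remove : ∀ a₀ → edges A? B? G? ≤ edges (λ a → A? a ×-dec ¬? (a Fin.≟ a₀)) B? G? ℕ.+ count
        (λ b → B? b ×-dec G? a₀ b)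
    edges-remove a₀ = begin
      sum (λ a → ind (A? a) ℕ.* deg a)
        ≤⟨ sum-mono _ _ (λ a → step a) ⟩
      sum (λ a → ind (A′? a) ℕ.* deg a ℕ.+ ind (a Fin.≟ a₀) ℕ.* deg a₀)
        ≡⟨ ∑-distrib-+ (λ a → ind (A′? a) ℕ.* deg a) (λ a → ind (a Fin.≟ a₀) ℕ.* deg a₀) ⟩
      sum (λ a → ind (A′? a) ℕ.* deg a) ℕ.+ sum (λ a → ind (a Fin.≟ a₀) ℕ.* deg a₀)
        ≡⟨ ≡.cong (sum (λ a → ind (A′? a) ℕ.* deg a) ℕ.+_) (*-distribʳ-sum (deg a₀) (λ a → ind (a Fin.≟ a₀))) ⟨
      sum (λ a → ind (A′? a) ℕ.* deg a) ℕ.+ count (λ a → a Fin.≟ a₀) ℕ.* deg a₀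
        ≤⟨ ℕₚ.+-monoʳ-≤ _ (ℕₚ.*-monoˡ-≤ (deg a₀) (count-≤1 (λ a → a Fin.≟ a₀) (λ i j e e′ → ≡.trans e (≡.sym e′)))) ⟩
      sum (λ a → ind (A′? a) ℕ.* deg a) ℕ.+ 1 ℕ.* deg a₀
        ≡⟨ ≡.cong (sum (λ a → ind (A′? a) ℕ.* deg a) ℕ.+_) (ℕₚ.*-identityˡ (deg a₀)) ⟩
      sum (λ a → ind (A′? a) ℕ.* deg a) ℕ.+ deg a₀ ∎
      where
      deg : Fin m → ℕ
      deg a = count (λ b → B? b ×-dec G? a b)
      A′? : ∀ a → Dec (A a × a ≢ a₀)
      A′? a = A? a ×-dec ¬? (a Fin.≟ a₀)
      step : ∀ a → ind (A? a) ℕ.* deg a ≤ ind (A′? a) ℕ.* deg a ℕ.+ ind (a Fin.≟ a₀) ℕ.* deg a₀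
      step a with A? a | a Fin.≟ a₀
      ... | no _  | _          = z≤n
      ... | yes _ | no _       = m≤m+n _ _
      ... | yes _ | yes ≡.refl = ≤-refl

  record Pruned {m n} (G : Fin m → Fin n → Set) (k r : ℕ) : Set₁ where
    field
      {A}    : Fin m → Set
      {B}    : Fin n → Set
      A?     : ∀ a → Dec (A a)
      B?     : ∀ b → Dec (B b)
      G?     : ∀ a b → Dec (G a b)
      rows   : ∀ a → A a → k ≤ count (λ b → B? b ×-dec G? a b)
      cols   : ∀ b → B b → r ≤ count (λ a → A? a ×-dec G? a b)
      row₀   : ∃ A

  private
    -- Deleting one of x vertices, of degree d ≤ k, takes k from the left side and at most k from
    -- the number of edges.
    exchange : ∀ {e e′ k d x x′ y} → k ℕ.* x ℕ.+ y < e → suc x′ ≡ x → e ≤ e′ ℕ.+ d → d ≤ k → k ℕ.* x′ ℕ.+ y < e′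
    exchange {e} {e′} {k} {d} {x} {x′} {y} lt ≡.refl le d≤k = ℕₚ.+-cancelʳ-< k _ _ (begin-strict
      k ℕ.* x′ ℕ.+ y ℕ.+ k      ≡⟨ ℕₚ.+-comm _ k ⟩
      k ℕ.+ (k ℕ.* x′ ℕ.+ y)    ≡⟨ ℕₚ.+-assoc k _ y ⟨
      k ℕ.+ k ℕ.* x′ ℕ.+ y      ≡⟨ ≡.cong (ℕ._+ y) (ℕₚ.*-suc k x′) ⟨
      k ℕ.* suc x′ ℕ.+ y        <⟨ lt ⟩
      e                         ≤⟨ le ⟩
      e′ ℕ.+ d                  ≤⟨ ℕₚ.+-monoʳ-≤ e′ d≤k ⟩
      e′ ℕ.+ k                  ∎)

  -- Deleting a row of degree less than k, or a column of degree less than r, preserves the density hypothesis.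
  prune : ∀ {m n} {G : Fin m → Fin n → Set} (G? : ∀ a b → Dec (G a b)) k r fuel
          {A : Fin m → Set} {B : Fin n → Set} (A? : ∀ a → Dec (A a)) (B? : ∀ b → Dec (B b)) →
          count A? ℕ.+ count B? ≤ fuel → k ℕ.* count A? ℕ.+ r ℕ.* count B? < edges A? B? G? → Pruned G k r
  prune {m} {n} {G} G? k r fuel {A} {B} A? B? size dense
    with Finₚ.any? (λ a → A? a ×-dec (count (λ b → B? b ×-dec G? a b) ℕ.<? k))
       | Finₚ.any? (λ b → B? b ×-dec (count (λ a → A? a ×-dec G? a b) ℕ.<? r))
  ... | no noA | no noB = record
    { A? = A? ; B? = B? ; G? = G?
    ; rows = λ a Aa → ≮⇒≥ λ lt → noA (a , Aa , lt)
    ; cols = λ b Bb → ≮⇒≥ λ lt → noB (b , Bb , lt)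
    ; row₀ = let a , pos = sum-pos (λ a → ind (A? a) ℕ.* count (λ b → B? b ×-dec G? a b)) (≤-trans (s≤s z≤n) dense) in a , active a pos }
    where
    active : ∀ a → 0 < ind (A? a) ℕ.* count (λ b → B? b ×-dec G? a b) → A a
    active a pos with A? a
    ... | yes p = p
    ... | no _  = ⊥-elim (ℕₚ.<-irrefl ≡.refl pos)
  -- `fuel` bounds the number of remaining rows and columns, and a₀ is one of them.
  prune {m} {n} {G} G? k r zero {A} {B} A? B? size dense | yes (a₀ , Aa , lt) | _ =
    ⊥-elim (ℕₚ.<⇒≱ (≤-trans (≡.subst (0 ℕ.<_) (count-remove A? a₀ Aa) (s≤s z≤n)) (m≤m+n _ _)) size)
  prune {m} {n} {G} G? k r (suc fuel) {A} {B} A? B? size dense | yes (a₀ , Aa , lt) | _ =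
    prune G? k r fuel (λ a → A? a ×-dec ¬? (a Fin.≟ a₀)) B?
      (≤-pred (≤-trans (≤-reflexive (≡.cong (ℕ._+ count B?) (count-remove A? a₀ Aa))) size))
      (exchange {k = k} {y = r ℕ.* count B?} dense (count-remove A? a₀ Aa) (edges-remove A? B? G? a₀) (<⇒≤ lt))
  prune {m} {n} {G} G? k r zero {A} {B} A? B? size dense | no _ | yes (b₀ , Bb , lt) =
    ⊥-elim (ℕₚ.<⇒≱ (≤-trans (≡.subst (0 ℕ.<_) (count-remove B? b₀ Bb) (s≤s z≤n)) (m≤n+m _ (count A?))) size)
  prune {m} {n} {G} G? k r (suc fuel) {A} {B} A? B? size dense | no _ | yes (b₀ , Bb , lt) =
    prune G? k r fuel A? (λ b → B? b ×-dec ¬? (b Fin.≟ b₀))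
      (≤-pred (≤-trans (≤-reflexive (≡.trans (≡.sym (ℕₚ.+-suc (count A?) _)) (≡.cong (count A? ℕ.+_)
          (count-remove B? b₀ Bb)))) size))
      (≡.subst₂ ℕ._<_ (ℕₚ.+-comm (r ℕ.* _) (k ℕ.* count A?)) (≡.sym (edges-swap A? (λ b → B? b ×-dec ¬?
          (b Fin.≟ b₀)) G?))
        (exchange {k = r} {y = k ℕ.* count A?} (≡.subst₂ ℕ._<_ (ℕₚ.+-comm (k ℕ.* count A?) _)
            (edges-swap A? B? G?) dense)
          (count-remove B? b₀ Bb) (edges-remove B? A? (λ b a → G? a b) b₀) (<⇒≤ lt)))

open Counting using (count)

-- Double counting of common neighbours

module CommonNeighbours {m n : ℕ} {M : Fin m → Fin n → Set} (M? : ∀ a b → Dec (M a b)) (k r : ℕ)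
  (rows : ∀ a b → M a b → k ≤ count (λ b → M? a b))
  (cols : ∀ a b → M a b → r ≤ count (λ a → M? a b))
  (two-points : ∀ {a a′ b b′} → M a b → M a b′ → M a′ b → M a′ b′ → b ≢ b′ → a ≡ a′)
  where
  open Counting
  open ℕₚ.≤-Reasoning

  Near : Fin n → Fin n → Set
  Near o x = ∃ λ a → M a o × (M a x × x ≢ o)

  -- Lines through o are excluded: if x, y and z lay on one such line, every further point of it
  -- would be a common neighbour of all three.
  Link : Fin n → Fin n → Fin n → Set
  Link o x p = ∃ λ a → (M a x × ¬ M a o) × (M a p × p ≢ x)

  near? : ∀ o x → Dec (Near o x)
  near? o x = Finₚ.any? λ a → M? a o ×-dec (M? a x ×-dec ¬? (x Fin.≟ o))

  link? : ∀ o x p → Dec (Link o x p)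
  link? o x p = Finₚ.any? λ a → (M? a x ×-dec ¬? (M? a o)) ×-dec (M? a p ×-dec ¬? (p Fin.≟ x))

  -- By `two-points`, two lines through x have no second common point, so the points other than x on
  -- these lines are each counted once.
  star : {A : Fin m → Set} (A? : ∀ a → Dec (A a)) (x : Fin n) → (∀ a → A a → M a x) →
         count A? ℕ.* ℕ.pred k ≤ count (λ p → Finₚ.any? (λ a → A? a ×-dec (M? a p ×-dec ¬? (p Fin.≟ x))))
  star {A} A? x A⇒M = begin
    count A? ℕ.* ℕ.pred k
      ≡⟨ *-distribʳ-sum (ℕ.pred k) (λ a → ind (A? a)) ⟩
    sum (λ a → ind (A? a) ℕ.* ℕ.pred k)
      ≤⟨ sum-mono _ _ long ⟩
    sum (λ a → ind (A? a) ℕ.* count (λ p → other? a p))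
      ≡⟨ sum-cong-≗ (λ a → ≡.trans (*-distribˡ-sum (ind (A? a)) (λ p → ind (other? a p)))
          (sum-cong-≗ λ p → ≡.sym (ind-× (A? a) (other? a p)))) ⟩
    sum (λ a → sum (λ p → ind (A? a ×-dec other? a p)))
      ≡⟨ ∑-comm (λ a p → ind (A? a ×-dec other? a p)) ⟩
    sum (λ p → count (λ a → A? a ×-dec other? a p))
      ≤⟨ sum-mono _ _ covered ⟩
    count (λ p → Finₚ.any? (λ a → A? a ×-dec other? a p)) ∎
    where
    other? : ∀ a p → Dec (M a p × p ≢ x)
    other? a p = M? a p ×-dec ¬? (p Fin.≟ x)
    long : ∀ a → ind (A? a) ℕ.* ℕ.pred k ≤ ind (A? a) ℕ.* count (λ p → other? a p)
    long a with A? a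
    ... | no _  = z≤n
    ... | yes p = ℕₚ.*-monoʳ-≤ 1 (pred-mono-≤ (≤-trans (rows a x (A⇒M a p)) (count-drop (M? a) x)))
    covered : ∀ p → count (λ a → A? a ×-dec other? a p) ≤ ind (Finₚ.any? (λ a → A? a ×-dec other? a p))
    covered p with Finₚ.any? (λ a → A? a ×-dec other? a p)
    ... | yes _ = count-≤1 (λ a → A? a ×-dec other? a p) λ { a a′ (Aa , Map , p≢x) (Aa′ , Ma′p , _) →
                    two-points Map (A⇒M a Aa) Ma′p (A⇒M a′ Aa′) p≢x }
    ... | no none = ≮⇒≥ λ pos → none (count-∃ (λ a → A? a ×-dec other? a p) pos)

  -- Counts the triples (x, p, p′) with x near o and p ≠ p′ linked to x: at least the left side, and at most two for each (p, p′).
  common-neighbours : ∀ {a₀} o → M a₀ o →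
    (∀ {x y z p p′} → Near o x → Near o y → Near o z → x ≢ y → x ≢ z → y ≢ z →
       Link o x p → Link o y p → Link o z p → Link o x p′ → Link o y p′ → Link o z p′ → p′ ≢ p → ⊥) →
    (r ℕ.* ℕ.pred k) ℕ.* ((ℕ.pred r ℕ.* ℕ.pred k) ℕ.* ℕ.pred (ℕ.pred r ℕ.* ℕ.pred k)) ≤ n ℕ.* (n ℕ.* 2)
  common-neighbours {a₀} o Mo few = begin
    (r ℕ.* ℕ.pred k) ℕ.* (δ ℕ.* ℕ.pred δ)
      ≤⟨ ℕₚ.*-monoˡ-≤ (δ ℕ.* ℕ.pred δ) many-near ⟩
    count (near? o) ℕ.* (δ ℕ.* ℕ.pred δ)
      ≡⟨ *-distribʳ-sum (δ ℕ.* ℕ.pred δ) (λ x → ind (near? o x)) ⟩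
    sum (λ x → ind (near? o x) ℕ.* (δ ℕ.* ℕ.pred δ))
      ≤⟨ sum-mono _ _ many-pairs ⟩
    sum (λ x → ind (near? o x) ℕ.* sum (λ p → ind (link? o x p) ℕ.* count (second? x p)))
      ≡⟨ sum-cong-≗ expand ⟩
    sum (λ x → sum (λ p → sum (λ p′ → ind (all? x p p′))))
      ≡⟨ ∑-comm (λ x p → sum (λ p′ → ind (all? x p p′))) ⟩
    sum (λ p → sum (λ x → sum (λ p′ → ind (all? x p p′))))
      ≡⟨ sum-cong-≗ (λ p → ∑-comm (λ x p′ → ind (all? x p p′))) ⟩
    sum (λ p → sum (λ p′ → count (λ x → all? x p p′)))
      ≤⟨ sum-mono _ _ (λ p → ≤-trans (sum-mono _ _ (λ p′ → at-most-two p p′)) (≤-reflexive (sum-const n 2))) ⟩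
    sum {n} (λ p → n ℕ.* 2)
      ≡⟨ sum-const n (n ℕ.* 2) ⟩
    n ℕ.* (n ℕ.* 2) ∎
    where
    δ : ℕ
    δ = ℕ.pred r ℕ.* ℕ.pred k
    second? : ∀ x p p′ → Dec (Link o x p′ × p′ ≢ p)
    second? x p p′ = link? o x p′ ×-dec ¬? (p′ Fin.≟ p)
    all? : ∀ x p p′ → Dec (Near o x × (Link o x p × (Link o x p′ × p′ ≢ p)))
    all? x p p′ = near? o x ×-dec (link? o x p ×-dec second? x p p′)
    many-near : r ℕ.* ℕ.pred k ≤ count (near? o)
    many-near = ≤-trans (ℕₚ.*-monoˡ-≤ (ℕ.pred k) (cols a₀ o Mo)) (star (λ a → M? a o) o (λ a p → p))
    many-links : ∀ x → Near o x → δ ≤ count (link? o x)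
    many-links x (a , Mao , Max , x≢o) = ≤-trans (ℕₚ.*-monoˡ-≤ (ℕ.pred k) through-x) (star
        (λ a → M? a x ×-dec ¬? (M? a o)) x (λ a → proj₁))
      where
      -- At most one line passes through both x and o, so one of the r lines is lost.
      through-x : ℕ.pred r ≤ count (λ a → M? a x ×-dec ¬? (M? a o))
      through-x = pred-mono-≤ (≤-trans (cols a x Max) (≤-trans
        (count-⊎ (λ a → M? a x) (λ a → M? a x ×-dec M? a o) (λ a → M? a x ×-dec ¬? (M? a o)) split)
        (ℕₚ.+-monoˡ-≤ _ (count-≤1 (λ a → M? a x ×-dec M? a o) λ { a a′ (Max , Mao)
            (Ma′x , Ma′o) → two-points Max Mao Ma′x Ma′o x≢o }))))
        where
        split : ∀ a → M a x → (M a x × M a o) ⊎ (M a x × ¬ M a o)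
        split a Max with M? a o
        ... | yes p = inj₁ (Max , p)
        ... | no ¬p = inj₂ (Max , ¬p)
    many-pairs : ∀ x → ind (near? o x) ℕ.* (δ ℕ.* ℕ.pred δ) ≤ ind (near? o x) ℕ.* sum (λ p → ind
        (link? o x p) ℕ.* count (second? x p))
    many-pairs x with near? o x
    ... | no _   = z≤n
    ... | yes nx = ℕₚ.*-monoʳ-≤ 1 (begin
      δ ℕ.* ℕ.pred δ
        ≤⟨ ℕₚ.*-monoˡ-≤ (ℕ.pred δ) (many-links x nx) ⟩
      count (link? o x) ℕ.* ℕ.pred δ
        ≡⟨ *-distribʳ-sum (ℕ.pred δ) (λ p → ind (link? o x p)) ⟩
      sum (λ p → ind (link? o x p) ℕ.* ℕ.pred δ)
        ≤⟨ sum-mono _ _ (λ p → ℕₚ.*-monoʳ-≤ (ind (link? o x p)) (pred-mono-≤ (≤-trans (many-links x nx)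
            (count-drop (link? o x) p)))) ⟩
      sum (λ p → ind (link? o x p) ℕ.* count (second? x p)) ∎)
    expand : ∀ x → ind (near? o x) ℕ.* sum (λ p → ind (link? o x p) ℕ.* count (second? x p)) ≡ sum (λ p → sum
        (λ p′ → ind (all? x p p′)))
    expand x = ≡.trans (*-distribˡ-sum (ind (near? o x)) (λ p → ind (link? o x p) ℕ.* count (second? x p)))
        (sum-cong-≗ λ p →
      ≡.trans (≡.cong (ind (near? o x) ℕ.*_) (*-distribˡ-sum (ind (link? o x p)) (λ p′ → ind (second? x p p′))))
        (≡.trans (*-distribˡ-sum (ind (near? o x)) (λ p′ → ind (link? o x p) ℕ.* ind (second? x p p′)))
            (sum-cong-≗ λ p′ →
          ≡.sym (≡.trans (ind-× (near? o x) (link? o x p ×-dec second? x p p′)) (≡.cong (ind (near? o x) ℕ.*_)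
              (ind-× (link? o x p) (second? x p p′)))))))
    at-most-two : ∀ p p′ → count (λ x → all? x p p′) ≤ 2
    at-most-two p p′ = count-≤2 (λ x → all? x p p′) λ
      { x y z (nx , lx , lx′ , ne) (ny , ly , ly′ , _) (nz , lz , lz′ , _) x≢y x≢z y≢z →
        few nx ny nz x≢y x≢z y≢z lx ly lz lx′ ly′ lz′ ne }

-- The quadratic form y² - xz and triples of null lines

module NullTriples {c ℓ} (F : Field c ℓ) (stable : Stable F)
  (two≉0 : ¬ Char2 F) where
  open Field F hiding (zero)
  open FieldPolynomials F using (cancelˡ; -‿≉0)
  open IntegerSolver commRing
  open NullGeometry F
  open import Relation.Binary.Reasoning.Setoid setoid

  square≈0 : ∀ {x} → x * x ≈ 0# → x ≈ 0#
  square≈0 e = stable λ x≉0 → x≉0 (cancelˡ x≉0 e)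

  diff≈0 : ∀ {x y} → x - y ≈ 0# → x ≈ y
  diff≈0 {x} {y} e = trans (solve 2 (λ x y → x := (x :- y) :+ y) refl x y) (trans (+-congʳ e) (+-identityˡ y))

  ≈-diff : ∀ {x y} → x ≈ y → x - y ≈ 0#
  ≈-diff {x} {y} e = trans (+-congʳ e) (-‿inverseʳ y)

  combine₂ : ∀ {x y} u v → x ≈ 0# → y ≈ 0# → u * x + v * y ≈ 0#
  combine₂ u v ex ey = trans (+-cong (trans (*-congˡ ex) (zeroʳ u)) (trans (*-congˡ ey) (zeroʳ v))) (+-identityʳ 0#)

  -- Up to sign, the polar form of β² - αγ at (α, β, γ) and the null vector (1, s, s²).
  quadratic : Carrier → Carrier → Carrier → Carrier → Carrier
  quadratic α β γ s = γ - (1# + 1#) * s * β + s * s * α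

  quadratic-zero : ∀ {α β γ s t u} → ¬ s ≈ t → ¬ s ≈ u → ¬ t ≈ u →
    quadratic α β γ s ≈ 0# → quadratic α β γ t ≈ 0# → quadratic α β γ u ≈ 0# → α ≈ 0# × β ≈ 0# × γ ≈ 0#
  quadratic-zero {α} {β} {γ} {s} {t} {u} s≉t s≉u t≉u es et eu = α≈0 , β≈0 , γ≈0
    where
    secant : ∀ {a b} → ¬ a ≈ b → quadratic α β γ a ≈ 0# → quadratic α β γ b ≈ 0# → (a + b) * α - (1# + 1#) * β ≈ 0#
    secant {a} {b} a≉b ea eb = cancelˡ (-‿≉0 a≉b) (trans
      (solve 5 (λ a b α β γ → (a :- b) :* ((a :+ b) :* α :- (:1 :+ :1) :* β)
          := :1 :* (γ :- (:1 :+ :1) :* a :* β :+ a :* a :* α) :+ (:- :1) :* (γ :-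
              (:1 :+ :1) :* b :* β :+ b :* b :* α)) refl a b α β γ)
      (combine₂ 1# (- 1#) ea eb))
    α≈0 : α ≈ 0#
    α≈0 = cancelˡ (-‿≉0 t≉u) (trans
      (solve 5 (λ s t u α β → (t :- u) :* α := :1 :* ((s :+ t) :* α :- (:1 :+ :1) :* β) :+ (:- :1) :*
          ((s :+ u) :* α :- (:1 :+ :1) :* β)) refl s t u α β)
      (combine₂ 1# (- 1#) (secant s≉t es et) (secant s≉u es eu)))
    β≈0 : β ≈ 0#
    β≈0 = cancelˡ two≉0 (trans (solve 4 (λ s t α β → (:1 :+ :1) :* β := (s :+ t) :* α :+ (:- :1) :*
        ((s :+ t) :* α :- (:1 :+ :1) :* β)) refl s t α β)
      (combine₂ (s + t) (- 1#) α≈0 (secant s≉t es et)))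
    γ≈0 : γ ≈ 0#
    γ≈0 = trans (solve 4 (λ s α β γ → γ := :1 :* (γ :- (:1 :+ :1) :* s :* β :+ s :* s :* α) :+ (:1 :*
        ((:1 :+ :1) :* s :* β) :+ (:- (s :* s)) :* α)) refl s α β γ)
      (trans (+-cong (trans (*-congˡ es) (zeroʳ 1#)) (combine₂ 1# (- (s * s)) (trans (*-congˡ β≈0)
          (zeroʳ _)) α≈0)) (+-identityʳ 0#))

  record Joined (s : Carrier) (p q : Point) : Set ℓ where
    constructor joined
    field
      dy : py q - py p ≈ s * (px q - px p)
      dz : pz q - pz p ≈ s * s * (px q - px p)

  join : ∀ {p q l} → On p l → On q l → Joined (slope l) p q
  join {p} {q} {l} (yp , zp) (yq , zq) = joined
    (trans (+-cong yq (-‿cong yp)) (solve 4 (λ c s a b → (c :+ s :* b) :- (c :+ s :* a) := s :* (b :- a)) refl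
        (y₀ l) (slope l) (px p) (px q)))
    (trans (+-cong zq (-‿cong zp)) (solve 4 (λ c s a b → (c :+ s :* b) :- (c :+ s :* a) := s :* (b :- a)) refl
        (z₀ l) (slope l * slope l) (px p) (px q)))

  SamePoint : Point → Point → Set ℓ
  SamePoint p q = px p ≈ px q × py p ≈ py q × pz p ≈ pz q

  joined-same : ∀ {s p q} → Joined s p q → px p ≈ px q → SamePoint p q
  joined-same {s} {p} {q} (joined dy dz) e = e , sym (diff≈0 (trans dy (zero-step s))) , sym (diff≈0 (trans dz
      (zero-step (s * s))))
    where
    zero-step : ∀ t → t * (px q - px p) ≈ 0#
    zero-step t = trans (*-congˡ (≈-diff (sym e))) (zeroʳ t)

  SameNullLine : NullLine → NullLine → Set ℓ
  SameNullLine l l′ = slope l ≈ slope l′ × y₀ l ≈ y₀ l′ × z₀ l ≈ z₀ l′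

  same-slope : ∀ {p l l′} → On p l → On p l′ → slope l ≈ slope l′ → SameNullLine l l′
  same-slope {p} {l} {l′} (y , z) (y′ , z′) e = e , intercept y y′ e , intercept z z′ (*-cong e e)
    where
    intercept : ∀ {v c c′ s s′} → v ≈ c + s * px p → v ≈ c′ + s′ * px p → s ≈ s′ → c ≈ c′
    intercept {v} {c} {c′} {s} {s′} e₁ e₂ es = begin
      c                                 ≈⟨ solve 3 (λ c s x → c := (c :+ s :* x) :- s :* x) refl c s (px p) ⟩
      (c + s * px p) - s * px p         ≈⟨ +-cong (trans (sym e₁) e₂) (-‿cong (*-congʳ es)) ⟩
      (c′ + s′ * px p) - s′ * px p      ≈⟨ solve 3 (λ c s x → c := (c :+ s :* x) :- s :* x) refl c′ s′ (px p) ⟨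
      c′                                ∎

  two-points-line : ∀ {p q l l′} → On p l → On q l → On p l′ → On q l′ → ¬ SamePoint p q → SameNullLine l l′
  two-points-line {p} {q} {l} {l′} pl ql pl′ ql′ p≉q = same-slope {p} {l} {l′} pl pl′ (diff≈0 (cancelˡ Δ≉0 (begin
    (px q - px p) * (slope l - slope l′)
      ≈⟨ solve 3 (λ d s t → d :* (s :- t) := s :* d :- t :* d) refl _ _ _ ⟩
    slope l * (px q - px p) - slope l′ * (px q - px p)
      ≈⟨ ≈-diff (trans (sym (Joined.dy (join {p} {q} {l} pl ql))) (Joined.dy (join {p} {q} {l′} pl′ ql′))) ⟩
    0# ∎)))
    where
    Δ≉0 : ¬ px q - px p ≈ 0#
    Δ≉0 e = p≉q (joined-same (join {p} {q} {l} pl ql) (sym (diff≈0 e)))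

  -- form vanishes on the points joined to o by a null line.
  module Relative (o : Point) where
    α β γ form : Point → Carrier
    α p = px p - px o
    β p = py p - py o
    γ p = pz p - pz o
    form p = β p * β p - α p * γ p

    w : Carrier → Point → Carrier
    w s p = quadratic (α p) (β p) (γ p) s

    -- The form vanishes on p - x. Here x - o is α x times the null vector (1, s, s²), so the
    -- expansion has no term quadratic in α x, and what remains is the form of p - o plus a polar
    -- term.
    secant-equation : ∀ {s t x p} → Joined s o x → Joined t x p → form p + α x * w s p ≈ 0#
    secant-equation {s} {t} {x} {p} (joined dy dz) (joined dy′ dz′) = begin
      form p + α x * w s p
        ≈⟨ solve 6 (λ s t a b g x → (b :* b :- a :* g) :+ x :* (g :- (:1 :+ :1) :* s :* b :+ s :* s :* a)
                := (b :- s :* x) :* (b :- s :* x) :- (a :- x) :* (g :- s :* s :* x)) refl s t (α p) (β p) (γ p)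
                    (α x) ⟩
      (β p - s * α x) * (β p - s * α x) - (α p - α x) * (γ p - s * s * α x)
        ≈⟨ +-cong (*-cong first first) (-‿cong (*-cong across second)) ⟩
      (t * d) * (t * d) - d * (t * t * d)
        ≈⟨ solve 2 (λ t d → (t :* d) :* (t :* d) :- d :* (t :* t :* d) := :0) refl t d ⟩
      0# ∎
      where
      d : Carrier
      d = px p - px x
      telescope : ∀ u v z → (u - z) - (v - z) ≈ u - v
      telescope = solve 3 (λ u v z → (u :- z) :- (v :- z) := u :- v) refl
      across : α p - α x ≈ d
      across = telescope (px p) (px x) (px o)
      first : β p - s * α x ≈ t * d
      first = trans (+-congˡ (-‿cong (sym dy))) (trans (telescope (py p) (py x) (py o)) dy′)
      second : γ p - s * s * α x ≈ t * t * d
      second = trans (+-congˡ (-‿cong (sym dz))) (trans (telescope (pz p) (pz x) (pz o)) dz′)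

    -- Null lines form no triangles. For two points x and y on one line through o the two secant
    -- equations give w = 0 and form = 0, and then (β - sα)² = form + α w = 0.
    triangle : ∀ {s x y p} → ¬ α x ≈ α y → form p + α x * w s p ≈ 0# → form p + α y * w s p ≈ 0# → Joined s o p
    triangle {s} {x} {y} {p} x≉y ex ey = joined (diff≈0 β-sα) (diff≈0 (trans
        (solve 4 (λ s a b g → g :- s :* s :* a := :1 :* (g :- (:1 :+ :1) :* s :* b :+ s :* s :* a) :+
            ((:1 :+ :1) :* s) :* (b :- s :* a)) refl s (α p) (β p) (γ p))
        (combine₂ 1# _ w≈0 β-sα)))
      where
      w≈0 : w s p ≈ 0#
      w≈0 = cancelˡ (-‿≉0 x≉y) (trans (solve 4 (λ x y f w → (x :- y) :* w := :1 :* (f :+ x :* w) :+ (:- :1) :*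
          (f :+ y :* w)) refl (α x) (α y) (form p) (w s p))
        (combine₂ 1# (- 1#) ex ey))
      form≈0 : form p ≈ 0#
      form≈0 = trans (solve 3 (λ f x w → f := :1 :* (f :+ x :* w) :+ (:- x) :* w) refl (form p) (α x) (w s p))
          (combine₂ 1# (- α x) ex w≈0)
      β-sα : β p - s * α p ≈ 0#
      β-sα = square≈0 (trans (solve 4 (λ s a b g → (b :- s :* a) :* (b :- s :* a) := :1 :*
          (b :* b :- a :* g) :+ a :* (g :- (:1 :+ :1) :* s :* b :+ s :* s :* a)) refl s (α p) (β p) (γ p))
        (combine₂ 1# (α p) form≈0 w≈0))

    -- With form p = 0 the equations make p - o orthogonal to three null vectors of different
    -- slopes, and these span the space.
    form≈0⇒same : ∀ {s t u x y z p} → ¬ s ≈ t → ¬ s ≈ u → ¬ t ≈ u → ¬ α x ≈ 0# → ¬ α y ≈ 0# → ¬ α z ≈ 0# →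
      form p + α x * w s p ≈ 0# → form p + α y * w t p ≈ 0# → form p + α z * w u p ≈ 0# → form p ≈ 0# → SamePoint p o
    form≈0⇒same {p = p} s≉t s≉u t≉u x≉0 y≉0 z≉0 ex ey ez f≈0 =
      let a , b , g = quadratic-zero s≉t s≉u t≉u (root x≉0 ex) (root y≉0 ey) (root z≉0 ez) in diff≈0 a , diff≈0 b , diff≈0 g
      where
      root : ∀ {a w} → ¬ a ≈ 0# → form p + a * w ≈ 0# → w ≈ 0#
      root {a} {w} a≉0 e = cancelˡ a≉0 (trans (solve 3 (λ f a w → a :* w := :1 :* (f :+ a :* w) :+
          (:- :1) :* f) refl (form p) a w) (combine₂ 1# (- 1#) e f≈0))

    -- Divided by form p, the equations become linear in (p - o) / form p, the inversion of p in the
    -- cone of o, and three slopes determine it. Cleared of denominators: g (p - o) - f (q - o) is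
    -- orthogonal to three null vectors, hence zero.
    unique : ∀ {s t u x y z p q} → ¬ s ≈ t → ¬ s ≈ u → ¬ t ≈ u → ¬ α x ≈ 0# → ¬ α y ≈ 0# → ¬ α z ≈ 0# →
      form p + α x * w s p ≈ 0# → form p + α y * w t p ≈ 0# → form p + α z * w u p ≈ 0# →
      form q + α x * w s q ≈ 0# → form q + α y * w t q ≈ 0# → form q + α z * w u q ≈ 0# →
      ¬ form p ≈ 0# → ¬ form q ≈ 0# → SamePoint p q
    unique {s} {t} {u} {x} {y} {z} {p} {q} s≉t s≉u t≉u x≉0 y≉0 z≉0 px′ py′ pz′ qx qy qz fp≉0 fq≉0 =
      same (proj₁ zeros) , same (proj₁ (proj₂ zeros)) , same (proj₂ (proj₂ zeros))
      where
      f g : Carrier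
      f = form p
      g = form q
      root : ∀ {a s} → ¬ a ≈ 0# → f + a * w s p ≈ 0# → g + a * w s q ≈ 0# →
             quadratic (g * α p - f * α q) (g * β p - f * β q) (g * γ p - f * γ q) s ≈ 0#
      root {a} {s} a≉0 ep eq = cancelˡ a≉0 (trans
        (solve 10 (λ a s f g α₁ β₁ γ₁ α₂ β₂ γ₂ →
            a :* ((g :* γ₁ :- f :* γ₂) :- (:1 :+ :1) :* s :* (g :* β₁ :- f :* β₂) :+ s :* s :* (g :* α₁ :- f :* α₂))
            := g :* (f :+ a :* (γ₁ :- (:1 :+ :1) :* s :* β₁ :+ s :* s :* α₁)) :+ (:- f) :* (g :+ a :* (γ₂ :-
                (:1 :+ :1) :* s :* β₂ :+ s :* s :* α₂)))
          refl a s f g (α p) (β p) (γ p) (α q) (β q) (γ q))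
        (combine₂ g (- f) ep eq))
      zeros : g * α p - f * α q ≈ 0# × g * β p - f * β q ≈ 0# × g * γ p - f * γ q ≈ 0#
      zeros = quadratic-zero s≉t s≉u t≉u (root x≉0 px′ qx) (root y≉0 py′ qy) (root z≉0 pz′ qz)
      -- form is homogeneous of degree two, so g p ≈ f q forces g² f ≈ f² g.
      g≈f : g ≈ f
      g≈f = diff≈0 (cancelˡ fp≉0 (cancelˡ fq≉0 (begin
        g * (f * (g - f))
          ≈⟨ solve 2 (λ f g → g :* (f :* (g :- f)) := g :* g :* f :- f :* f :* g) refl f g ⟩
        g * g * f - f * f * g
          ≈⟨ solve 8 (λ f g α₁ β₁ γ₁ α₂ β₂ γ₂ →
                g :* g :* (β₁ :* β₁ :- α₁ :* γ₁) :- f :* f :* (β₂ :* β₂ :- α₂ :* γ₂)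
                := (g :* β₁ :+ f :* β₂) :* (g :* β₁ :- f :* β₂)
                   :+ ((:- (g :* γ₁)) :* (g :* α₁ :- f :* α₂) :+ (:- (f :* α₂)) :*
                       (g :* γ₁ :- f :* γ₂))) refl f g (α p) (β p) (γ p) (α q) (β q) (γ q) ⟩
        (g * β p + f * β q) * (g * β p - f * β q) + (- (g * γ p) * (g * α p - f * α q) + - (f * α q) *
            (g * γ p - f * γ q))
          ≈⟨ +-cong (trans (*-congˡ (proj₁ (proj₂ zeros))) (zeroʳ _)) (combine₂ _ _ (proj₁ zeros) (proj₂
              (proj₂ zeros))) ⟩
        0# + 0#
          ≈⟨ +-identityʳ 0# ⟩
        0# ∎)))
      same : ∀ {a b c} → g * (a - c) - f * (b - c) ≈ 0# → a ≈ b
      same {a} {b} {c} e = diff≈0 (cancelˡ fq≉0 (trans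
        (solve 5 (λ f g a b c → g :* (a :- b) := :1 :* (g :* (a :- c) :- f :* (b :- c)) :+ (b :- c) :*
            (f :- g)) refl f g a b c)
        (combine₂ 1# (b - c) e (≈-diff (sym g≈f)))))

module NullIncidences {c ℓ} (F : Field c ℓ) (stable : Stable F)
  (two≉0 : ¬ Char2 F)
  {m n : ℕ} (line : Fin m → NullGeometry.NullLine F) (P : Fin n → NullGeometry.Point F)
  {G : Fin m → Fin n → Set}
  (on : ∀ {a b} → G a b → NullGeometry.On F (P b) (line a))
  (line-injective : ∀ {a a′ b b′} → G a b → G a′ b′ → NullTriples.SameNullLine F stable two≉0 (line a)
      (line a′) → a ≡ a′)
  (point-injective : ∀ {a a′ b b′} → G a b → G a′ b′ → NullTriples.SamePoint F stable two≉0 (P b) (P b′) → b ≡ b′)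
  {k r : ℕ} (pruned : Pruning.Pruned G k r)
  where
  open Field F hiding (zero)
  open NullGeometry F
  open NullTriples F stable two≉0
  open FieldPolynomials F using (CharExceeds)
  open Counting
  open Pruning.Pruned pruned

  private
    M : Fin m → Fin n → Set
    M a b = A a × (B b × G a b)

    M? : ∀ a b → Dec (M a b)
    M? a b = A? a ×-dec (B? b ×-dec G? a b)

    G-of : ∀ {a b} → M a b → G a b
    G-of = proj₂ ∘ proj₂

    on′ : ∀ {a b} → M a b → On (P b) (line a)
    on′ = on ∘ G-of

    distinct-points : ∀ {a a′ b b′} → M a b → M a′ b′ → b ≢ b′ → ¬ SamePoint (P b) (P b′)
    distinct-points g g′ b≢b′ e = b≢b′ (point-injective (G-of g) (G-of g′) e)

    same-line : ∀ {a a′ b b′} → M a b → M a b′ → M a′ b → M a′ b′ → b ≢ b′ → a ≡ a′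
    same-line {a} {a′} {b} {b′} ab ab′ a′b a′b′ b≢b′ = line-injective (G-of ab) (G-of a′b)
      (two-points-line {P b} {P b′} {line a} {line a′} (on′ ab) (on′ ab′) (on′ a′b) (on′ a′b′)
          (distinct-points ab ab′ b≢b′))

    rich-rows : ∀ a b → M a b → k ≤ count (λ b → M? a b)
    rich-rows a b (Aa , _) = ≤-trans (rows a Aa) (count-mono (λ b → B? b ×-dec G? a b) (λ b → M? a b)
        (λ b bg → Aa , bg))

    rich-cols : ∀ a b → M a b → r ≤ count (λ a → M? a b)
    rich-cols a b (_ , Bb , _) = ≤-trans (cols b Bb) (count-mono (λ a → A? a ×-dec G? a b) (λ a → M? a b) (λ { a
        (Aa , g) → Aa , Bb , g }))

    open CommonNeighbours M? k r rich-rows rich-cols same-line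

    module _ (o : Fin n) where
      open Relative (P o)

      near-joined : ∀ {x} ((a , _) : Near o x) → Joined (slope (line a)) (P o) (P x)
      near-joined (a , ao , ax , _) = join {l = line a} (on′ ao) (on′ ax)

      near-α≉0 : ∀ {x} → Near o x → ¬ α (P x) ≈ 0#
      near-α≉0 nx@(a , ao , ax , x≢o) e = distinct-points ao ax (x≢o ∘ ≡.sym) (joined-same (near-joined nx) (sym
          (diff≈0 e)))

      equation : ∀ {x p} (nx : Near o x) → Link o x p → form (P p) + α (P x) * w (slope (line (proj₁ nx))) (P p) ≈ 0#
      equation nx (c , (cx , _) , cp , _) = secant-equation (near-joined nx) (join {l = line c} (on′ cx) (on′ cp))

      on-joined : ∀ {l p q} → On p l → Joined (slope l) p q → On q l
      on-joined {l} {p} {q} (y , z) (joined dy dz) = extend y dy , extend z dz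
        where
        open IntegerSolver commRing
        extend : ∀ {u v c s} → u ≈ c + s * px p → v - u ≈ s * (px q - px p) → v ≈ c + s * px q
        extend {u} {v} {c} {s} e d = trans (solve 2 (λ u v → v := u :+ (v :- u)) refl u v) (trans (+-cong e d)
          (solve 4 (λ c s x y → (c :+ s :* x) :+ s :* (y :- x) := c :+ s :* y) refl c s (px p) (px q)))

      -- With equal slopes x and y lie on the same line a through o. By `triangle` so does p, and
      -- the line c from x to p is then a itself; but c avoids o.
      slopes-differ : ∀ {x y p} (nx : Near o x) (ny : Near o y) → x ≢ y → Link o x p → Link o y p →
                      ¬ slope (line (proj₁ nx)) ≈ slope (line (proj₁ ny))
      slopes-differ {x} {y} {p} nx@(a , ao , ax , x≢o) ny@(a′ , a′o , a′y , y≢o) x≢y lx@(c ,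
          (cx , ¬co) , cp , p≢x) ly e
        with line-injective (G-of ao) (G-of a′o) (same-slope {P o} {line a} {line a′} (on′ ao) (on′ a′o) e)
      ... | ≡.refl = ¬co (≡.subst (λ a → M a o) a≡c ao)
        where
        αx≉αy : ¬ α (P x) ≈ α (P y)
        αx≉αy h = distinct-points ax a′y x≢y (joined-same (join {l = line a} (on′ ax) (on′ a′y))
          (diff≈0 (trans (solve 3 (λ x y z → x :- y := (x :- z) :- (y :- z)) refl (px (P x)) (px (P y)) (px
              (P o))) (≈-diff h))))
          where open IntegerSolver commRing
        p-on-a : On (P p) (line a)
        p-on-a = on-joined {line a} (on′ ao) (triangle {slope (line a)} {P x} {P y} {P p} αx≉αy (equation nx lx)
            (equation ny ly))
        a≡c : a ≡ c
        a≡c = line-injective (G-of ax) (G-of cx) (two-points-line {P x} {P p} {line a} {line c} (on′ ax) p-on-a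
            (on′ cx) (on′ cp)
                (distinct-points cx cp (p≢x ∘ ≡.sym)))

      -- A point q linked to x, y and z is off the cone of o: otherwise q = o by `form≈0⇒same`,
      -- while the line that links q to x avoids o. So inversion applies, and `unique` leaves room
      -- for one such point only.
      at-most-two : ∀ {x y z p p′} → Near o x → Near o y → Near o z → x ≢ y → x ≢ z → y ≢ z →
        Link o x p → Link o y p → Link o z p → Link o x p′ → Link o y p′ → Link o z p′ → p′ ≢ p → ⊥
      at-most-two {x} {y} {z} {p} {p′} nx ny nz x≢y x≢z y≢z lx ly lz lx′@(_ , _ , dp′ , _) ly′ lz′ p′≢p = clash lx
        where
        s≉t : ¬ slope (line (proj₁ nx)) ≈ slope (line (proj₁ ny))
        s≉t = slopes-differ nx ny x≢y lx ly
        s≉u : ¬ slope (line (proj₁ nx)) ≈ slope (line (proj₁ nz))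
        s≉u = slopes-differ nx nz x≢z lx lz
        t≉u : ¬ slope (line (proj₁ ny)) ≈ slope (line (proj₁ nz))
        t≉u = slopes-differ ny nz y≢z ly lz
        nonzero : ∀ {q} → Link o x q → Link o y q → Link o z q → ¬ form (P q) ≈ 0#
        nonzero {q} lx@(c , (_ , ¬co) , cq , _) ly lz e = ¬co (≡.subst (M c) q≡o cq)
          where
          q≡o : q ≡ o
          q≡o = point-injective (G-of cq) (G-of (proj₁ (proj₂ nx))) (form≈0⇒same {x = P x} {P y} {P z}
              {P q} s≉t s≉u t≉u (near-α≉0 nx) (near-α≉0 ny) (near-α≉0 nz)
            (equation nx lx) (equation ny ly) (equation nz lz) e)
        clash : Link o x p → ⊥
        clash (_ , _ , cp , _) = distinct-points dp′ cp p′≢p (unique {x = P x} {P y} {P z} {P p′}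
            {P p} s≉t s≉u t≉u (near-α≉0 nx) (near-α≉0 ny) (near-α≉0 nz)
          (equation nx lx′) (equation ny ly′) (equation nz lz′) (equation nx lx) (equation ny ly) (equation nz lz)
          (nonzero lx′ ly′ lz′) (nonzero lx ly lz))

  neighbour-bound : 0 < k →
    (r ℕ.* ℕ.pred k) ℕ.* ((ℕ.pred r ℕ.* ℕ.pred k) ℕ.* ℕ.pred (ℕ.pred r ℕ.* ℕ.pred k)) ≤ n ℕ.* (n ℕ.* 2)
  neighbour-bound 0<k = let a , Aa = row₀
                            b , Bb , g = count-∃ (λ b → B? b ×-dec G? a b) (≤-trans 0<k (rows a Aa))
                        in common-neighbours b (Aa , Bb , g) (at-most-two b)

  private
    Row Col : Set
    Row = ∃ A
    Col = ∃ B

    row-elements : ((a , _) : Row) → Σ (List (∃ λ b → B b × G a b)) _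
    row-elements (a , _) = elements (λ b → B? b ×-dec G? a b)

    col-elements : ((b , _) : Col) → Σ (List (∃ λ a → A a × G a b)) _
    col-elements (b , _) = elements (λ a → A? a ×-dec G? a b)

    cols-of : Row → List Col
    cols-of a = map (λ { (b , Bb , _) → b , Bb }) (proj₁ (row-elements a))

    rows-of : Col → List Row
    rows-of b = map (λ { (a , Aa , _) → a , Aa }) (proj₁ (col-elements b))

    line′ : Row → NullLine
    line′ = line ∘ proj₁

    pt : Col → Point
    pt = P ∘ proj₁

    k≤cols : ∀ a → k ≤ length (cols-of a)
    k≤cols a@(a₀ , Aa) = ≤-trans (rows a₀ Aa) (≤-reflexive (≡.sym (≡.trans (Listₚ.length-map _ (proj₁
        (row-elements a))) (proj₂ (proj₂ (row-elements a))))))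

    r≤rows : ∀ b → r ≤ length (rows-of b)
    r≤rows b@(b₀ , Bb) = ≤-trans (cols b₀ Bb) (≤-reflexive (≡.sym (≡.trans (Listₚ.length-map _ (proj₁
        (col-elements b))) (proj₂ (proj₂ (col-elements b))))))

    on-cols : ∀ a → All (λ b → On (pt b) (line′ a)) (cols-of a)
    on-cols a = Allₚ.map⁺ (All.universal (λ { (b , _ , g) → on g }) (proj₁ (row-elements a)))

    on-rows : ∀ b → All (λ a → On (pt b) (line′ a)) (rows-of b)
    on-rows b = Allₚ.map⁺ (All.universal (λ { (a , _ , g) → on g }) (proj₁ (col-elements b)))

    cols-distinct : ∀ a → AllPairs (λ b b′ → ¬ px (pt b) ≈ px (pt b′)) (cols-of a)
    cols-distinct a = AllPairsₚ.map⁺ (AllPairs.map (λ { {b , _ , g} {b′ , _ , g′} b≢b′ e →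
      b≢b′ (point-injective g g′ (joined-same (join {l = line′ a} (on g) (on g′)) e)) }) (proj₁ (proj₂
          (row-elements a))))

    rows-distinct : ∀ b → AllPairs (λ a a′ → ¬ slope (line′ a) ≈ slope (line′ a′)) (rows-of b)
    rows-distinct b = AllPairsₚ.map⁺ (AllPairs.map (λ { {a , _ , g} {a′ , _ , g′} a≢a′ e →
      a≢a′ (line-injective g g′ (same-slope {pt b} {line a} {line a′} (on g) (on g′) e)) }) (proj₁ (proj₂
          (col-elements b))))

  open Configurations F stable line′ pt cols-of rows-of k r k≤cols r≤rows on-cols on-rows cols-distinct rows-distinct row₀
    using (contradiction)

  too-rich : ∀ M v s → let d = suc (NullLines.degree F (M ℕ.+ M ℕ.+ M)) in CharExceeds d →
    d ℕ.+ d ≤ k ℕ.* s → d ≤ ℕ.pred k ℕ.* suc s → (∀ j → j < suc (suc s) → suc (j ℕ.+ j) ≤ r) →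
    NullLines.degree F (M ℕ.+ M ℕ.+ M) ≤ k ℕ.* v → n ℕ.* (v ℕ.* (v ℕ.+ v)) < M ℕ.* (M ℕ.* M) → ⊥
  too-rich M v s = contradiction P proj₁ (λ _ → ≡.refl) M v s two≉0

-- Choice of the parameters and the constants

module Numerics where
  open import Data.Nat using (pred; >-nonZero; _+_; _*_; _^_; _≤_; _<_; _/_; _%_; NonZero)
  open import Data.Nat.Properties
  open import Data.Nat.DivMod using (m/n*n≤m; m≡m%n+[m/n]*n; m%n<n)
  open import Data.Nat.Tactic.RingSolver using (solve-∀)
  open ≤-Reasoning

  ≤-by : ∀ {a b} d → a + d ≡ b → a ≤ b
  ≤-by d e = ≤-trans (m≤m+n _ d) (≤-reflexive e)

  lineDegree : ℕ → ℕ
  lineDegree M = (M + M + M) + ((M + M + M) + ((M + M + M) + 1))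

  m<[1+m/n]*n : ∀ m n .{{_ : NonZero n}} → m < suc (m / n) * n
  m<[1+m/n]*n m n = begin-strict
    m                      ≡⟨ m≡m%n+[m/n]*n m n ⟩
    m % n + m / n * n      <⟨ +-monoˡ-< (m / n * n) (m%n<n m n) ⟩
    n + m / n * n          ∎

  module _ (h q : ℕ) where
    private
      -- With M = HV the degree bound is D = 9HV + 1. The row degree K = 10H lies just above 9H,
      -- which yields D ≤ KV and, since s is about 2V, also 2(D + 1) ≤ Ks.
      H V K s D : ℕ
      H = suc h
      V = suc q
      K = 10 * H
      s = 2 * V + 1
      D = lineDegree (H * V)

    wronskian-degree : suc D + suc D ≤ K * s
    wronskian-degree = ≤-by (2 * (H * V) + 10 * h + 6) (eq h q)
      where
      eq : ∀ h q → let M = suc h * suc q; D = (M + M + M) + ((M + M + M) + ((M + M + M) + 1)) in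
           suc D + suc D + (2 * (suc h * suc q) + 10 * h + 6) ≡ 10 * suc h * (2 * suc q + 1)
      eq = solve-∀

    pencil-degree : suc D ≤ pred K * suc s
    pencil-degree = ≤-by (25 + 31 * h + 9 * q + 11 * h * q) (eq h q)
      where
      eq : ∀ h q → let M = suc h * suc q; D = (M + M + M) + ((M + M + M) + ((M + M + M) + 1)) in
           suc D + (25 + 31 * h + 9 * q + 11 * h * q) ≡ (h + 9 * suc h) * suc (2 * suc q + 1)
      eq = solve-∀

    line-degree : D ≤ K * V
    line-degree = ≤-by (h + q + h * q) (eq h q)
      where
      eq : ∀ h q → let M = suc h * suc q in (M + M + M) + ((M + M + M) + ((M + M + M) + 1)) + (h + q + h * q) ≡ 10 * suc h * suc q
      eq = solve-∀

    few-conditions : ∀ n → n + n < H * (H * H) * V → n * (V * (V + V)) < H * V * (H * V * (H * V))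
    few-conditions n lt = begin-strict
      n * (V * (V + V))              ≡⟨ e₁ n V ⟩
      (n + n) * (V * V)              <⟨ *-monoˡ-< (V * V) lt ⟩
      H * (H * H) * V * (V * V)      ≡⟨ e₂ H V ⟩
      H * V * (H * V * (H * V))      ∎
      where
      e₁ : ∀ n v → n * (v * (v + v)) ≡ (n + n) * (v * v)
      e₁ = solve-∀
      e₂ : ∀ h v → h * (h * h) * v * (v * v) ≡ h * v * (h * v * (h * v))
      e₂ = solve-∀

    -- Order s + 2 on a cone concerns coefficients of degree up to 2(s + 1) = 4V + 4 in the slope,
    -- and these need 4V + 5 roots.
    rich : ∀ {r} → 4 * V + 5 ≤ r → ∀ j → j < suc (suc s) → suc (j + j) ≤ r
    rich {r} le j (s≤s j≤) = begin
      suc (j + j)            ≤⟨ s≤s (+-mono-≤ j≤ j≤) ⟩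
      suc (suc s + suc s)    ≡⟨ eq V ⟩
      4 * V + 5              ≤⟨ le ⟩
      r                      ∎
      where
      eq : ∀ v → suc (suc (2 * v + 1) + suc (2 * v + 1)) ≡ 4 * v + 5
      eq = solve-∀

    -- D + 1 = 9HV + 2 is at most (9/4) H (4V + 5), hence at most (9/4) H r.
    degree-small : ∀ {r p} → 4 * V + 5 ≤ r → 3 * (H * r) < p → suc D < p
    degree-small {r} {p} le lt = *-cancelˡ-< 4 _ _ (begin-strict
      4 * suc D                                  ≤⟨ ≤-by (45 * h + 37) (eq h q) ⟩
      9 * (H * (4 * V + 5))                      ≤⟨ *-monoʳ-≤ 9 (*-monoʳ-≤ H le) ⟩
      9 * (H * r)                                ≤⟨ *-monoˡ-≤ (H * r) (≤-by {9} {12} 3 ≡.refl) ⟩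
      12 * (H * r)                               ≡⟨ e₂ (H * r) ⟩
      4 * (3 * (H * r))                          <⟨ *-monoʳ-< 4 lt ⟩
      4 * p                                      ∎)
      where
      eq : ∀ h q → let M = suc h * suc q; D = (M + M + M) + ((M + M + M) + ((M + M + M) + 1)) in
           4 * suc D + (45 * h + 37) ≡ 9 * (suc h * (4 * suc q + 5))
      eq = solve-∀
      e₂ : ∀ x → 12 * x ≡ 4 * (3 * x)
      e₂ = solve-∀

  -- V = suc q is the least number with 2n < H³V. The hypothesis gives q ≤ r/8, so that 4V + 5 = 4q
  -- + 9 ≤ r/2 + 9 ≤ r; this is the source of 16 and 18.
  choose-v : ∀ h n r → 18 ≤ r → 16 * n ≤ r * (suc h * (suc h * suc h)) →
             Σ ℕ λ q → n + n < suc h * (suc h * suc h) * suc q × 4 * suc q + 5 ≤ r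
  choose-v h n r 18≤r big = q , lower , *-cancelˡ-≤ 2 (begin
    2 * (4 * suc q + 5)     ≡⟨ e₁ q ⟩
    8 * q + 18              ≤⟨ +-mono-≤ 8q≤r 18≤r ⟩
    r + r                   ≡⟨ e₂ r ⟩
    2 * r                   ∎)
    where
    H³ q : ℕ
    H³ = suc h * (suc h * suc h)
    q = (n + n) / H³
    lower : n + n < H³ * suc q
    lower = ≡.subst (n + n <_) (*-comm (suc q) H³) (m<[1+m/n]*n (n + n) H³)
    8q≤r : 8 * q ≤ r
    8q≤r = *-cancelʳ-≤ (8 * q) r H³ (begin
      8 * q * H³       ≡⟨ *-assoc 8 q H³ ⟩
      8 * (q * H³)     ≤⟨ *-monoʳ-≤ 8 (m/n*n≤m (n + n) H³) ⟩
      8 * (n + n)      ≡⟨ e₃ n ⟩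
      16 * n           ≤⟨ big ⟩
      r * H³           ∎)
      where
      e₃ : ∀ n → 8 * (n + n) ≡ 16 * n
      e₃ = solve-∀
    e₁ : ∀ q → 2 * (4 * suc q + 5) ≡ 8 * q + 18
    e₁ = solve-∀
    e₂ : ∀ r → r + r ≡ 2 * r
    e₂ = solve-∀

  -- Put D = (r - 1) K. From K ≥ 9H and r - 1 ≥ r/2 one has rK ≥ 9x, 2D ≥ 9x and 2(D - 1) ≥ 7x. The
  -- product gives 567 x³ ≤ 8n², and 567 ≥ 8 · 70.
  neighbour-cube : ∀ h r n → 2 ≤ r → let K = pred (10 * suc h); x = suc h * r in
    (r * K) * ((pred r * K) * pred (pred r * K)) ≤ n * (n * 2) → 70 * (x * x * x) ≤ n * n
  neighbour-cube h (suc zero) n (s≤s ()) bound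
  neighbour-cube h r@(suc (suc r″)) n 2≤r bound = *-cancelˡ-≤ 8 (begin
    8 * (70 * (x * x * x))                        ≤⟨ ≤-by (7 * (x * x * x)) (e₁ (x * x * x)) ⟩
    567 * (x * x * x)                             ≡⟨ e₂ x ⟩
    9 * x * ((9 * x) * (7 * x))                   ≤⟨ *-mono-≤ 9x≤rK (*-mono-≤ 9x≤2D 7x≤2D-) ⟩
    (r * K) * ((2 * D) * (2 * pred D))            ≡⟨ e₃ (r * K) D (pred D) ⟩
    4 * ((r * K) * (D * pred D))                  ≤⟨ *-monoʳ-≤ 4 bound ⟩
    4 * (n * (n * 2))                             ≡⟨ e₄ n ⟩
    8 * (n * n)                                   ∎)
    where
    K D x r′ : ℕ
    K = pred (10 * suc h)
    r′ = suc r″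
    D = r′ * K
    x = suc h * r
    e₁ : ∀ y → 8 * (70 * y) + 7 * y ≡ 567 * y
    e₁ = solve-∀
    e₂ : ∀ x → 567 * (x * x * x) ≡ 9 * x * ((9 * x) * (7 * x))
    e₂ = solve-∀
    e₃ : ∀ a b c → a * ((2 * b) * (2 * c)) ≡ 4 * (a * (b * c))
    e₃ = solve-∀
    e₄ : ∀ n → 4 * (n * (n * 2)) ≡ 8 * (n * n)
    e₄ = solve-∀
    9x≤rK : 9 * x ≤ r * K
    9x≤rK = ≤-by (r * h) (eq h r)
      where
      eq : ∀ h r → 9 * (suc h * r) + r * h ≡ r * (h + 9 * suc h)
      eq = solve-∀
    9x≤2D : 9 * x ≤ 2 * D
    9x≤2D = ≤-by (9 * suc h * r″ + 2 * h * r′) (eq h r″)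
      where
      eq : ∀ h r″ → 9 * (suc h * suc (suc r″)) + (9 * suc h * r″ + 2 * h * suc r″) ≡ 2 * (suc r″ * (h + 9 * suc h))
      eq = solve-∀
    7x≤2D- : 7 * x ≤ 2 * pred D
    7x≤2D- = +-cancelʳ-≤ 2 _ _ (begin
      7 * x + 2            ≤⟨ +-monoʳ-≤ (7 * x) (*-monoʳ-≤ 2 {1} {x} (s≤s z≤n)) ⟩
      7 * x + 2 * x        ≡⟨ e₅ x ⟩
      9 * x                ≤⟨ 9x≤2D ⟩
      2 * D                ≤⟨ double-pred D ⟩
      2 * pred D + 2       ∎)
      where
      e₅ : ∀ x → 7 * x + 2 * x ≡ 9 * x
      e₅ = solve-∀
      e₆ : ∀ d → 2 * suc d ≡ 2 * d + 2
      e₆ = solve-∀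
      double-pred : ∀ d → 2 * d ≤ 2 * pred d + 2
      double-pred zero    = z≤n
      double-pred (suc d) = ≤-reflexive (e₆ d)

  -- If p ≤ 3x, then p³ ≤ 27x³ < 70x³ ≤ n², and so p⁹ < n⁶ ≤ p⁸. This is where n ≤ p^(4/3) is
  -- needed.
  below-characteristic : ∀ {x n p} → 0 < x → 0 < p → 70 * (x * x * x) ≤ n * n → n ^ 3 ≤ p ^ 4 → 3 * x < p
  below-characteristic {x@(suc x′)} {n} {p@(suc _)} _ _ le small = ≰⇒> λ p≤3x → <-irrefl ≡.refl (begin-strict
    p³ * (p³ * p³)                     <⟨ *-mono-< (cube p≤3x) (*-mono-< (cube p≤3x) (cube p≤3x)) ⟩
    z * (z * z)                        ≤⟨ *-mono-≤ le (*-mono-≤ le le) ⟩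
    n * n * (n * n * (n * n))          ≡⟨ e₁ n ⟩
    n ^ 3 * n ^ 3                      ≤⟨ *-mono-≤ small small ⟩
    p ^ 4 * p ^ 4                      ≤⟨ m≤m*n (p ^ 4 * p ^ 4) p ⟩
    p ^ 4 * p ^ 4 * p                  ≡⟨ e₂ p ⟩
    p³ * (p³ * p³)                     ∎)
    where
    p³ z : ℕ
    p³ = p * p * p
    z = 70 * (x * x * x)
    e₁ : ∀ n → n * n * (n * n * (n * n)) ≡ n * (n * (n * 1)) * (n * (n * (n * 1)))
    e₁ = solve-∀
    e₂ : ∀ p → p * (p * (p * (p * 1))) * (p * (p * (p * (p * 1)))) * p ≡ p * p * p * (p * p * p * (p * p * p))
    e₂ = solve-∀
    cube : p ≤ 3 * x → p³ < z
    cube p≤3x = begin-strict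
      p * p * p                      ≤⟨ *-mono-≤ (*-mono-≤ p≤3x p≤3x) p≤3x ⟩
      3 * x * (3 * x) * (3 * x)      ≡⟨ e₃ x ⟩
      27 * (x * x * x)               <⟨ *-monoˡ-< (x * x * x) (≤-by {28} {70} 42 ≡.refl) ⟩
      70 * (x * x * x)               ∎
      where
      e₃ : ∀ x → 3 * x * (3 * x) * (3 * x) ≡ 27 * (x * x * x)
      e₃ = solve-∀

  -- Each threshold is about a third of the average degree of a row or column.
  thresholds : ∀ {I m n} → 68 * (suc m + suc n) < I → Σ ℕ λ h → Σ ℕ λ r →
    10 * suc h * suc m + r * suc n + suc m < I × 18 ≤ r × I ≤ 60 * suc m * suc h × I ≤ 6 * suc n * r
  thresholds {I} {m} {n} big = pred h₀ , r , ≡.subst (λ h → 10 * h * suc m + r * suc n + suc m < I) h≡ sum< , 18≤r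
                             , ≡.subst (λ h → I ≤ 60 * suc m * h) h≡ I≤mh , I≤nr
    where
    h₀ r : ℕ
    h₀ = I / (30 * suc m)
    r = I / (3 * suc n)
    m≤I : 68 * suc m ≤ I
    m≤I = ≤-trans (*-monoʳ-≤ 68 (m≤m+n (suc m) (suc n))) (<⇒≤ big)
    n≤I : 68 * suc n ≤ I
    n≤I = ≤-trans (*-monoʳ-≤ 68 (m≤n+m (suc n) (suc m))) (<⇒≤ big)
    h-upper : h₀ * (30 * suc m) ≤ I
    h-upper = m/n*n≤m I (30 * suc m)
    r-upper : r * (3 * suc n) ≤ I
    r-upper = m/n*n≤m I (3 * suc n)
    h-lower : I < suc h₀ * (30 * suc m)
    h-lower = m<[1+m/n]*n I (30 * suc m)
    r-lower : I < suc r * (3 * suc n)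
    r-lower = m<[1+m/n]*n I (3 * suc n)
    0<h : 1 ≤ h₀
    0<h = ≤-pred (*-cancelʳ-< (30 * suc m) 1 (suc h₀) (≤-<-trans (≤-trans (≤-by (38 * suc m) (e
        (suc m))) m≤I) h-lower))
      where
      e : ∀ m → 1 * (30 * m) + 38 * m ≡ 68 * m
      e = solve-∀
    18≤r : 18 ≤ r
    18≤r = ≤-pred (*-cancelʳ-< (3 * suc n) 18 (suc r) (≤-<-trans (≤-trans (≤-by (14 * suc n) (e
        (suc n))) n≤I) r-lower))
      where
      e : ∀ n → 18 * (3 * n) + 14 * n ≡ 68 * n
      e = solve-∀
    h≡ : h₀ ≡ suc (pred h₀)
    h≡ = ≡.sym (suc-pred h₀ {{>-nonZero 0<h}})
    I≤mh : I ≤ 60 * suc m * h₀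
    I≤mh = begin
      I                          ≤⟨ <⇒≤ h-lower ⟩
      suc h₀ * (30 * suc m)      ≤⟨ *-monoˡ-≤ (30 * suc m) (+-monoˡ-≤ h₀ 0<h) ⟩
      (h₀ + h₀) * (30 * suc m)   ≡⟨ e h₀ (suc m) ⟩
      60 * suc m * h₀            ∎
      where
      e : ∀ h m → (h + h) * (30 * m) ≡ 60 * m * h
      e = solve-∀
    I≤nr : I ≤ 6 * suc n * r
    I≤nr = begin
      I                          ≤⟨ <⇒≤ r-lower ⟩
      suc r * (3 * suc n)        ≤⟨ *-monoˡ-≤ (3 * suc n) (+-monoˡ-≤ r (≤-trans (s≤s z≤n) 18≤r)) ⟩
      (r + r) * (3 * suc n)      ≡⟨ e r (suc n) ⟩
      6 * suc n * r              ∎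
      where
      e : ∀ r n → (r + r) * (3 * n) ≡ 6 * n * r
      e = solve-∀
    -- Rows and columns each take at most a third of I; the remaining third exceeds the number of
    -- points, that is, the allowance for incidences with degenerate lines.
    sum< : 10 * h₀ * suc m + r * suc n + suc m < I
    sum< = *-cancelˡ-< 3 _ _ (begin-strict
      3 * (10 * h₀ * suc m + r * suc n + suc m)             ≡⟨ e₁ h₀ r (suc m) (suc n) ⟩
      h₀ * (30 * suc m) + r * (3 * suc n) + 3 * suc m       <⟨ +-mono-≤-< (+-mono-≤ h-upper r-upper) 3m<I ⟩
      I + I + I                                             ≡⟨ e₂ I ⟩
      3 * I                                                 ∎)
      where
      e₁ : ∀ h r m n → 3 * (10 * h * m + r * n + m) ≡ h * (30 * m) + r * (3 * n) + 3 * m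
      e₁ = solve-∀
      e₂ : ∀ i → i + i + i ≡ 3 * i
      e₂ = solve-∀
      3m<I : 3 * suc m < I
      3m<I = <-≤-trans (*-monoˡ-< (suc m) (≤-by {4} {68} 64 ≡.refl)) m≤I

  -- Multiply the bound through columns by the cube of the bound through rows: the unknown
  -- thresholds appear exactly in the product r h³.
  fourth-power-bound : ∀ {I m n h r a b c C} → I ≤ b * m * h → I ≤ a * n * r → r * (h * (h * h)) ≤ c * n →
                       a * (b * (b * b)) * c ≤ C → I ^ 4 ≤ C * (m ^ 3 * n ^ 2)
  fourth-power-bound {I} {m} {n} {h} {r} {a} {b} {c} {C} I≤mh I≤nr small large = begin
    I ^ 4
      ≡⟨ e₀ I ⟩
    I * (I * (I * I))
      ≤⟨ *-mono-≤ I≤nr (*-mono-≤ I≤mh (*-mono-≤ I≤mh I≤mh)) ⟩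
    a * n * r * (b * m * h * (b * m * h * (b * m * h)))
      ≡⟨ e₁ a b m n h r ⟩
    a * (b * (b * b)) * (n * (m * (m * m))) * (r * (h * (h * h)))
      ≤⟨ *-monoʳ-≤ (a * (b * (b * b)) * (n * (m * (m * m)))) small ⟩
    a * (b * (b * b)) * (n * (m * (m * m))) * (c * n)
      ≡⟨ e₂ (a * (b * (b * b))) c m n ⟩
    a * (b * (b * b)) * c * (m ^ 3 * n ^ 2)
      ≤⟨ *-monoˡ-≤ (m ^ 3 * n ^ 2) large ⟩
    C * (m ^ 3 * n ^ 2) ∎
    where
    e₀ : ∀ i → i * (i * (i * (i * 1))) ≡ i * (i * (i * i))
    e₀ = solve-∀
    e₁ : ∀ a b m n h r → a * n * r * (b * m * h * (b * m * h * (b * m * h))) ≡ a * (b * (b * b)) * (n * (m *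
        (m * m))) * (r * (h * (h * h)))
    e₁ = solve-∀
    e₂ : ∀ d c m n → d * (n * (m * (m * m))) * (c * n) ≡ d * c * (m * (m * (m * 1)) * (n * (n * 1)))
    e₂ = solve-∀

  fourth-root : ∀ {c t I} → c ^ 4 * t ^ 4 < I ^ 4 → c * t < I
  fourth-root {c} {t} {I} lt = ≰⇒> λ I≤ct → <⇒≱ lt (≤-trans (^-monoˡ-≤ 4 I≤ct) (≤-reflexive (e c t)))
    where
    e : ∀ c t → c * t * (c * t * (c * t * (c * t * 1))) ≡ c * (c * (c * (c * 1))) * (t * (t * (t * (t * 1))))
    e = solve-∀

-- The dual of a linear line complex

open import Defs

module LineComplex {c ℓ} (F : Field c ℓ) where
  open Field F hiding (zero)
  open FieldPolynomials F using (cancelˡ)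
  open IntegerSolver commRing
  open NullGeometry F
  open V4
  open V6
  open Line
  open import Relation.Binary.Reasoning.Setoid setoid

  -- Coordinates x0, ξ₁, ξ₂, ξ₃ in which the complex is P₀₃ = P₁₂.
  record Frame (N : V6 F) : Set (c ⊔ ℓ) where
    field
      ξ₁ ξ₂ ξ₃  : V4 F → Carrier
      linear    : ∀ ξ → (ξ ≡ ξ₁ ⊎ ξ ≡ ξ₂ ⊎ ξ ≡ ξ₃) → ∀ α X β Y → ξ (_+4_ F (_·4_ F α X)
          (_·4_ F β Y)) ≈ α * ξ X + β * ξ Y
      ξ-cong    : ∀ ξ → (ξ ≡ ξ₁ ⊎ ξ ≡ ξ₂ ⊎ ξ ≡ ξ₃) → ∀ {X Y} → _≈4_ F X Y → ξ X ≈ ξ Y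
      normal    : ∀ l → InComplex F N l → let X = pt₁ l; Y = pt₂ l in x0 X * ξ₃ Y - ξ₃ X * x0 Y ≈ ξ₁ X * ξ₂ Y - ξ₂ X * ξ₁ Y
      separates : ∀ {X Y} → x0 X ≈ x0 Y → ξ₁ X ≈ ξ₁ Y → ξ₂ X ≈ ξ₂ Y → ξ₃ X ≈ ξ₃ Y → _≈4_ F X Y

  cancel-≈ : ∀ {a x y} → ¬ a ≈ 0# → a * x ≈ a * y → x ≈ y
  cancel-≈ {a} {x} {y} a≉0 e = trans (solve 2 (λ x y → x := (x :- y) :+ y) refl x y) (trans (+-congʳ
    (cancelˡ a≉0 (trans (solve 3 (λ a x y → a :* (x :- y) := a :* x :- a :* y) refl a x y) (trans (+-congʳ e)
        (-‿inverseʳ _))))) (+-identityˡ y))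

  -- The 2-form f x₂∧x₃ + g x₃∧x₁ + h x₁∧x₂ is (1/f)(f x₂ - g x₁)∧(f x₃ - h x₁).
  module _ (a b e f g h : Carrier) where
    Δ : Carrier
    Δ = a * f + b * g + e * h

    ζ₁ ζ₂ ζ₃ : Carrier → Carrier → Carrier → Carrier
    ζ₁ x y z = f * y - g * x
    ζ₂ x y z = f * z - h * x
    ζ₃ x y z = - (f * (a * x + b * y + e * z))

    -- The combination - ζ₃ - b ζ₁ - e ζ₂ equals Δ x; here the regularity of the complex enters.
    -- Then f y and f z follow from ζ₁ and ζ₂.
    ζ-separates : ¬ Δ ≈ 0# → ¬ f ≈ 0# → ∀ {x y z x′ y′ z′} → ζ₁ x y z ≈ ζ₁ x′ y′ z′ → ζ₂ x y z ≈ ζ₂ x′ y′ z′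
        → ζ₃ x y z ≈ ζ₃ x′ y′ z′ →
                  x ≈ x′ × y ≈ y′ × z ≈ z′
    ζ-separates Δ≉0 f≉0 {x} {y} {z} {x′} {y′} {z′} e₁ e₂ e₃ = x≈ , second f≉0 e₁ , second f≉0 e₂
      where
      recover : ∀ x y z → - ζ₃ x y z - b * ζ₁ x y z - e * ζ₂ x y z ≈ Δ * x
      recover = solve 9 (λ a b e f g h x y z → :- (:- (f :* (a :* x :+ b :* y :+ e :* z))) :- b :*
          (f :* y :- g :* x) :- e :* (f :* z :- h :* x)
                  := (a :* f :+ b :* g :+ e :* h) :* x) refl a b e f g h
      x≈ : x ≈ x′
      x≈ = cancel-≈ Δ≉0 (trans (sym (recover x y z)) (trans (+-cong (+-cong (-‿cong e₃) (-‿cong (*-congˡ e₁)))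
          (-‿cong (*-congˡ e₂))) (recover x′ y′ z′)))
      second : ∀ {f g y y′} → ¬ f ≈ 0# → f * y - g * x ≈ f * y′ - g * x′ → y ≈ y′
      second {f} {g} {y} {y′} f≉0 eq = cancel-≈ f≉0 (begin
        f * y                        ≈⟨ solve 2 (λ u v → u := (u :- v) :+ v) refl (f * y) (g * x) ⟩
        (f * y - g * x) + g * x      ≈⟨ +-cong eq (*-congˡ x≈) ⟩
        (f * y′ - g * x′) + g * x′   ≈⟨ solve 2 (λ u v → u := (u :- v) :+ v) refl (f * y′) (g * x′) ⟨
        f * y′                       ∎)

    ζ-linear₁ : ∀ α x y z β x′ y′ z′ → ζ₁ (α * x + β * x′) (α * y + β * y′)
        (α * z + β * z′) ≈ α * ζ₁ x y z + β * ζ₁ x′ y′ z′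
    ζ-linear₁ α x y z β x′ y′ z′ = solve 8 (λ f g α x y β x′ y′ → f :* (α :* y :+ β :* y′) :- g :* (α :* x :+ β :* x′)
      := α :* (f :* y :- g :* x) :+ β :* (f :* y′ :- g :* x′)) refl f g α x y β x′ y′

    ζ-linear₂ : ∀ α x y z β x′ y′ z′ → ζ₂ (α * x + β * x′) (α * y + β * y′)
        (α * z + β * z′) ≈ α * ζ₂ x y z + β * ζ₂ x′ y′ z′
    ζ-linear₂ α x y z β x′ y′ z′ = solve 8 (λ f h α x z β x′ z′ → f :* (α :* z :+ β :* z′) :- h :* (α :* x :+ β :* x′)
      := α :* (f :* z :- h :* x) :+ β :* (f :* z′ :- h :* x′)) refl f h α x z β x′ z′

    ζ-linear₃ : ∀ α x y z β x′ y′ z′ → ζ₃ (α * x + β * x′) (α * y + β * y′)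
        (α * z + β * z′) ≈ α * ζ₃ x y z + β * ζ₃ x′ y′ z′
    ζ-linear₃ α x y z β x′ y′ z′ = solve 12 (λ a b e f α x y z β x′ y′ z′ →
      :- (f :* (a :* (α :* x :+ β :* x′) :+ b :* (α :* y :+ β :* y′) :+ e :* (α :* z :+ β :* z′)))
      := α :* (:- (f :* (a :* x :+ b :* y :+ e :* z))) :+ β :* (:- (f :*
          (a :* x′ :+ b :* y′ :+ e :* z′)))) refl a b e f α x y z β x′ y′ z′

    ζ-normal : ∀ x₀ x y z x₀′ x′ y′ z′ →
      x₀ * ζ₃ x′ y′ z′ - ζ₃ x y z * x₀′ ≈ (ζ₁ x y z * ζ₂ x′ y′ z′ - ζ₂ x y z * ζ₁ x′ y′ z′)
        + - f * (a * (x₀ * x′ - x * x₀′) + b * (x₀ * y′ - y * x₀′) + e * (x₀ * z′ - z * x₀′)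
                 + f * (y * z′ - z * y′) + g * (z * x′ - x * z′) + h * (x * y′ - y * x′))
    ζ-normal x₀ x y z x₀′ x′ y′ z′ = trans
      (solve 12 (λ a b e f x₀ x y z x₀′ x′ y′ z′ →
         x₀ :* (:- (f :* (a :* x′ :+ b :* y′ :+ e :* z′))) :- (:- (f :* (a :* x :+ b :* y :+ e :* z))) :* x₀′
         := :- f :* (a :* (x₀ :* x′ :- x :* x₀′) :+ b :* (x₀ :* y′ :- y :* x₀′) :+ e :*
             (x₀ :* z′ :- z :* x₀′))) refl a b e f x₀ x y z x₀′ x′ y′ z′)
      (trans (trans (sym (+-identityʳ _)) (+-congˡ (sym wedge))) (solve 6 (λ f u v w t q → :- f :* u :+
          (q :+ :- f :* (v :+ w :+ t)) := q :+ :- f :* (u :+ v :+ w :+ t)) refl f _ _ _ _ _))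
      where
      wedge : (ζ₁ x y z * ζ₂ x′ y′ z′ - ζ₂ x y z * ζ₁ x′ y′ z′) + - f * (f * (y * z′ - z * y′) + g *
          (z * x′ - x * z′) + h * (x * y′ - y * x′)) ≈ 0#
      wedge = solve 9 (λ f g h x y z x′ y′ z′ →
        ((f :* y :- g :* x) :* (f :* z′ :- h :* x′) :- (f :* z :- h :* x) :* (f :* y′ :- g :* x′))
        :+ :- f :* (f :* (y :* z′ :- z :* y′) :+ g :* (z :* x′ :- x :* z′) :+ h :*
            (x :* y′ :- y :* x′)) := :0) refl f g h x y z x′ y′ z′

    ζ-cong₁ : ∀ x y z {x′ y′ z′} → x ≈ x′ → y ≈ y′ → z ≈ z′ → ζ₁ x y z ≈ ζ₁ x′ y′ z′
    ζ-cong₁ x y z p q r = +-cong (*-congˡ q) (-‿cong (*-congˡ p))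

    ζ-cong₂ : ∀ x y z {x′ y′ z′} → x ≈ x′ → y ≈ y′ → z ≈ z′ → ζ₂ x y z ≈ ζ₂ x′ y′ z′
    ζ-cong₂ x y z p q r = +-cong (*-congˡ r) (-‿cong (*-congˡ p))

    ζ-cong₃ : ∀ x y z {x′ y′ z′} → x ≈ x′ → y ≈ y′ → z ≈ z′ → ζ₃ x y z ≈ ζ₃ x′ y′ z′
    ζ-cong₃ x y z p q r = -‿cong (*-congˡ (+-cong (+-cong (*-congˡ p) (*-congˡ q)) (*-congˡ r)))

  -- x, y, z are the affine coordinates up to a cyclic rotation, which makes f nonzero.
  module _ (N : V6 F) (a b e f g h : Carrier) (x y z : V4 F → Carrier)
    (split : ∀ {X Y} → x X ≈ x Y → y X ≈ y Y → z X ≈ z Y → x0 X ≈ x0 Y → _≈4_ F X Y)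
    (unsplit : ∀ {X Y} → _≈4_ F X Y → x X ≈ x Y × y X ≈ y Y × z X ≈ z Y)
    (x-linear : ∀ α X β Y → x (_+4_ F (_·4_ F α X) (_·4_ F β Y)) ≈ α * x X + β * x Y)
    (y-linear : ∀ α X β Y → y (_+4_ F (_·4_ F α X) (_·4_ F β Y)) ≈ α * y X + β * y Y)
    (z-linear : ∀ α X β Y → z (_+4_ F (_·4_ F α X) (_·4_ F β Y)) ≈ α * z X + β * z Y)
    (complex : ∀ l → InComplex F N l →
       a * (x0 (pt₁ l) * x (pt₂ l) - x (pt₁ l) * x0 (pt₂ l)) + b * (x0 (pt₁ l) * y (pt₂ l) - y (pt₁ l) * x0 (pt₂ l))
       + e * (x0 (pt₁ l) * z (pt₂ l) - z (pt₁ l) * x0 (pt₂ l)) + f * (y (pt₁ l) * z (pt₂ l) - z (pt₁ l) * y (pt₂ l))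
       + g * (z (pt₁ l) * x (pt₂ l) - x (pt₁ l) * z (pt₂ l)) + h * (x (pt₁ l) * y (pt₂ l) - y (pt₁ l) * x
           (pt₂ l)) ≈ 0#)
    (Δ≉0 : ¬ Δ a b e f g h ≈ 0#) (f≉0 : ¬ f ≈ 0#)
    where
    private
      lift : (Carrier → Carrier → Carrier → Carrier) → V4 F → Carrier
      lift ζ X = ζ (x X) (y X) (z X)

    frame : Frame N
    frame = record
      { ξ₁ = lift (ζ₁ a b e f g h)
      ; ξ₂ = lift (ζ₂ a b e f g h)
      ; ξ₃ = lift (ζ₃ a b e f g h)
      ; linear = λ
          { _ (inj₁ ≡.refl) α X β Y → trans (ζ-cong₁ a b e f g h _ _ _ (x-linear α X β Y) (y-linear α X β Y)
              (z-linear α X β Y)) (ζ-linear₁ a b e f g h α (x X) (y X) (z X) β (x Y) (y Y) (z Y))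
          ; _ (inj₂ (inj₁ ≡.refl)) α X β Y → trans (ζ-cong₂ a b e f g h _ _ _ (x-linear α X β Y)
              (y-linear α X β Y) (z-linear α X β Y)) (ζ-linear₂ a b e f g h α (x X) (y X) (z X) β (x Y) (y Y) (z Y))
          ; _ (inj₂ (inj₂ ≡.refl)) α X β Y → trans (ζ-cong₃ a b e f g h _ _ _ (x-linear α X β Y)
              (y-linear α X β Y) (z-linear α X β Y)) (ζ-linear₃ a b e f g h α (x X) (y X) (z X) β (x Y) (y Y) (z Y)) }
      ; ξ-cong = λ
          { _ (inj₁ ≡.refl) E → let p , q , r = unsplit E in ζ-cong₁ a b e f g h _ _ _ p q r
          ; _ (inj₂ (inj₁ ≡.refl)) E → let p , q , r = unsplit E in ζ-cong₂ a b e f g h _ _ _ p q r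
          ; _ (inj₂ (inj₂ ≡.refl)) E → let p , q , r = unsplit E in ζ-cong₃ a b e f g h _ _ _ p q r }
      ; normal = λ l in-complex → trans (ζ-normal a b e f g h _ _ _ _ _ _ _ _)
          (trans (+-congˡ (trans (*-congˡ (complex l in-complex)) (zeroʳ _))) (+-identityʳ _))
      ; separates = λ e₀ e₁ e₂ e₃ → let p , q , r = ζ-separates a b e f g h Δ≉0 f≉0 e₁ e₂ e₃ in split p q r e₀ }

  -- One of f, g, h is nonzero, since otherwise af + bg + eh = 0. Which one cannot be decided, hence
  -- the double negation. The rotation moves (a, b, e) and (f, g, h) in step.
  frame-exists : ∀ N → NotOnKlein F N → ¬ ¬ Frame N
  frame-exists N@(v6 a b e f g h) Δ≉0 k = ¬¬-dec λ
    { (no f≉0) → k (frame N a b e f g h x1 x2 x3 (λ p q r s → s , p , q , r) (λ { (s , p , q , r) → p , q , r })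
        (λ _ _ _ _ → refl) (λ _ _ _ _ → refl) (λ _ _ _ _ → refl) (λ l i → i) Δ≉0 f≉0)
    ; (yes f≈0) → ¬¬-dec λ
        { (no g≉0) → k (frame N b e a g h f x2 x3 x1 (λ p q r s → s , r , p , q) (λ { (s , p , q , r) → q , r , p })
            (λ _ _ _ _ → refl) (λ _ _ _ _ → refl) (λ _ _ _ _ → refl)
            (λ l i → trans (solve 6 (λ u v w x y z
                → u :+ v :+ w :+ x :+ y :+ z := w :+ u :+ v :+ z :+ x :+ y) refl _ _ _ _ _ _) i)
            (λ d → Δ≉0 (trans (solve 3 (λ u v w → u :+ v :+ w := v :+ w :+ u) refl _ _ _) d)) g≉0)
        ; (yes g≈0) → ¬¬-dec λ
            { (no h≉0) → k (frame N e a b h f g x3 x1 x2 (λ p q r s → s , q , r , p) (λ {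
                (s , p , q , r) → r , p , q })
                (λ _ _ _ _ → refl) (λ _ _ _ _ → refl) (λ _ _ _ _ → refl)
                (λ l i → trans (solve 6 (λ u v w x y z
                    → u :+ v :+ w :+ x :+ y :+ z := v :+ w :+ u :+ y :+ z :+ x) refl _ _ _ _ _ _) i)
                (λ d → Δ≉0 (trans (solve 3 (λ u v w → u :+ v :+ w := w :+ u :+ v) refl _ _ _) d)) h≉0)
            ; (yes h≈0) → Δ≉0 (trans (+-cong (+-cong (trans (*-congˡ f≈0) (zeroʳ a)) (trans (*-congˡ g≈0)
                (zeroʳ b))) (trans (*-congˡ h≈0) (zeroʳ e)))
                                (trans (+-identityʳ _) (+-identityʳ 0#))) } } }

  module Dual {N : V6 F} (frame : Frame N) where
    open Frame frame

    private
      is₁ : ξ₁ ≡ ξ₁ ⊎ ξ₁ ≡ ξ₂ ⊎ ξ₁ ≡ ξ₃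
      is₁ = inj₁ ≡.refl
      is₂ : ξ₂ ≡ ξ₁ ⊎ ξ₂ ≡ ξ₂ ⊎ ξ₂ ≡ ξ₃
      is₂ = inj₂ (inj₁ ≡.refl)
      is₃ : ξ₃ ≡ ξ₁ ⊎ ξ₃ ≡ ξ₂ ⊎ ξ₃ ≡ ξ₃
      is₃ = inj₂ (inj₂ ≡.refl)

    record Coordinates : Set c where
      constructor coords
      field
        c₀ c₁ c₂ c₃ : Carrier
    open Coordinates

    coordinates : V4 F → Coordinates
    coordinates X = coords (x0 X) (ξ₁ X) (ξ₂ X) (ξ₃ X)

    record Combination (W : Coordinates) (α : Carrier) (X : Coordinates) (β : Carrier) (Y : Coordinates) : Set ℓ where
      constructor combination
      field
        in₀ : c₀ W ≈ α * c₀ X + β * c₀ Y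
        in₁ : c₁ W ≈ α * c₁ X + β * c₁ Y
        in₂ : c₂ W ≈ α * c₂ X + β * c₂ Y
        in₃ : c₃ W ≈ α * c₃ X + β * c₃ Y
    open Combination

    from-OnLine : ∀ {W} l → (o : OnLineH F W l) → Combination (coordinates W) (proj₁ o) (coordinates (pt₁ l))
        (proj₁ (proj₂ o)) (coordinates (pt₂ l))
    from-OnLine (line X Y _) (α , β , e) = combination (proj₁ e)
      (trans (ξ-cong ξ₁ is₁ e) (linear ξ₁ is₁ α X β Y)) (trans (ξ-cong ξ₂ is₂ e) (linear ξ₂ is₂ α X β Y)) (trans
          (ξ-cong ξ₃ is₃ e) (linear ξ₃ is₃ α X β Y))

    to-OnLine : ∀ {W α β} l → Combination (coordinates W) α (coordinates (pt₁ l)) β (coordinates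
        (pt₂ l)) → OnLineH F W l
    to-OnLine {W} {α} {β} (line X Y _) w = α , β , separates (in₀ w)
      (trans (in₁ w) (sym (linear ξ₁ is₁ α X β Y))) (trans (in₂ w) (sym (linear ξ₂ is₂ α X β Y))) (trans (in₃ w)
          (sym (linear ξ₃ is₃ α X β Y)))

    first-point : ∀ X Y → Combination X 1# X 0# Y
    first-point X Y = combination (unit _ _) (unit _ _) (unit _ _) (unit _ _)
      where
      unit : ∀ x y → x ≈ 1# * x + 0# * y
      unit = solve 2 (λ x y → x := :1 :* x :+ :0 :* y) refl

    second-point : ∀ X Y → Combination Y 0# X 1# Y
    second-point X Y = combination (unit _ _) (unit _ _) (unit _ _) (unit _ _)
      where
      unit : ∀ x y → y ≈ 0# * x + 1# * y
      unit = solve 2 (λ x y → y := :0 :* x :+ :1 :* y) refl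

    cramer : ∀ {ρ w x y w′ x′ y′} → ρ * (x * y′ - x′ * y) ≈ 1# →
             let α = ρ * (w * y′ - w′ * y); β = ρ * (x * w′ - x′ * w) in
             (w ≈ α * x + β * y) × (w′ ≈ α * x′ + β * y′)
    cramer {ρ} {w} {x} {y} {w′} {x′} {y′} e =
        trans (sym (*-identityˡ w)) (trans (*-congʳ (sym e))
          (solve 7 (λ ρ w x y w′ x′ y′ → ρ :* (x :* y′ :- x′ :* y) :* w := ρ :*
              (w :* y′ :- w′ :* y) :* x :+ ρ :* (x :* w′ :- x′ :* w) :* y) refl ρ w x y w′ x′ y′))
      , trans (sym (*-identityˡ w′)) (trans (*-congʳ (sym e))
          (solve 7 (λ ρ w x y w′ x′ y′ → ρ :* (x :* y′ :- x′ :* y) :* w′ := ρ :*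
              (w :* y′ :- w′ :* y) :* x′ :+ ρ :* (x :* w′ :- x′ :* w) :* y′) refl ρ w x y w′ x′ y′))

    dependent : ∀ {α β u v w₀ w₁ w₂ x₀ x₁ x₂ y₀ y₁ y₂} → w₀ ≈ α * x₀ + β * y₀ → w₁ ≈ α * x₁ + β * y₁ →
                w₂ ≈ u * w₀ + v * w₁ → x₂ ≈ u * x₀ + v * x₁ → y₂ ≈ u * y₀ + v * y₁ → w₂ ≈ α * x₂ + β * y₂
    dependent {α} {β} {u} {v} {x₀ = x₀} {x₁} {x₂} {y₀} {y₁} {y₂} e₀ e₁ ew ex ey = trans ew (trans (+-cong
        (*-congˡ e₀) (*-congˡ e₁))
      (trans (solve 8 (λ α β u v x₀ x₁ y₀ y₁ → u :* (α :* x₀ :+ β :* y₀) :+ v :* (α :* x₁ :+ β :* y₁)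
                := α :* (u :* x₀ :+ v :* x₁) :+ β :* (u :* y₀ :+ v :* y₁)) refl α β u v x₀ x₁ y₀ y₁)
             (sym (+-cong (*-congˡ ex) (*-congˡ ey)))))

    module _ (l : Line F) where
      private
        X Y : Coordinates
        X = coordinates (pt₁ l)
        Y = coordinates (pt₂ l)

      P₀₁ P₀₂ P₀₃ P₃₁ : Carrier
      P₀₁ = c₀ X * c₁ Y - c₁ X * c₀ Y
      P₀₂ = c₀ X * c₂ Y - c₂ X * c₀ Y
      P₀₃ = c₀ X * c₃ Y - c₃ X * c₀ Y
      P₃₁ = c₃ X * c₁ Y - c₁ X * c₃ Y

    module _ {l : Line F} (in-complex : InComplex F N l) where
      private
        X Y : Coordinates
        X = coordinates (pt₁ l)
        Y = coordinates (pt₂ l)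

        P₀₃≈P₁₂ : P₀₃ l ≈ c₁ X * c₂ Y - c₂ X * c₁ Y
        P₀₃≈P₁₂ = normal l in-complex

      -- The relations P ∧ W = 0 between the Plücker coordinates of l and a point W of l, with P₁₂ = P₀₃.
      plane₂ : ∀ {W α β} → Combination W α X β Y → P₀₁ l * c₂ W ≈ P₀₂ l * c₁ W - P₀₃ l * c₀ W
      plane₂ {W} {α} {β} w = begin
        P₀₁ l * c₂ W
          ≈⟨ *-congˡ (in₂ w) ⟩
        P₀₁ l * (α * c₂ X + β * c₂ Y)
          ≈⟨ solve 8 (λ α β x₀ x₁ x₂ y₀ y₁ y₂ → (x₀ :* y₁ :- x₁ :* y₀) :* (α :* x₂ :+ β :* y₂)
                := (x₀ :* y₂ :- x₂ :* y₀) :* (α :* x₁ :+ β :* y₁) :- (x₁ :* y₂ :- x₂ :* y₁) :*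
                    (α :* x₀ :+ β :* y₀)) refl α β _ _ _ _ _ _ ⟩
        P₀₂ l * (α * c₁ X + β * c₁ Y) - (c₁ X * c₂ Y - c₂ X * c₁ Y) * (α * c₀ X + β * c₀ Y)
          ≈⟨ +-cong (*-congˡ (in₁ w)) (-‿cong (*-cong P₀₃≈P₁₂ (in₀ w))) ⟨
        P₀₂ l * c₁ W - P₀₃ l * c₀ W ∎

      plane₃ : ∀ {W α β} → Combination W α X β Y → P₀₁ l * c₃ W ≈ P₀₃ l * c₁ W + P₃₁ l * c₀ W
      plane₃ {W} {α} {β} w = begin
        P₀₁ l * c₃ W
          ≈⟨ *-congˡ (in₃ w) ⟩
        P₀₁ l * (α * c₃ X + β * c₃ Y)
          ≈⟨ solve 8 (λ α β x₀ x₁ x₃ y₀ y₁ y₃ → (x₀ :* y₁ :- x₁ :* y₀) :* (α :* x₃ :+ β :* y₃)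
                := (x₀ :* y₃ :- x₃ :* y₀) :* (α :* x₁ :+ β :* y₁) :+ (x₃ :* y₁ :- x₁ :* y₃) :*
                    (α :* x₀ :+ β :* y₀)) refl α β _ _ _ _ _ _ ⟩
        P₀₃ l * (α * c₁ X + β * c₁ Y) + P₃₁ l * (α * c₀ X + β * c₀ Y)
          ≈⟨ +-cong (*-congˡ (in₁ w)) (*-congˡ (in₀ w)) ⟨
        P₀₃ l * c₁ W + P₃₁ l * c₀ W ∎

      module _ {ρ : Carrier} (ρP≈1 : P₀₁ l * ρ ≈ 1#) where
        divide : ∀ {w u v x y} → P₀₁ l * w ≈ u * x + v * y → w ≈ ρ * u * x + ρ * v * y
        divide {w} {u} {v} {x} {y} e = begin
          w                        ≈⟨ trans (sym (*-identityˡ w)) (*-congʳ (sym ρP≈1)) ⟩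
          P₀₁ l * ρ * w            ≈⟨ solve 3 (λ p ρ w → p :* ρ :* w := ρ :* (p :* w)) refl (P₀₁ l) ρ w ⟩
          ρ * (P₀₁ l * w)          ≈⟨ *-congˡ e ⟩
          ρ * (u * x + v * y)      ≈⟨ solve 5 (λ ρ u v x y → ρ :*
              (u :* x :+ v :* y) := ρ :* u :* x :+ ρ :* v :* y) refl ρ u v x y ⟩
          ρ * u * x + ρ * v * y    ∎

        slope₂ : ∀ {W α β} → Combination W α X β Y → c₂ W ≈ ρ * (- P₀₃ l) * c₀ W + ρ * P₀₂ l * c₁ W
        slope₂ {W} w = divide (trans (plane₂ w) (solve 4
            (λ a b x y → a :* x :- b :* y := :- b :* y :+ a :* x) refl (P₀₂ l) (P₀₃ l) (c₁ W) (c₀ W)))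

        slope₃ : ∀ {W α β} → Combination W α X β Y → c₃ W ≈ ρ * P₃₁ l * c₀ W + ρ * P₀₃ l * c₁ W
        slope₃ {W} w = divide (trans (plane₃ w) (+-comm _ _))

        -- Plücker coordinates normalised by P₀₁ = 1. With P₁₂ = P₀₃ these three determine the line,
        -- because the Klein relation supplies P₂₃. The signs are those that make `nullLineOf` a
        -- line in direction (1, s, s²).
        dualPoint : Point
        dualPoint = point (ρ * P₀₂ l) (ρ * (- P₀₃ l)) (- (ρ * P₃₁ l))

        -- As P₀₁ ≠ 0, the coordinates c₀ and c₁ parametrise l: Cramer's rule matches them, and the
        -- two equations then force c₂ and c₃.
        on-line-if : ∀ {W} → c₂ (coordinates W) ≈ ρ * (- P₀₃ l) * x0 W + ρ * P₀₂ l * ξ₁ W → c₃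
            (coordinates W) ≈ ρ * P₃₁ l * x0 W + ρ * P₀₃ l * ξ₁ W →
                     OnLineH F W l
        on-line-if {W} e₂ e₃ = to-OnLine l (combination (proj₁ solved) (proj₂ solved)
          (dependent (proj₁ solved) (proj₂ solved) e₂ (slope₂ (first-point X Y)) (slope₂ (second-point X Y)))
          (dependent (proj₁ solved) (proj₂ solved) e₃ (slope₃ (first-point X Y)) (slope₃ (second-point X Y))))
          where
          solved : _
          solved = cramer {ρ} {x0 W} {c₀ X} {c₀ Y} {ξ₁ W} {c₁ X} {c₁ Y} (trans (*-comm ρ _) ρP≈1)

    -- A line with dual point (x, y, z) has the affine equations ξ₂ = y + x ξ₁ and ξ₃ = - z - y ξ₁.
    -- Read for a fixed point q, they say y = ξ₂ - ξ₁ x and z = - (ξ₃ + ξ₁ ξ₂) + ξ₁² x.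
    nullLineOf : V3 F → NullLine
    nullLineOf q = let W = embed F q in nullLine (- ξ₁ W) (ξ₂ W) (- (ξ₃ W + ξ₁ W * ξ₂ W))

    incidence : ∀ {l} (i : InComplex F N l) {ρ} (e : P₀₁ l * ρ ≈ 1#) q → _∈L_ F q l → On (dualPoint {l} i e)
        (nullLineOf q)
    incidence {l} i {ρ} e q o = equation₂ , (begin
        - (ρ * P₃₁ l)
          ≈⟨ solve 6 (λ u b v x y z → :- u := :- ((u :+ v :* x) :+ x :* y) :+ (v :* x :+ x :* y)) refl
              (ρ * P₃₁ l) b (ρ * P₀₃ l) (ξ₁ W) (ξ₂ W) (ξ₃ W) ⟩
        - ((ρ * P₃₁ l + ρ * P₀₃ l * ξ₁ W) + ξ₁ W * ξ₂ W) + (ρ * P₀₃ l * ξ₁ W + ξ₁ W * ξ₂ W)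
          ≈⟨ +-cong (-‿cong (+-congʳ (sym third))) (+-congˡ (*-congˡ second)) ⟩
        - (ξ₃ W + ξ₁ W * ξ₂ W) + (ρ * P₀₃ l * ξ₁ W + ξ₁ W * (ρ * (- P₀₃ l) + ρ * P₀₂ l * ξ₁ W))
          ≈⟨ solve 5 (λ k ρ p₂ p₃ x → k :+ (ρ :* p₃ :* x :+ x :* (ρ :*
              (:- p₃) :+ ρ :* p₂ :* x)) := k :+ :- x :* :- x :* (ρ :* p₂)) refl _ ρ (P₀₂ l) (P₀₃ l) (ξ₁ W) ⟩
        - (ξ₃ W + ξ₁ W * ξ₂ W) + - ξ₁ W * - ξ₁ W * (ρ * P₀₂ l) ∎)
      where
      W : V4 F
      W = embed F q
      b : Carrier
      b = ρ * (- P₀₃ l)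
      second : ξ₂ W ≈ ρ * (- P₀₃ l) + ρ * P₀₂ l * ξ₁ W
      second = trans (slope₂ {l} i e (from-OnLine l o)) (+-congʳ (*-identityʳ _))
      third : ξ₃ W ≈ ρ * P₃₁ l + ρ * P₀₃ l * ξ₁ W
      third = trans (slope₃ {l} i e (from-OnLine l o)) (+-congʳ (*-identityʳ _))
      equation₂ : b ≈ ξ₂ W + - ξ₁ W * (ρ * P₀₂ l)
      equation₂ = trans (solve 3 (λ b p x → b := (b :+ p :* x) :+ :- x :* p) refl b (ρ * P₀₂ l) (ξ₁ W)) (+-congʳ
          (sym second))

    nullLineOf-injective : ∀ q q′ → slope (nullLineOf q) ≈ slope (nullLineOf q′) → y₀ (nullLineOf q) ≈ y₀
        (nullLineOf q′) →
                           z₀ (nullLineOf q) ≈ z₀ (nullLineOf q′) → _≈3_ F q q′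
    nullLineOf-injective q q′ es ey ez = let _ , p , r , t = separates {embed F q} {embed F q′} refl e₁ ey e₃ in p , r , t
      where
      W W′ : V4 F
      W = embed F q
      W′ = embed F q′
      negate : ∀ {x y} → - x ≈ - y → x ≈ y
      negate {x} {y} e = trans (solve 1 (λ x → x := :- :- x) refl x) (trans (-‿cong e) (solve 1
          (λ x → :- :- x := x) refl y))
      e₁ : ξ₁ W ≈ ξ₁ W′
      e₁ = negate es
      e₃ : ξ₃ W ≈ ξ₃ W′
      e₃ = trans (solve 2 (λ x y → x := (x :+ y) :- y) refl (ξ₃ W) (ξ₁ W * ξ₂ W)) (trans (+-cong (negate ez)
          (-‿cong (*-cong e₁ ey)))
        (solve 2 (λ x y → (x :+ y) :- y := x) refl (ξ₃ W′) (ξ₁ W′ * ξ₂ W′)))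

    dualPoint-injective : ∀ {l l′} (i : InComplex F N l) (i′ : InComplex F N l′) {ρ ρ′} (e : P₀₁ l * ρ ≈ 1#)
        (e′ : P₀₁ l′ * ρ′ ≈ 1#) →
      px (dualPoint {l} i e) ≈ px (dualPoint {l′} i′ e′) → py (dualPoint {l} i e) ≈ py (dualPoint {l′} i′ e′) →
      pz (dualPoint {l} i e) ≈ pz (dualPoint {l′} i′ e′) → SameLine F l l′
    dualPoint-injective {l} {l′@(line X′ Y′ _)} i i′ {ρ} {ρ′} e e′ ex ey ez =
      transfer (first-point (coordinates X′) (coordinates Y′)) , transfer (second-point (coordinates X′)
          (coordinates Y′))
      where
      negate : ∀ {x y} → - x ≈ - y → y ≈ x
      negate {x} {y} e = trans (solve 1 (λ x → x := :- :- x) refl y) (trans (-‿cong (sym e)) (solve 1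
          (λ x → :- :- x := x) refl x))
      p₃ : ρ′ * P₀₃ l′ ≈ ρ * P₀₃ l
      p₃ = negate (trans (solve 2 (λ r p → :- (r :* p) := r :* :- p) refl ρ (P₀₃ l)) (trans ey (solve 2
          (λ r p → r :* :- p := :- (r :* p)) refl ρ′ (P₀₃ l′))))
      transfer : ∀ {W α β} → Combination (coordinates W) α (coordinates X′) β (coordinates Y′) → OnLineH F W l
      transfer {W} w = on-line-if {l} i e {W} (trans (slope₂ {l′} i′ e′ w) (+-cong (*-congʳ (sym ey)) (*-congʳ
          (sym ex))))
                                      (trans (slope₃ {l′} i′ e′ w) (+-cong (*-congʳ (negate ez)) (*-congʳ p₃)))

    module _ {l : Line F} (in-complex : InComplex F N l) (degenerate : P₀₁ l ≈ 0#) (q : V3 F) (q∈l : _∈L_ F q l) where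
      private
        X Y Q : Coordinates
        X = coordinates (pt₁ l)
        Y = coordinates (pt₂ l)
        Q = coordinates (embed F q)
        α₀ β₀ : Carrier
        α₀ = proj₁ q∈l
        β₀ = proj₁ (proj₂ q∈l)
        q-in : Combination Q α₀ X β₀ Y
        q-in = from-OnLine l q∈l

      pencil₁ : ∀ {W α β} → Combination W α X β Y → c₁ W ≈ c₁ Q * c₀ W
      pencil₁ {W} {α} {β} w = begin
        c₁ W
          ≈⟨ trans (in₁ w) (trans (sym (*-identityʳ _)) (*-congˡ (in₀ q-in))) ⟩
        (α * c₁ X + β * c₁ Y) * (α₀ * c₀ X + β₀ * c₀ Y)
          ≈⟨ solve 8 (λ α β a b x₀ x₁ y₀ y₁ → (α :* x₁ :+ β :* y₁) :* (a :* x₀ :+ b :* y₀)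
                := (a :* x₁ :+ b :* y₁) :* (α :* x₀ :+ β :* y₀) :+ (β :* a :- α :* b) :*
                    (x₀ :* y₁ :- x₁ :* y₀)) refl α β α₀ β₀ (c₀ X) (c₁ X) (c₀ Y) (c₁ Y) ⟩
        (α₀ * c₁ X + β₀ * c₁ Y) * (α * c₀ X + β * c₀ Y) + (β * α₀ - α * β₀) * P₀₁ l
          ≈⟨ +-cong (*-cong (sym (in₁ q-in)) (sym (in₀ w))) (trans (*-congˡ degenerate) (zeroʳ _)) ⟩
        c₁ Q * c₀ W + 0#
          ≈⟨ +-identityʳ _ ⟩
        c₁ Q * c₀ W ∎

      pencil₃ : ∀ {W α β} → Combination W α X β Y → c₃ W ≈ (c₃ Q - c₁ Q * c₂ Q) * c₀ W + c₁ Q * c₂ W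
      pencil₃ {W} {α} {β} w = begin
        c₃ W
          ≈⟨ solve 3 (λ q₃ w₀ w₃ → w₃ := (w₃ :- q₃ :* w₀) :+ q₃ :* w₀) refl (c₃ Q) (c₀ W) (c₃ W) ⟩
        (c₃ W - c₃ Q * c₀ W) + c₃ Q * c₀ W
          ≈⟨ +-congʳ (trans (+-congʳ (sym (*-identityˡ (c₃ W)))) conjugate) ⟩
        (c₁ Q * c₂ W - c₂ Q * c₁ W) + c₃ Q * c₀ W
          ≈⟨ +-congʳ (+-congˡ (-‿cong (*-congˡ (pencil₁ w)))) ⟩
        (c₁ Q * c₂ W - c₂ Q * (c₁ Q * c₀ W)) + c₃ Q * c₀ W
          ≈⟨ solve 5 (λ q₁ q₂ q₃ w₀ w₂ → (q₁ :* w₂ :- q₂ :* (q₁ :* w₀)) :+ q₃ :* w₀ :=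
              (q₃ :- q₁ :* q₂) :* w₀ :+ q₁ :* w₂) refl _ _ _ _ _ ⟩
        (c₃ Q - c₁ Q * c₂ Q) * c₀ W + c₁ Q * c₂ W ∎
        where
        det : Carrier
        det = α₀ * β - β₀ * α
        minor : ∀ q q′ w w′ x x′ y y′ → q ≈ α₀ * x + β₀ * y → q′ ≈ α₀ * x′ + β₀ * y′ → w ≈ α * x + β * y → w′
            ≈ α * x′ + β * y′ →
                q * w′ - q′ * w ≈ det * (x * y′ - x′ * y)
        minor q q′ w w′ x x′ y y′ eq eq′ ew ew′ = trans (+-cong (*-cong eq ew′) (-‿cong (*-cong eq′ ew)))
          (solve 8 (λ a b α β x x′ y y′ → (a :* x :+ b :* y) :* (α :* x′ :+ β :* y′) :- (a :* x′ :+ b :* y′) :*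
              (α :* x :+ β :* y)
              := (a :* β :- b :* α) :* (x :* y′ :- x′ :* y)) refl α₀ β₀ α β x x′ y y′)
        -- Each minor of Q and W is `det` times the corresponding minor of the two spanning points,
        -- so the relation P₀₃ = P₁₂ passes to Q and W.
        conjugate : 1# * c₃ W - c₃ Q * c₀ W ≈ c₁ Q * c₂ W - c₂ Q * c₁ W
        conjugate = trans (minor 1# (c₃ Q) (c₀ W) (c₃ W) _ _ _ _ (in₀ q-in) (in₃ q-in) (in₀ w) (in₃ w))
          (trans (*-congˡ (normal l in-complex)) (sym (minor (c₁ Q) (c₂ Q) (c₁ W) (c₂ W) _ _ _ _ (in₁ q-in)
              (in₂ q-in) (in₁ w) (in₂ w))))

      -- If P₀₁ = P₀₂ = 0, then P₀₃ = 0 by `pencil₃`. So the second spanning point is a multiple of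
      -- the first, or the first is zero: if its x₀ vanishes, that of the second does not, because l
      -- contains the affine point q.
      P₀₂≉0 : ¬ P₀₂ l ≈ 0#
      P₀₂≉0 e = ¬¬-dec {P = x0 (pt₁ l) ≈ 0#} λ
        { (no x₀≉0) → let ρ , x₀ρ≈1 = inverse _ x₀≉0
                          ratio : ∀ {x y} → c₀ X * y ≈ c₀ Y * x → y ≈ (c₀ Y * ρ) * x
                          ratio {x} {y} h = trans (trans (sym (*-identityˡ y)) (*-congʳ (sym x₀ρ≈1))) (trans
                            (solve 3 (λ a r y → a :* r :* y := r :* (a :* y)) refl (c₀ X) ρ y) (trans (*-congˡ h)
                            (solve 3 (λ r b x → r :* (b :* x) := b :* r :* x) refl ρ (c₀ Y) x)))
                      in proj₂ (proj₂ (distinct l)) (c₀ Y * ρ , separates (ratio (*-comm (c₀ X) (c₀ Y)))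
                           (scaled is₁ (c₀ Y * ρ) (ratio cross₁)) (scaled is₂ (c₀ Y * ρ) (ratio cross₂))
                               (scaled is₃ (c₀ Y * ρ) (ratio cross₃)))
        ; (yes x₀≈0) → proj₁ (distinct l) (separates x₀≈0 (vanish is₁ x₀≈0 cross₁) (vanish is₂ x₀≈0 cross₂)
            (vanish is₃ x₀≈0 cross₃)) }
        where
        flip : ∀ {x y} → c₀ X * y - x * c₀ Y ≈ 0# → c₀ X * y ≈ c₀ Y * x
        flip {x} {y} h = trans (solve 2 (λ u v → u := (u :- v) :+ v) refl (c₀ X * y) (x * c₀ Y)) (trans
            (+-congʳ h) (trans (+-identityˡ _) (*-comm x (c₀ Y))))
        cross₁ : c₀ X * c₁ Y ≈ c₀ Y * c₁ X
        cross₁ = flip degenerate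
        cross₂ : c₀ X * c₂ Y ≈ c₀ Y * c₂ X
        cross₂ = flip e
        cross₃ : c₀ X * c₃ Y ≈ c₀ Y * c₃ X
        cross₃ = trans (*-congˡ (pencil₃ (second-point X Y))) (trans
          (solve 5 (λ x₀ y₀ y₂ u v → x₀ :* (u :* y₀ :+ v :* y₂) := y₀ :* (u :* x₀) :+ v :* (x₀ :* y₂)) refl
              (c₀ X) (c₀ Y) (c₂ Y) (c₃ Q - c₁ Q * c₂ Q) (c₁ Q))
          (trans (+-congˡ (*-congˡ cross₂)) (trans
          (solve 5 (λ x₀ y₀ x₂ u v → y₀ :* (u :* x₀) :+ v :* (y₀ :* x₂) := y₀ :* (u :* x₀ :+ v :* x₂)) refl
              (c₀ X) (c₀ Y) (c₂ X) (c₃ Q - c₁ Q * c₂ Q) (c₁ Q))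
          (*-congˡ (sym (pencil₃ (first-point X Y)))))))
        scale-form : ∀ {ξ} → (ξ ≡ ξ₁ ⊎ ξ ≡ ξ₂ ⊎ ξ ≡ ξ₃) → ∀ t Z → ξ (_·4_ F t Z) ≈ t * ξ Z
        scale-form {ξ} is t Z = trans (ξ-cong ξ is (pad _ , pad _ , pad _ , pad _)) (trans
            (linear ξ is t Z 0# Z) (sym (pad _)))
          where
          pad : ∀ x {y} → x ≈ x + 0# * y
          pad x {y} = solve 2 (λ x y → x := x :+ :0 :* y) refl x y
        scaled : ∀ {ξ} → (ξ ≡ ξ₁ ⊎ ξ ≡ ξ₂ ⊎ ξ ≡ ξ₃) → ∀ t → ξ (pt₂ l) ≈ t * ξ (pt₁ l) → ξ (pt₂ l) ≈ ξ (_·4_ F t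
            (pt₁ l))
        scaled is t h = trans h (sym (scale-form is t (pt₁ l)))
        zero-form : ∀ {ξ} → (ξ ≡ ξ₁ ⊎ ξ ≡ ξ₂ ⊎ ξ ≡ ξ₃) → ξ (v4 0# 0# 0# 0#) ≈ 0#
        zero-form {ξ} is = trans (ξ-cong ξ is (sym (zeroˡ _) , sym (zeroˡ _) , sym (zeroˡ _) , sym (zeroˡ _)))
            (trans (scale-form is 0# (pt₁ l)) (zeroˡ _))
        vanish : ∀ {ξ} → (ξ ≡ ξ₁ ⊎ ξ ≡ ξ₂ ⊎ ξ ≡ ξ₃) → c₀ X ≈ 0# → c₀ X * ξ (pt₂ l) ≈ c₀ Y * ξ (pt₁ l) → ξ
            (pt₁ l) ≈ ξ (v4 0# 0# 0# 0#)
        vanish is x₀≈0 h = trans (cancelˡ y₀≉0 (trans (sym h) (trans (*-congʳ x₀≈0) (zeroˡ _)))) (sym (zero-form is))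
          where
          y₀≉0 : ¬ c₀ Y ≈ 0#
          y₀≉0 y₀≈0 = 1≉0 (trans (in₀ q-in) (trans (+-cong (trans (*-congˡ x₀≈0) (zeroʳ _)) (trans
              (*-congˡ y₀≈0) (zeroʳ _))) (+-identityʳ 0#)))

      on-degenerate : ∀ {W} → ξ₁ W ≈ c₁ Q * x0 W → ξ₃ W ≈ (c₃ Q - c₁ Q * c₂ Q) * x0 W + c₁ Q * ξ₂ W → OnLineH F W l
      on-degenerate {W} e₁ e₃ = to-OnLine l (combination (proj₁ solved)
        (dependent (proj₁ solved) (proj₂ solved) (pad e₁) (pad (pencil₁ (first-point X Y))) (pad (pencil₁
            (second-point X Y))))
        (proj₂ solved)
        (dependent (proj₁ solved) (proj₂ solved) e₃ (pencil₃ (first-point X Y)) (pencil₃ (second-point X Y))))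
        where
        ρ : Σ Carrier λ ρ → P₀₂ l * ρ ≈ 1#
        ρ = inverse _ P₀₂≉0
        solved : _
        solved = cramer {proj₁ ρ} {x0 W} {c₀ X} {c₀ Y} {ξ₂ W} {c₂ X} {c₂ Y} (trans (*-comm (proj₁ ρ) _) (proj₂ ρ))
        pad : ∀ {x y z} → x ≈ y → x ≈ y + 0# * z
        pad {z = z} e = trans e (solve 2 (λ y z → y := y :+ :0 :* z) refl _ z)

    -- All lines of the complex through q lie in the polar plane of q, and those with P₀₁ = 0 also
    -- lie in the plane ξ₁ = ξ₁(q) x₀. The two planes meet in one line; `pencil₁` and `pencil₃` are
    -- its equations.
    degenerate-unique : ∀ {l l′} → InComplex F N l → InComplex F N l′ → P₀₁ l ≈ 0# → P₀₁ l′ ≈ 0# → ∀ q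
        → _∈L_ F q l → _∈L_ F q l′ → SameLine F l l′
    degenerate-unique {l} {l′@(line X′ Y′ _)} i i′ d d′ q o o′ =
      transfer (first-point (coordinates X′) (coordinates Y′)) , transfer (second-point (coordinates X′)
          (coordinates Y′))
      where
      transfer : ∀ {W α β} → Combination (coordinates W) α (coordinates X′) β (coordinates Y′) → OnLineH F W l
      transfer {W} w = on-degenerate {l} i d q o {W} (pencil₁ {l′} i′ d′ q o′ w) (pencil₃ {l′} i′ d′ q o′ w)

-- Double negation and the final count

¬¬-map : ∀ {p q} {P : Set p} {Q : Set q} → (P → Q) → ¬ ¬ P → ¬ ¬ Q
¬¬-map f h k = h (k ∘ f)

¬¬-map₂ : ∀ {p q r} {P : Set p} {Q : Set q} {R : Set r} → (P → Q → R) → ¬ ¬ P → ¬ ¬ Q → ¬ ¬ R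
¬¬-map₂ f g h k = g λ p → h λ q → k (f p q)

¬¬-Fin : ∀ {n p} {P : Fin n → Set p} → (∀ i → ¬ ¬ P i) → ¬ ¬ (∀ i → P i)
¬¬-Fin {zero}          h k = k λ ()
¬¬-Fin {suc n} {P = P} h k = h zero λ p → ¬¬-Fin (h ∘ suc) λ ps → k λ { zero → p ; (suc i) → ps i }

-- Since the goal is a decidable inequality, nothing is lost by weakening the equality of the field.
stabilize : ∀ {c ℓ} → Field c ℓ → Field c ℓ
stabilize F = record
  { commRing = record
    { Carrier = Carrier ; _≈_ = λ x y → ¬ ¬ x ≈ y ; _+_ = _+_ ; _*_ = _*_ ; -_ = -_ ; 0# = 0# ; 1# = 1#
    ; isCommutativeRing = record
      { isRing = record
        { +-isAbelianGroup = record
          { isGroup = record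
            { isMonoid = record
              { isSemigroup = record
                { isMagma = record
                  { isEquivalence = record { refl = η refl ; sym = ¬¬-map sym ; trans = ¬¬-map₂ trans }
                  ; ∙-cong = ¬¬-map₂ +-cong }
                ; assoc = λ x y z → η (+-assoc x y z) }
              ; identity = (λ x → η (+-identityˡ x)) , (λ x → η (+-identityʳ x)) }
            ; inverse = (λ x → η (-‿inverseˡ x)) , (λ x → η (-‿inverseʳ x))
            ; ⁻¹-cong = ¬¬-map -‿cong }
          ; comm = λ x y → η (+-comm x y) }
        ; *-cong = ¬¬-map₂ *-cong
        ; *-assoc = λ x y z → η (*-assoc x y z)
        ; *-identity = (λ x → η (*-identityˡ x)) , (λ x → η (*-identityʳ x))
        ; distrib = (λ x y z → η (distribˡ x y z)) , (λ x y z → η (distribʳ x y z)) }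
      ; *-comm = λ x y → η (*-comm x y) } }
  ; 1≉0 = η 1≉0
  ; inverse = λ x x≉0 → let y , e = inverse x (x≉0 ∘ η) in y , η e }
  where
  open Field F hiding (zero)
  η : ∀ {p} {P : Set p} → P → ¬ ¬ P
  η p k = k p

stabilize-stable : ∀ {c ℓ} (F : Field c ℓ) → Stable (stabilize F)
stabilize-stable F h k = h λ e → e k

module Characteristic {c ℓ} (F : Field c ℓ) where
  open Field F hiding (zero)
  private
    module F′ = FieldPolynomials (stabilize F)
    module S′ = Sequences (Field.commRing (stabilize F))

  ι≡ : ∀ i → ι F i ≡ i S′.·ₙ 1#
  ι≡ zero    = ≡.refl
  ι≡ (suc i) = ≡.cong (1# +_) (ι≡ i)

  exceeds : ∀ {p d} → HasChar F p → (0 < p → d < p) → F′.CharExceeds d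
  exceeds {zero}  char small i i<d e = e λ z → char i (trans (reflexive (ι≡ (suc i))) z)
  exceeds {suc q} char small i i<d e = e λ z → proj₂ char i (<-≤-trans i<d (≤-pred (small (s≤s z≤n)))) (trans
      (reflexive (ι≡ (suc i))) z)

  two≉0 : ∀ {p} → HasChar F p → p ≢ 2 → ¬ ¬ ¬ 1# + 1# ≈ 0#
  two≉0 {zero}              char p≢2 k = k λ e → char 1 (trans (+-congˡ (+-identityʳ 1#)) e)
  two≉0 {suc zero}          char p≢2 k = 1≉0 (trans (sym (+-identityʳ 1#)) (proj₁ char))
  two≉0 {suc (suc zero)}    char p≢2 k = p≢2 ≡.refl
  two≉0 {suc (suc (suc q))} char p≢2 k = k λ e → proj₂ char 1 (s≤s (s≤s z≤n)) (trans (+-congˡ (+-identityʳ 1#)) e)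

module CountingPairs {m n : ℕ} where
  open Counting
  open DecMembership (≡-dec (Fin._≟_ {m}) (Fin._≟_ {n})) using (_∈?_)

  private
    term≤sum : ∀ {n} (f : Fin n → ℕ) i → f i ≤ sum f
    term≤sum {suc n} f zero    = m≤m+n _ _
    term≤sum {suc n} f (suc i) = ≤-trans (term≤sum (f ∘ suc) i) (m≤n+m _ (f zero))

  members : List (Fin m × Fin n) → ℕ
  members I = sum λ a → count λ b → (a , b) ∈? I

  length≤members : ∀ I → Unique I → length I ≤ members I
  length≤members []            _            = z≤n
  length≤members ((a₀ , b₀) ∷ I) (fresh ∷ uniq) = begin
    suc (length I)
      ≤⟨ s≤s (length≤members I uniq) ⟩
    1 ℕ.+ members I
      ≤⟨ ℕₚ.+-monoˡ-≤ (members I) (≤-trans (≤-trans (≤-reflexive (≡.sym (ind-true (is? a₀ b₀) ≡.refl)))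
          (term≤sum (λ b → ind (is? a₀ b)) b₀))
           (term≤sum (λ a → count (is? a)) a₀)) ⟩
    sum (λ a → count (is? a)) ℕ.+ members I
      ≡⟨ ∑-distrib-+ (λ a → count (is? a)) (λ a → count λ b → (a , b) ∈? I) ⟨
    sum (λ a → count (is? a) ℕ.+ count (λ b → (a , b) ∈? I))
      ≡⟨ sum-cong-≗ (λ a → ∑-distrib-+ (λ b → ind (is? a b)) (λ b → ind ((a , b) ∈? I))) ⟨
    sum (λ a → sum λ b → ind (is? a b) ℕ.+ ind ((a , b) ∈? I))
      ≤⟨ sum-mono _ _ (λ a → sum-mono _ _ (λ b → step a b)) ⟩
    members ((a₀ , b₀) ∷ I) ∎
    where
    open ℕₚ.≤-Reasoning
    is? : ∀ a b → Dec ((a , b) ≡ (a₀ , b₀))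
    is? a b = ≡-dec Fin._≟_ Fin._≟_ (a , b) (a₀ , b₀)
    fresh′ : (a₀ , b₀) ∉ I
    fresh′ x∈I = All.lookup fresh x∈I ≡.refl
    step : ∀ a b → ind (is? a b) ℕ.+ ind ((a , b) ∈? I) ≤ ind ((a , b) ∈? ((a₀ , b₀) ∷ I))
    step a b = ind-disjoint (is? a b) ((a , b) ∈? I) ((a , b) ∈? ((a₀ , b₀) ∷ I))
        (λ { ≡.refl x∈I → fresh′ x∈I }) here there

module Incidences {c ℓ} (F : Field c ℓ) (p : ℕ) (char : HasChar F p) (p≢2 : p ≢ 2) (N : V6 F) {n m : ℕ} (L : Fin
    (suc n) → Line F)
  (L-distinct : ∀ i j → i ≢ j → ¬ SameLine F (L i) (L j)) (L-complex : ∀ i → InComplex F N (L i))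
  (small : 0 < p → suc n ℕ.^ 3 ≤ p ℕ.^ 4) (Q : Fin (suc m) → V3 F) (Q-distinct : ∀ i j → i ≢ j → ¬ _≈3_ F (Q i) (Q j))
  (I : List (Fin (suc m) × Fin (suc n))) (unique : Unique I) (incident : ∀ {a b} → (a , b) ∈ I → _∈L_ F (Q a) (L b)) where
  open Field F hiding (zero)
  open Counting
  open Numerics
  open LineComplex F
  open DecMembership (≡-dec (Fin._≟_ {suc m}) (Fin._≟_ {suc n})) using (_∈?_)
  private
    F′ : Field c ℓ
    F′ = stabilize F
    module G′ = NullGeometry F′
    open Field F′ using () renaming (_≈_ to _≈′_)

  module _ (frame : Frame N) (degenerate? : ∀ b → Dec (Dual.P₀₁ frame (L b) ≈ 0#)) where
    open Dual frame

    Good : Fin (suc n) → Set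
    Good b = False (degenerate? b)

    good? : ∀ b → Dec (Good b)
    good? b with degenerate? b
    ... | yes _ = no λ ()
    ... | no _  = yes tt

    bad : ∀ {b} → ¬ Good b → P₀₁ (L b) ≈ 0#
    bad {b} ¬good with degenerate? b
    ... | yes e = e
    ... | no _  = ⊥-elim (¬good tt)

    G : Fin (suc m) → Fin (suc n) → Set
    G a b = Good b × (a , b) ∈ I

    G? : ∀ a b → Dec (G a b)
    G? a b = good? b ×-dec ((a , b) ∈? I)

    line′ : Fin (suc m) → G′.NullLine
    line′ a = let l = nullLineOf (Q a) in G′.nullLine (slope l) (y₀ l) (z₀ l)
      where open NullGeometry F

    dual : ∀ l → InComplex F N l → Dec (P₀₁ l ≈ 0#) → NullGeometry.Point F
    -- A placeholder that keeps the points indexed by all lines; `G` has no incidence with a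
    -- degenerate line.
    dual l i (yes _)  = NullGeometry.point 0# 0# 0#
    dual l i (no P≉0) = dualPoint {l} i (proj₂ (inverse _ P≉0))

    pointOf : Fin (suc n) → NullGeometry.Point F
    pointOf b = dual (L b) (L-complex b) (degenerate? b)

    point′ : Fin (suc n) → G′.Point
    point′ b = G′.point (px (pointOf b)) (py (pointOf b)) (pz (pointOf b))
      where open NullGeometry F

    on : ∀ {a b} → G a b → NullGeometry.On F (pointOf b) (nullLineOf (Q a))
    on {a} {b} (good , ab∈I) with degenerate? b
    ... | no P≉0 = incidence {L b} (L-complex b) (proj₂ (inverse _ P≉0)) (Q a) (incident ab∈I)

    on′ : ∀ {a b} → G a b → G′.On (point′ b) (line′ a)
    on′ {a} {b} g = (λ k → k (proj₁ (on {a} {b} g))) , (λ k → k (proj₂ (on {a} {b} g)))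

    -- Equations in F′ are doubly negated. Indices can be compared, so it remains to derive a
    -- contradiction, and for that the negations can be stripped.
    line-injective : ∀ a a′ → G′.slope (line′ a) ≈′ G′.slope (line′ a′) → G′.y₀ (line′ a) ≈′ G′.y₀ (line′ a′) →
                     G′.z₀ (line′ a) ≈′ G′.z₀ (line′ a′) → a ≡ a′
    line-injective a a′ es ey ez with a Fin.≟ a′
    ... | yes e = e
    ... | no ne = ⊥-elim (es λ es → ey λ ey → ez λ ez → Q-distinct a a′ ne (nullLineOf-injective (Q a)
        (Q a′) es ey ez))

    point-injective : ∀ b b′ → Good b → Good b′ → G′.px (point′ b) ≈′ G′.px (point′ b′) → G′.py
        (point′ b) ≈′ G′.py (point′ b′) →
                      G′.pz (point′ b) ≈′ G′.pz (point′ b′) → b ≡ b′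
    point-injective b b′ good good′ ex ey ez with b Fin.≟ b′ | degenerate? b | degenerate? b′
    ... | yes e | _      | _       = e
    ... | no ne | no P≉0 | no P′≉0 = ⊥-elim (ex λ ex → ey λ ey → ez λ ez → L-distinct b b′ ne
      (dualPoint-injective {L b} {L b′} (L-complex b) (L-complex b′) (proj₂ (inverse _ P≉0)) (proj₂
          (inverse _ P′≉0)) ex ey ez))

    all-rows? : (a : Fin (suc m)) → Dec ⊤
    all-rows? _ = yes tt

    all-cols? : (b : Fin (suc n)) → Dec ⊤
    all-cols? _ = yes tt

    count-all : ∀ k → count {k} (λ _ → yes tt) ≡ k
    count-all k = ≡.trans (sum-const k 1) (ℕₚ.*-identityʳ k)

    length≤edges : length I ≤ Pruning.edges all-rows? all-cols? G? ℕ.+ suc m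
    length≤edges = begin
      length I
        ≤⟨ CountingPairs.length≤members I unique ⟩
      sum (λ a → count λ b → (a , b) ∈? I)
        ≤⟨ sum-mono _ _ (λ a → row a) ⟩
      sum (λ a → 1 ℕ.* count (λ b → yes tt ×-dec G? a b) ℕ.+ 1)
        ≡⟨ ∑-distrib-+ (λ a → 1 ℕ.* count (λ b → yes tt ×-dec G? a b)) (λ _ → 1) ⟩
      Pruning.edges all-rows? all-cols? G? ℕ.+ sum {suc m} (λ _ → 1)
        ≡⟨ ≡.cong (Pruning.edges all-rows? all-cols? G? ℕ.+_) (≡.trans (sum-const (suc m) 1) (ℕₚ.*-identityʳ
            (suc m))) ⟩
      Pruning.edges all-rows? all-cols? G? ℕ.+ suc m ∎
      where
      open ℕₚ.≤-Reasoning
      bad? : ∀ a b → Dec (¬ Good b × (a , b) ∈ I)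
      bad? a b = ¬? (good? b) ×-dec ((a , b) ∈? I)
      bad-unique : ∀ a b b′ → ¬ Good b × (a , b) ∈ I → ¬ Good b′ × (a , b′) ∈ I → b ≡ b′
      bad-unique a b b′ (β , ab) (β′ , ab′) with b Fin.≟ b′
      ... | yes e = e
      ... | no ne = ⊥-elim (L-distinct b b′ ne (degenerate-unique {L b} {L b′} (L-complex b) (L-complex b′) (bad
          {b} β) (bad {b′} β′) (Q a) (incident ab) (incident ab′)))
      split : ∀ a b → (a , b) ∈ I → (⊤ × G a b) ⊎ (¬ Good b × (a , b) ∈ I)
      split a b ab with good? b
      ... | yes g = inj₁ (tt , g , ab)
      ... | no ¬g = inj₂ (¬g , ab)
      row : ∀ a → count (λ b → (a , b) ∈? I) ≤ 1 ℕ.* count (λ b → yes tt ×-dec G? a b) ℕ.+ 1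
      row a = ≤-trans (count-⊎ (λ b → (a , b) ∈? I) (λ b → yes tt ×-dec G? a b) (bad? a) (split a))
        (ℕₚ.+-mono-≤ (≤-reflexive (≡.sym (ℕₚ.*-identityˡ _))) (count-≤1 (bad? a) (bad-unique a)))

    private
      two-≉0 : ¬ 1# + 1# ≈ 0# → ¬ 1# + 1# ≈′ 0#
      two-≉0 two e = e two

      module _ (two : ¬ 1# + 1# ≈ 0#) where
        open NullTriples F′ (stabilize-stable F) (two-≉0 two)

        rows-injective : ∀ {a a′ b b′} → G a b → G a′ b′ → SameNullLine (line′ a) (line′ a′) → a ≡ a′
        rows-injective {a} {a′} _ _ (es , ey , ez) = line-injective a a′ es ey ez

        columns-injective : ∀ {a a′ b b′} → G a b → G a′ b′ → SamePoint (point′ b) (point′ b′) → b ≡ b′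
        columns-injective {b = b} {b′} (g , _) (g′ , _) (ex , ey , ez) = point-injective b b′ g g′ ex ey ez

    -- The box has side M = HV with H = suc h. The neighbour count bounds Hr, the hypothesis on n
    -- turns this into 3Hr < p, and so the degree is below p as `too-rich` demands.
    not-too-rich : ¬ 1# + 1# ≈ 0# → ∀ h r → 18 ≤ r → Pruning.Pruned G (10 ℕ.* suc h) r → ¬ 16 ℕ.* suc n ≤ r ℕ.*
        (suc h ℕ.* (suc h ℕ.* suc h))
    not-too-rich two h r 18≤r pruned big =
      too-rich (suc h ℕ.* suc q) (suc q) (2 ℕ.* suc q ℕ.+ 1)
        (Characteristic.exceeds F char λ 0<p → degree-small h q 4v≤r (below-characteristic {suc h ℕ.* r} {suc n}
            {p} 0<x 0<p cube (small 0<p)))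
        (wronskian-degree h q) (pencil-degree h q) (rich h q 4v≤r) (line-degree h q) (few-conditions h q (suc n) few)
      where
      open NullIncidences F′ (stabilize-stable F) (two-≉0 two) line′ point′ on′ (rows-injective two) (columns-injective two) pruned
      choice : Σ ℕ _
      choice = choose-v h (suc n) r 18≤r big
      q : ℕ
      q = proj₁ choice
      few : suc n ℕ.+ suc n < suc h ℕ.* (suc h ℕ.* suc h) ℕ.* suc q
      few = proj₁ (proj₂ choice)
      4v≤r : 4 ℕ.* suc q ℕ.+ 5 ≤ r
      4v≤r = proj₂ (proj₂ choice)
      0<x : 0 < suc h ℕ.* r
      0<x = ℕₚ.*-mono-≤ (s≤s (z≤n {h})) (≤-trans (s≤s z≤n) 18≤r)
      cube : 70 ℕ.* (suc h ℕ.* r ℕ.* (suc h ℕ.* r) ℕ.* (suc h ℕ.* r)) ≤ suc n ℕ.* suc n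
      cube = neighbour-cube h r (suc n) (≤-trans (s≤s (s≤s z≤n)) 18≤r) (neighbour-bound (s≤s z≤n))

    bound : ¬ 1# + 1# ≈ 0# → 68 ℕ.* (suc m ℕ.+ suc n) < length I →
            ∀ {C} → 6 ℕ.* (60 ℕ.* (60 ℕ.* 60)) ℕ.* 16 ≤ C → length I ℕ.^ 4 ≤ C ℕ.* (suc m ℕ.^ 3 ℕ.* suc n ℕ.^ 2)
    bound two large C-large =
      let h , r , dense , 18≤r , I≤mh , I≤nr = thresholds {length I} {m} {n} large
          pruned = Pruning.prune G? (10 ℕ.* suc h) r _ all-rows? all-cols? ≤-refl
            (ℕₚ.+-cancelʳ-< (suc m) _ _ (<-≤-trans (≤-<-trans
              (≤-reflexive (≡.cong₂ (λ x y → 10 ℕ.* suc h ℕ.* x ℕ.+ r ℕ.* y ℕ.+ suc m) (count-all (suc m))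
                  (count-all (suc n)))) dense) length≤edges))
      in fourth-power-bound {length I} {suc m} {suc n} {suc h} {r} {6} {60} {16} I≤mh I≤nr (<⇒≤ (≰⇒>
          (not-too-rich two h r 18≤r pruned))) C-large

  module _ (N∉K : NotOnKlein F N) where
    incidence-bound : 68 ℕ.* (suc m ℕ.+ suc n) < length I →
                      ∀ {C} → 6 ℕ.* (60 ℕ.* (60 ℕ.* 60)) ℕ.* 16 ≤ C → ¬ ¬ (length I ℕ.^ 4 ≤ C ℕ.*
                          (suc m ℕ.^ 3 ℕ.* suc n ℕ.^ 2))
    incidence-bound large C-large k = frame-exists N N∉K λ frame → ¬¬-Fin (λ b → ¬¬-dec) λ degenerate? →
      Characteristic.two≉0 F char p≢2 λ two → k (bound frame degenerate? two large C-large)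

opaque
  -- 68⁴ = 21381376 just exceeds 6 · 60³ · 16 = 20736000, the constant of the case of many
  -- incidences. So 68 can serve both there and as the threshold below which the linear terms m + n
  -- suffice.
  constant : ℕ
  constant = 68 ℕ.^ 4

  constant≡ : constant ≡ 68 ℕ.^ 4
  constant≡ = ≡.refl

  constant-large : 6 ℕ.* (60 ℕ.* (60 ℕ.* 60)) ℕ.* 16 ≤ constant
  constant-large = ℕₚ.≤ᵇ⇒≤ _ _ _

open import Data.Nat using (_+_; _*_; _^_; _≤_; _<_)

theorem4 : ∃Const λ C →
    ∀ {c ℓ} (F : Field c ℓ) (p : ℕ) → HasChar F p → p ≢ 2 →
    (N : V6 F) → NotOnKlein F N →
    (n : ℕ) (L : Fin n → Line F) →
    (∀ i j → i ≢ j → ¬ SameLine F (L i) (L j)) →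
    (∀ i → InComplex F N (L i)) →
    (0 < p → n ^ 3 ≤ p ^ 4) →
    (m : ℕ) (Q : Fin m → V3 F) →
    (∀ i j → i ≢ j → ¬ _≈3_ F (Q i) (Q j)) →
    (I : List (Fin m × Fin n)) → Unique I →
    All (λ { (a , b) → _∈L_ F (Q a) (L b) }) I →
    length I ^ 4 ≤ C * (m ^ 3 * n ^ 2 + (m + n) ^ 4)
theorem4 = constant ,ω λ
  { F p char p≢2 N N∉K n L Ld Lc small m Q Qd [] uniq incident → z≤n
  ; F p char p≢2 N N∉K zero L Ld Lc small m Q Qd ((_ , ()) ∷ _) uniq incident
  ; F p char p≢2 N N∉K (suc n) L Ld Lc small (suc m) Q Qd I@(_ ∷ _) uniq incident →
      decidable-stable (length I ^ 4 ℕ.≤? _) λ ¬le →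
        Incidences.incidence-bound F p char p≢2 N L Ld Lc small Q Qd I uniq (All.lookup incident) N∉K
          -- If the bound fails, then already 68⁴ (m + n)⁴ < I⁴, which puts I above the threshold.
          (Numerics.fourth-root {68} {suc m + suc n} {length I} (≤-<-trans (≤-trans
            (ℕₚ.*-monoˡ-≤ ((suc m + suc n) ^ 4) (≤-reflexive (≡.sym constant≡)))
            (ℕₚ.*-monoʳ-≤ constant (m≤n+m _ (suc m ^ 3 * suc n ^ 2)))) (≰⇒> ¬le)))
          constant-large
          λ le → ¬le (≤-trans le (ℕₚ.*-monoʳ-≤ constant (m≤m+n _ _))) }
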